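{- Let $\mathcal{M}=(M,+,<,\dots)$ be an $\aleph_0$-saturated weakly o-minimal expansion of an ordered group. Then: (1) $\mathcal{M}^{\mathrm{eq}}$ has uniform finiteness if and only if the collection of definable convex subgroups of $(M,+)$ has uniform finiteness. (2) If, moreover, $\mathcal{M}$ is an expansion of an ordered field, then $\mathcal{M}^{\mathrm{eq}}$ has uniform finiteness if and only if the collection of definable convex valuation subrings of $M$ has uniform finiteness.
   Context: A linearly ordered structure $\mathcal{M}$ is weakly o-minimal if every definable subset of $M$ is a finite union of convex sets. (Since $\mathcal{M}$ is $\aleph_0$-saturated, its theory is then weakly o-minimal.) Convention: "definable" means definable in $\mathcal{M}^{\mathrm{eq}}$, with parameters. A definable set $X$ (in $\mathcal{M}^{\mathrm{eq}}$) has uniform finiteness if for every definable family $\{Y_t\subseteq X: t\in T\}$ there is $n\in\mathbb{N}$ such that for all $t\in T$: $|Y_t|=\infty \iff |Y_t|>n$. We say that $\mathcal{M}^{\mathrm{eq}}$ has uniform finiteness if every definable set in $\mathcal{M}^{\mathrm{eq}}$ has uniform finiteness. Let $\mathcal{D}$ be a (not necessarily definable) collection of definable subsets of $\bigcup_n M^n$. A definable set $X$ (in $\mathcal{M}^{\mathrm{eq}}$) is a set of imaginaries from $\mathcal{D}$ if there is a definable relation $R\subseteq X\times M^n$ such that the map $x\mapsto R_x:=\{m\in M^n:(x,m)\in R\}$ is injective and $R_x\in\mathcal{D}$ for every $x\in X$. The collection $\mathcal{D}$ has uniform finiteness if every definable set of imaginaries from $\mathcal{D}$ has uniform finiteness.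 -}

module Defs where

open import Level using (Level; suc)
open import Data.Empty.Polymorphic using (⊥)
open import Data.Fin using (Fin)
open import Data.List using (List; []; _∷_; _++_; map; length; replicate)
open import Data.List.Membership.Propositional using (_∈_)
open import Data.List.Relation.Unary.All as All using (All; []; _∷_)
open import Data.List.Relation.Unary.All.Properties using (++⁺; ++⁻; map⁻)
open import Data.List.Relation.Unary.Any using (here; there)
open import Data.Nat as ℕ using (ℕ)
open import Data.Product using (Σ; Σ-syntax; ∃-syntax; _×_; _,_; proj₁; proj₂; uncurry)
open import Data.Sum using (_⊎_)
open import Data.Unit.Polymorphic using (⊤; tt)
open import Function.Bundles using (_⇔_; Inverse; Injection)
open import Relation.Binary using (Rel; REL; Setoid; IsEquivalence; IsStrictTotalOrder)
import Relation.Binary.Construct.On as On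
open import Relation.Binary.PropositionalEquality as ≡ using (_≡_)
open import Relation.Nullary using (¬_)
open import Relation.Unary using (Pred; _≐_)
open import Algebra.Structures using (IsGroup; IsCommutativeRing)

private
  variable
    ℓ : Level

record Signature (ℓ : Level) : Set (suc ℓ) where
  field
    Sort   : Set ℓ
    FunSym : List Sort → Sort → Set ℓ
    RelSym : List Sort → Set ℓ

record Language (ℓ : Level) : Set (suc ℓ) where
  field
    FunSym : ℕ → Set ℓ
    RelSym : ℕ → Set ℓ

oneSorted : Language ℓ → Signature ℓ
oneSorted L = record
  { Sort   = ⊤
  ; FunSym = λ ss _ → Language.FunSym L (length ss)
  ; RelSym = λ ss → Language.RelSym L (length ss)
  }

-- Carriers are setoids so that the quotient sorts of 𝓜ᵉᑫ are available;
-- the setoid equality is the equality of the structure.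

module _ {S : Set ℓ} (C : S → Setoid ℓ ℓ) where

  Tuple : List S → Set ℓ
  Tuple = All (λ s → Setoid.Carrier (C s))

  infixr 5 _∷_
  data TupleEq : ∀ {ss} → Rel (Tuple ss) ℓ where
    []  : TupleEq [] []
    _∷_ : ∀ {s ss x y} {xs ys : Tuple ss} →
          Setoid._≈_ (C s) x y → TupleEq xs ys →
          TupleEq {s ∷ ss} (x ∷ xs) (y ∷ ys)

  tupleEq-refl : ∀ {ss} {xs : Tuple ss} → TupleEq xs xs
  tupleEq-refl {xs = []}              = []
  tupleEq-refl {ss = s ∷ _} {x ∷ xs} = Setoid.refl (C s) ∷ tupleEq-refl

  tupleEq-sym : ∀ {ss} {xs ys : Tuple ss} → TupleEq xs ys → TupleEq ys xs
  tupleEq-sym []                    = []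
  tupleEq-sym {ss = s ∷ _} (p ∷ ps) = Setoid.sym (C s) p ∷ tupleEq-sym ps

  tupleEq-trans : ∀ {ss} {xs ys zs : Tuple ss} →
                  TupleEq xs ys → TupleEq ys zs → TupleEq xs zs
  tupleEq-trans []                    []       = []
  tupleEq-trans {ss = s ∷ _} (p ∷ ps) (q ∷ qs) =
    Setoid.trans (C s) p q ∷ tupleEq-trans ps qs

  tupleSetoid : List S → Setoid ℓ ℓ
  tupleSetoid ss = record
    { Carrier       = Tuple ss
    ; _≈_           = TupleEq
    ; isEquivalence = record
      { refl = tupleEq-refl ; sym = tupleEq-sym ; trans = tupleEq-trans }
    }

  tupleEq-lookup : ∀ {s ss} {xs ys : Tuple ss} → TupleEq xs ys →
                   (v : s ∈ ss) → Setoid._≈_ (C s) (All.lookup xs v) (All.lookup ys v)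
  tupleEq-lookup (p ∷ ps) (here ≡.refl) = p
  tupleEq-lookup (p ∷ ps) (there v)     = tupleEq-lookup ps v

  tupleEq-++ : ∀ {ss ts} {xs xs′ : Tuple ss} {ys ys′ : Tuple ts} →
               TupleEq xs xs′ → TupleEq ys ys′ → TupleEq (++⁺ xs ys) (++⁺ xs′ ys′)
  tupleEq-++ []       qs = qs
  tupleEq-++ (p ∷ ps) qs = p ∷ tupleEq-++ ps qs

record Structure (Sg : Signature ℓ) : Set (suc ℓ) where
  open Signature Sg
  field
    sortSetoid : Sort → Setoid ℓ ℓ
    fun        : ∀ {ss s} → FunSym ss s → Tuple sortSetoid ss → Setoid.Carrier (sortSetoid s)
    fun-cong   : ∀ {ss s} (f : FunSym ss s) {xs ys} → TupleEq sortSetoid xs ys →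
                 Setoid._≈_ (sortSetoid s) (fun f xs) (fun f ys)
    rel        : ∀ {ss} → RelSym ss → Pred (Tuple sortSetoid ss) ℓ
    rel-resp   : ∀ {ss} (R : RelSym ss) {xs ys} → TupleEq sortSetoid xs ys → rel R xs → rel R ys

  ∣_∣ : Sort → Set ℓ
  ∣ s ∣ = Setoid.Carrier (sortSetoid s)

  Env : List Sort → Set ℓ
  Env = Tuple sortSetoid

  infix 4 _≋_
  _≋_ : ∀ {ss} → Rel (Env ss) ℓ
  _≋_ = TupleEq sortSetoid

module _ (Sg : Signature ℓ) where
  open Signature Sg

  data Term (Γ : List Sort) : Sort → Set ℓ where
    var : ∀ {s} → s ∈ Γ → Term Γ s
    app : ∀ {ss s} → FunSym ss s → All (Term Γ) ss → Term Γ s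

  -- The remaining connectives and ∀ are definable from these, since the
  -- ambient logic is assumed classical.
  data Formula (Γ : List Sort) : Set ℓ where
    _≈′_ : ∀ {s} → Term Γ s → Term Γ s → Formula Γ
    rel′ : ∀ {ss} → RelSym ss → All (Term Γ) ss → Formula Γ
    ¬′_  : Formula Γ → Formula Γ
    _∧′_ : Formula Γ → Formula Γ → Formula Γ
    ∃′   : ∀ s → Formula (s ∷ Γ) → Formula Γ

module _ {Sg : Signature ℓ} (A : Structure Sg) where
  open Signature Sg
  open Structure A

  mutual
    eval : ∀ {Γ s} → Term Sg Γ s → Env Γ → ∣ s ∣
    eval (var v)    ρ = All.lookup ρ v
    eval (app f ts) ρ = fun f (evals ts ρ)

    evals : ∀ {Γ ss} → All (Term Sg Γ) ss → Env Γ → Env ss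
    evals []       ρ = []
    evals (t ∷ ts) ρ = eval t ρ ∷ evals ts ρ

  Sat : ∀ {Γ} → Formula Sg Γ → Pred (Env Γ) ℓ
  Sat (_≈′_ {s} t u) ρ = Setoid._≈_ (sortSetoid s) (eval t ρ) (eval u ρ)
  Sat (rel′ R ts)    ρ = rel R (evals ts ρ)
  Sat (¬′ φ)         ρ = ¬ Sat φ ρ
  Sat (φ ∧′ ψ)       ρ = Sat φ ρ × Sat ψ ρ
  Sat (∃′ s φ)       ρ = Σ[ x ∈ ∣ s ∣ ] Sat φ (x ∷ ρ)

  mutual
    eval-cong : ∀ {Γ s} (t : Term Sg Γ s) {ρ σ} → ρ ≋ σ →
                Setoid._≈_ (sortSetoid s) (eval t ρ) (eval t σ)
    eval-cong (var v)    e = tupleEq-lookup sortSetoid e v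
    eval-cong (app f ts) e = fun-cong f (evals-cong ts e)

    evals-cong : ∀ {Γ ss} (ts : All (Term Sg Γ) ss) {ρ σ} → ρ ≋ σ → evals ts ρ ≋ evals ts σ
    evals-cong []       e = []
    evals-cong (t ∷ ts) e = eval-cong t e ∷ evals-cong ts e

  Sat-resp : ∀ {Γ} (φ : Formula Sg Γ) {ρ σ} → ρ ≋ σ → Sat φ ρ → Sat φ σ
  Sat-resp (_≈′_ {s} t u) e p =
    trans (sym (eval-cong t e)) (trans p (eval-cong u e))
    where open Setoid (sortSetoid s)
  Sat-resp (rel′ R ts) e p        = rel-resp R (evals-cong ts e) p
  Sat-resp (¬′ φ)      e p        = λ q → p (Sat-resp φ (tupleEq-sym sortSetoid e) q)
  Sat-resp (φ ∧′ ψ)    e (p , q)  = Sat-resp φ e p , Sat-resp ψ e q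
  Sat-resp (∃′ s φ)    e (x , p)  = x , Sat-resp φ (Setoid.refl (sortSetoid s) ∷ e) p

  -- Definability with parameters d.
  Definable : ∀ {Γ} → Pred (Env Γ) ℓ → Set ℓ
  Definable {Γ} P = ∃[ Δ ] Σ[ φ ∈ Formula Sg (Γ ++ Δ) ] Σ[ d ∈ Env Δ ]
                    (∀ ρ → P ρ ⇔ Sat φ (++⁺ ρ d))

  DefinableRel : ∀ {Γ Θ} → REL (Env Γ) (Env Θ) ℓ → Set ℓ
  DefinableRel {Γ} {Θ} R = Definable {Γ ++ Θ} (λ ρ → uncurry R (++⁻ Γ ρ))

  Definable₁ : ∀ {s} → Pred ∣ s ∣ ℓ → Set ℓ
  Definable₁ {s} U = Definable {s ∷ []} (λ ρ → U (All.head ρ))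

  -- 1-types over finite parameter tuples d.
  ℵ₀-Saturated : Set (suc ℓ)
  ℵ₀-Saturated =
    ∀ {s Δ} (d : Env Δ) (Φ : Pred (Formula Sg (s ∷ Δ)) ℓ) →
    (∀ φs → All Φ φs → Σ[ x ∈ ∣ s ∣ ] All (λ φ → Sat φ (x ∷ d)) φs) →
    Σ[ x ∈ ∣ s ∣ ] (∀ φ → Φ φ → Sat φ (x ∷ d))

  subsetSetoid : ∀ {Γ} → Pred (Env Γ) ℓ → Setoid ℓ ℓ
  subsetSetoid {Γ} P = On.setoid {B = Σ (Env Γ) P} (tupleSetoid sortSetoid Γ) proj₁

  Infinite : ∀ {Γ} → Pred (Env Γ) ℓ → Set ℓ
  Infinite P = ¬ (∃[ k ] Inverse (≡.setoid (Fin k)) (subsetSetoid P))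

  MoreThan : ∀ {Γ} → ℕ → Pred (Env Γ) ℓ → Set ℓ
  MoreThan n P = Injection (≡.setoid (Fin (ℕ.suc n))) (subsetSetoid P)

  SetUniformFiniteness : ∀ {Γ} → Pred (Env Γ) ℓ → Set (suc ℓ)
  SetUniformFiniteness {Γ} X =
    ∀ {Θ} (T : Pred (Env Θ) ℓ) (Y : Env Θ → Pred (Env Γ) ℓ) →
    Definable T →
    DefinableRel {Γ} {Θ} (λ x t → T t × Y t x) →
    (∀ t → T t → ∀ x → Y t x → X x) →
    ∃[ n ] (∀ t → T t → Infinite (Y t) ⇔ MoreThan n (Y t))

  UniformFiniteness : Set (suc ℓ)
  UniformFiniteness = ∀ {Γ} (X : Pred (Env Γ) ℓ) → Definable X → SetUniformFiniteness X

-- 𝓜ᵉᑫ: the sorts of 𝓜, a quotient sort for each formula without parameters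
-- defining an equivalence relation in 𝓜, and the canonical projections.
module _ {Sg : Signature ℓ} (M : Structure Sg) where
  open Signature Sg
  private module M = Structure M

  DefinesEquivalence : ∀ {Γ} → Formula Sg (Γ ++ Γ) → Set ℓ
  DefinesEquivalence {Γ} φ = IsEquivalence {A = M.Env Γ} (λ a b → Sat M φ (++⁺ a b))

  data EqSort : Set ℓ where
    home : Sort → EqSort
    quot : ∀ Γ (φ : Formula Sg (Γ ++ Γ)) → DefinesEquivalence {Γ} φ → EqSort

  data EqFunSym : List EqSort → EqSort → Set ℓ where
    base : ∀ {ss s} → FunSym ss s → EqFunSym (map home ss) (home s)
    proj : ∀ Γ φ e → EqFunSym (map home Γ) (quot Γ φ e)

  data EqRelSym : List EqSort → Set ℓ where
    base : ∀ {ss} → RelSym ss → EqRelSym (map home ss)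

  eqSignature : Signature ℓ
  eqSignature = record { Sort = EqSort ; FunSym = EqFunSym ; RelSym = EqRelSym }

  eqSetoid : EqSort → Setoid ℓ ℓ
  eqSetoid (home s)     = M.sortSetoid s
  eqSetoid (quot Γ φ e) = record { isEquivalence = e }

  map⁻-cong : ∀ {ss} {xs ys : Tuple eqSetoid (map home ss)} →
              TupleEq eqSetoid xs ys → map⁻ {xs = ss} xs M.≋ map⁻ ys
  map⁻-cong {[]}     []       = []
  map⁻-cong {s ∷ ss} (p ∷ ps) = p ∷ map⁻-cong ps

  infix 10 _ᵉᑫ
  _ᵉᑫ : Structure eqSignature
  _ᵉᑫ = record
    { sortSetoid = eqSetoid
    ; fun        = λ where
        (base f)     xs → M.fun f (map⁻ xs)
        (proj Γ φ e) xs → map⁻ xs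
    ; fun-cong   = λ where
        (base f)     p → M.fun-cong f (map⁻-cong p)
        (proj Γ φ e) {xs} p → Sat-resp M φ
          (tupleEq-++ M.sortSetoid (tupleEq-refl M.sortSetoid) (map⁻-cong p))
          (IsEquivalence.refl e {map⁻ xs})
    ; rel        = λ where
        (base R) xs → M.rel R (map⁻ xs)
    ; rel-resp   = λ where
        (base R) p → M.rel-resp R (map⁻-cong p)
    }

module _ (L : Language ℓ) (M : Structure (oneSorted L)) where
  private
    module M   = Structure M
    module Meq = Structure (M ᵉᑫ)

  Point : Set ℓ
  Point = M.∣ tt ∣

  homeSort : EqSort M
  homeSort = home tt

  Power : ℕ → Set ℓ
  Power n = Meq.Env (replicate n homeSort)

  Collection : Set (suc ℓ)
  Collection = ∀ n → Pred (Pred (Power n) ℓ) ℓ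

  -- Collections of subsets of M = M¹.
  onLine : Pred (Pred Point ℓ) ℓ → Collection
  onLine 𝓒 1 P = 𝓒 (λ x → P (x ∷ []))
  onLine 𝓒 _ P = ⊥

  ImaginariesFrom : Collection → ∀ {Γ} → Pred (Meq.Env Γ) ℓ → Set (suc ℓ)
  ImaginariesFrom 𝓓 {Γ} X =
    ∃[ n ] Σ[ R ∈ REL (Meq.Env Γ) (Power n) ℓ ]
      DefinableRel (M ᵉᑫ) R ×
      (∀ x m → R x m → X x) ×
      (∀ x y → X x → X y → R x ≐ R y → x Meq.≋ y) ×
      (∀ x → X x → 𝓓 n (R x))

  CollectionUniformFiniteness : Collection → Set (suc ℓ)
  CollectionUniformFiniteness 𝓓 =
    ∀ {Γ} (X : Pred (Meq.Env Γ) ℓ) → Definable (M ᵉᑫ) X →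
    ImaginariesFrom 𝓓 X → SetUniformFiniteness (M ᵉᑫ) X

  DefinableSubset : Pred Point ℓ → Set ℓ
  DefinableSubset = Definable₁ (M ᵉᑫ) {homeSort}

  -- Commutativity of _+_ is not assumed.
  record ExpandsOrderedGroup : Set ℓ where
    field
      plus : Language.FunSym L 2
      less : Language.RelSym L 2

    infix  4 _≈_ _<_
    infixl 6 _+_

    _≈_ : Rel Point ℓ
    _≈_ = Setoid._≈_ (M.sortSetoid tt)

    _<_ : Rel Point ℓ
    x < y = M.rel {tt ∷ tt ∷ []} less (x ∷ y ∷ [])

    _+_ : Point → Point → Point
    x + y = M.fun {tt ∷ tt ∷ []} {tt} plus (x ∷ y ∷ [])

    field
      0#                 : Point
      -_                 : Point → Point
      isGroup            : IsGroup _≈_ _+_ 0# -_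
      isStrictTotalOrder : IsStrictTotalOrder _≈_ _<_
      +-monoˡ-<          : ∀ z {x y} → x < y → x + z < y + z
      +-monoʳ-<          : ∀ z {x y} → x < y → z + x < z + y

  module _ (G : ExpandsOrderedGroup) where
    open ExpandsOrderedGroup G

    Convex : Pred Point ℓ → Set ℓ
    Convex C = ∀ {x y z} → C x → C z → x < y → y < z → C y

    WeaklyOMinimal : Set (suc ℓ)
    WeaklyOMinimal =
      ∀ (U : Pred Point ℓ) → DefinableSubset U →
      ∃[ k ] Σ[ C ∈ (Fin k → Pred Point ℓ) ]
        (∀ i → Convex (C i)) × (∀ x → U x ⇔ (∃[ i ] C i x))

    record IsSubgroup (H : Pred Point ℓ) : Set ℓ where
      field
        0#-mem   : H 0#
        +-closed : ∀ {x y} → H x → H y → H (x + y)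
        -‿closed : ∀ {x} → H x → H (- x)

    definableConvexSubgroups : Collection
    definableConvexSubgroups =
      onLine (λ H → DefinableSubset H × Convex H × IsSubgroup H)

    record ExpandsOrderedField : Set ℓ where
      field
        times : Language.FunSym L 2

      infixl 7 _*_
      _*_ : Point → Point → Point
      x * y = M.fun {tt ∷ tt ∷ []} {tt} times (x ∷ y ∷ [])

      field
        1#                : Point
        isCommutativeRing : IsCommutativeRing _≈_ _+_ _*_ -_ 0# 1#
        0≉1               : ¬ 0# ≈ 1#
        inverse           : ∀ x → ¬ x ≈ 0# → ∃[ y ] x * y ≈ 1#
        *-pos             : ∀ {x y} → 0# < x → 0# < y → 0# < x * y

    module _ (F : ExpandsOrderedField) where
      open ExpandsOrderedField F

      record IsValuationSubring (O : Pred Point ℓ) : Set ℓ where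
        field
          isSubgroup : IsSubgroup O
          1#-mem     : O 1#
          *-closed   : ∀ {x y} → O x → O y → O (x * y)
          valuation  : ∀ x y → x * y ≈ 1# → O x ⊎ O y

      definableConvexValuationSubrings : Collection
      definableConvexValuationSubrings =
        onLine (λ O → DefinableSubset O × Convex O × IsValuationSubring O)

{-# OPTIONS --safe #-}

module Submission where

open import Defs
open import Level using (Level; Lift; lift; lower; _⊔_)
open import Algebra.Bundles using (Group; CommutativeRing)
import Algebra.Properties.Group as GroupProperties
import Algebra.Properties.Ring as RingProperties
open import Algebra.Structures using (IsGroup)
open import Axiom.ExcludedMiddle using (ExcludedMiddle)
open import Data.Empty using (⊥; ⊥-elim)
open import Data.Fin as Fin using (Fin; zero; suc; combine)
open import Data.Fin.Properties as Fin
  using (combine-injective; pigeonhole; suc-injective; toℕ-fromℕ<; inject≤-injective)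
open import Data.List using (List; []; _∷_; _++_; map)
open import Data.List.Membership.Propositional using (_∈_)
open import Data.List.Membership.Propositional.Properties using (∈-++⁺ˡ; ∈-++⁺ʳ; ∈-++⁻)
open import Data.List.Relation.Unary.All as All using (All; []; _∷_)
open import Data.List.Relation.Unary.All.Properties
  using (++⁺; ++⁻; map⁺; map⁻; map-∘; map-cong; lookup-map)
open import Data.List.Relation.Unary.Any using (here; there)
open import Data.Nat as ℕ using (ℕ; zero; suc)
import Data.Nat.Properties as ℕ
open import Data.Product using (Σ; Σ-syntax; ∃-syntax; _×_; _,_; proj₁; proj₂; map₂; uncurry)
open import Data.Sum as Sum using (_⊎_; inj₁; inj₂; [_,_]′)
import Data.Unit.Polymorphic as Unit
open import Function using (_∘_; id)
open import Function.Bundles using (_⇔_; mk⇔; Equivalence; Inverse; Injection)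
open import Relation.Binary
  using (Rel; Setoid; IsEquivalence; IsStrictTotalOrder; Transitive; tri<; tri≈; tri>)
import Relation.Binary.Construct.On as On
open import Relation.Binary.PropositionalEquality as ≡
  using (_≡_; refl; sym; trans; cong; cong₂; subst)
import Relation.Binary.Reasoning.Setoid as SetoidReasoning
open import Relation.Nullary using (¬_; Dec; yes; no)
open import Relation.Nullary.Decidable as Dec using (decidable-stable)
open import Relation.Unary using (Pred; _⊆_; _≐_)

-- A family of sets is bounded if there is a uniform bound on the sizes of those of its members
-- that are finite.  Suppose the definable families of convex subgroups are bounded.
--
-- (i) A definable family of initial segments ("cuts") of M is bounded.  Only boundedly many
-- stabilizers occur, so all cuts U of a finite member may be assumed to have the same stabilizer
-- H.  As M is 2-divisible, M / H is densely ordered, so for small ε ∉ H and enough cuts the set of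
-- points of all the margins (U + ε) \ U has about as many convex components as there are cuts.
-- That number is bounded by weak o-minimality and saturation.
--
-- (ii) A definable family of pairwise equal or disjoint subsets of Mⁿ is bounded, by induction on
-- n: the projections to the first coordinate are determined by the ends of their convex
-- components, which are boundedly many by (i), and the sets with a given projection are told
-- apart by their fibres over a single point.  Subsets of a sort of 𝓜ᵉᑫ are such families.
--
-- For fields, a convex subgroup H is an initial segment of the multiplicative group of positive
-- elements, whose stabilizer is determined by the valuation ring { x ∣ x H ⊆ H }.  So the argument
-- of (i), applied to that group, bounds families of convex subgroups.

-- The bound in (i) must not depend on the number of cuts in a member, although `ε` depends on the
-- member. This is harmless because the margins for all `ε` form one definable family, to which a
-- single number of convex components applies. Finiteness of the member enters (i) twice: to find
-- one `ε` that fits into all relevant gaps, and to stop a halving process that would otherwise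
-- produce ever more cuts inside a gap covered by margins. That `M` is commutative and 2-divisible
-- has to be proved. A subgroup with finitely many convex components is convex; this is applied to
-- the centralizers, then to the set of doubles, and in a field once more to the squares of positive
-- elements. In (ii) an element of a quotient sort has no canonical representative, so it is not
-- counted as a tuple: it becomes the set of all tuples that represent it, and distinct elements
-- become disjoint sets.

open Equivalence using (to; from)

-- Coordinates of tuples

module Tuples {a p : Level} {A : Set a} {P : A → Set p} where

  lookup-ext : ∀ {Γ} {xs ys : All P Γ} →
               (∀ {s} (v : s ∈ Γ) → All.lookup xs v ≡ All.lookup ys v) → xs ≡ ys
  lookup-ext {xs = []}     {[]}     h = refl
  lookup-ext {xs = x ∷ xs} {y ∷ ys} h =
    cong₂ _∷_ (h (here refl)) (lookup-ext (λ v → h (there v)))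

  lookup-++ˡ : ∀ {Γ Δ} (xs : All P Γ) (ys : All P Δ) {s} (v : s ∈ Γ) →
               All.lookup (++⁺ xs ys) (∈-++⁺ˡ v) ≡ All.lookup xs v
  lookup-++ˡ (x ∷ xs) ys (here refl) = refl
  lookup-++ˡ (x ∷ xs) ys (there v)   = lookup-++ˡ xs ys v

  lookup-++ʳ : ∀ {Γ Δ} (xs : All P Γ) (ys : All P Δ) {s} (v : s ∈ Δ) →
               All.lookup (++⁺ xs ys) (∈-++⁺ʳ Γ v) ≡ All.lookup ys v
  lookup-++ʳ []       ys v = refl
  lookup-++ʳ (x ∷ xs) ys v = lookup-++ʳ xs ys v

  lookup-tabulate : ∀ {Γ} (f : ∀ {s} → s ∈ Γ → P s) {s} (v : s ∈ Γ) →
                    All.lookup (All.tabulate f) v ≡ f v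
  lookup-tabulate f (here refl) = refl
  lookup-tabulate f (there v)   = lookup-tabulate (λ u → f (there u)) v

  lookup-split : ∀ {Γ Δ} (xs : All P Γ) (ys : All P Δ) {s} (v : s ∈ (Γ ++ Δ)) →
                 All.lookup (++⁺ xs ys) v ≡ [ All.lookup xs , All.lookup ys ]′ (∈-++⁻ Γ v)
  lookup-split []       ys v           = refl
  lookup-split (x ∷ xs) ys (here refl) = refl
  lookup-split {_ ∷ Γ} (x ∷ xs) ys (there v) with ∈-++⁻ Γ v | lookup-split xs ys v
  ... | inj₁ u | q = q
  ... | inj₂ w | q = q

  lookup-++⁻ˡ : ∀ Γ {Δ} (ρ : All P (Γ ++ Δ)) {s} (v : s ∈ Γ) →
                All.lookup (proj₁ (++⁻ Γ ρ)) v ≡ All.lookup ρ (∈-++⁺ˡ v)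
  lookup-++⁻ˡ (s ∷ Γ) (x ∷ ρ) (here refl) = refl
  lookup-++⁻ˡ (s ∷ Γ) (x ∷ ρ) (there v)   = lookup-++⁻ˡ Γ ρ v

  lookup-++⁻ʳ : ∀ Γ {Δ} (ρ : All P (Γ ++ Δ)) {s} (v : s ∈ Δ) →
                All.lookup (proj₂ (++⁻ Γ ρ)) v ≡ All.lookup ρ (∈-++⁺ʳ Γ v)
  lookup-++⁻ʳ []      ρ       v = refl
  lookup-++⁻ʳ (s ∷ Γ) (x ∷ ρ) v = lookup-++⁻ʳ Γ ρ v

  ++⁻∘++⁺ : ∀ {Γ Δ} (xs : All P Γ) (ys : All P Δ) → ++⁻ Γ (++⁺ xs ys) ≡ (xs , ys)
  ++⁻∘++⁺ []       ys = refl
  ++⁻∘++⁺ (x ∷ xs) ys rewrite ++⁻∘++⁺ xs ys = refl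

  map-++ : ∀ {q} {Q : A → Set q} (f : ∀ {s} → P s → Q s) {Γ Δ} (xs : All P Γ) (ys : All P Δ) →
           All.map f (++⁺ xs ys) ≡ ++⁺ (All.map f xs) (All.map f ys)
  map-++ f []       ys = refl
  map-++ f (x ∷ xs) ys = cong (f x ∷_) (map-++ f xs ys)

  map-lookup-tabulate : ∀ {Γ Δ} {xs : All P Δ} {ys : All P Γ} (k : ∀ {s} → s ∈ Γ → s ∈ Δ) →
    (∀ {s} (v : s ∈ Γ) → All.lookup xs (k v) ≡ All.lookup ys v) →
    All.map (All.lookup xs) (All.tabulate k) ≡ ys
  map-lookup-tabulate {xs = xs} {[]}     k h = refl
  map-lookup-tabulate {xs = xs} {y ∷ ys} k h =
    cong₂ _∷_ (h (here refl)) (map-lookup-tabulate {xs = xs} (λ v → k (there v)) (λ v → h (there v)))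
open Tuples public

-- Definable families and their closure under first-order operations

module Definability {ℓ : Level} (em : ExcludedMiddle ℓ) {Sg : Signature ℓ} (A : Structure Sg) where
  open Signature Sg
  open Structure A

  mutual
    renameTerm : ∀ {Γ Δ s} → All (_∈ Δ) Γ → Term Sg Γ s → Term Sg Δ s
    renameTerm k (var v)    = var (All.lookup k v)
    renameTerm k (app f ts) = app f (renameTerms k ts)

    renameTerms : ∀ {Γ Δ ss} → All (_∈ Δ) Γ → All (Term Sg Γ) ss → All (Term Sg Δ) ss
    renameTerms k []       = []
    renameTerms k (t ∷ ts) = renameTerm k t ∷ renameTerms k ts

  rename : ∀ {Γ Δ} → All (_∈ Δ) Γ → Formula Sg Γ → Formula Sg Δ
  rename k (t ≈′ u)    = renameTerm k t ≈′ renameTerm k u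
  rename k (rel′ R ts) = rel′ R (renameTerms k ts)
  rename k (¬′ φ)      = ¬′ rename k φ
  rename k (φ ∧′ ψ)    = rename k φ ∧′ rename k ψ
  rename k (∃′ s φ)    = ∃′ s (rename (here refl ∷ All.map there k) φ)

  mutual
    eval-rename : ∀ {Γ Δ s} (k : All (_∈ Δ) Γ) (t : Term Sg Γ s) ρ →
                  eval A (renameTerm k t) ρ ≡ eval A t (All.map (All.lookup ρ) k)
    eval-rename k (var v)    ρ = sym (lookup-map k v)
    eval-rename k (app f ts) ρ = cong (fun f) (evals-rename k ts ρ)

    evals-rename : ∀ {Γ Δ ss} (k : All (_∈ Δ) Γ) (ts : All (Term Sg Γ) ss) ρ →
                   evals A (renameTerms k ts) ρ ≡ evals A ts (All.map (All.lookup ρ) k)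
    evals-rename k []       ρ = refl
    evals-rename k (t ∷ ts) ρ = cong₂ _∷_ (eval-rename k t ρ) (evals-rename k ts ρ)

  Sat-rename : ∀ {Γ Δ} (k : All (_∈ Δ) Γ) (φ : Formula Sg Γ) ρ →
               Sat A (rename k φ) ρ ⇔ Sat A φ (All.map (All.lookup ρ) k)
  Sat-rename k (_≈′_ {s} t u) ρ rewrite eval-rename k t ρ | eval-rename k u ρ = mk⇔ id id
  Sat-rename k (rel′ R ts)    ρ rewrite evals-rename k ts ρ = mk⇔ id id
  Sat-rename k (¬′ φ)         ρ =
    mk⇔ (λ h → h ∘ from (Sat-rename k φ ρ)) (λ h → h ∘ to (Sat-rename k φ ρ))
  Sat-rename k (φ ∧′ ψ)       ρ =
    mk⇔ (λ (h , h′) → to (Sat-rename k φ ρ) h , to (Sat-rename k ψ ρ) h′)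
        (λ (h , h′) → from (Sat-rename k φ ρ) h , from (Sat-rename k ψ ρ) h′)
  Sat-rename k (∃′ s φ)       ρ = mk⇔
    (λ (x , h) → x , subst (λ ys → Sat A φ (x ∷ ys)) (map-∘ k) (to (Sat-rename _ φ (x ∷ ρ)) h))
    (λ (x , h) → x , from (Sat-rename _ φ (x ∷ ρ)) (subst (λ ys → Sat A φ (x ∷ ys)) (sym (map-∘ k)) h))

  -- A context is a set of points with coordinate functions on it.
  record Ctx : Set (Level.suc ℓ) where
    field
      Pt  : Set ℓ
      Var : Sort → Set ℓ
      at  : ∀ {s} → Var s → Pt → ∣ s ∣
  open Ctx public

  values : ∀ (C : Ctx) {Γ} → All (Var C) Γ → Pt C → Env Γ
  values C r a = All.map (λ v → at C v a) r

  -- The formula has no parameters of its own; parameters enter as coordinates. Over `params T` one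
  -- formula thus serves all `t`, with a tuple of parameters of fixed length that varies with `t`.
  -- This is the uniformity on which saturation acts.
  Def : (C : Ctx) → (Pt C → Set ℓ) → Set ℓ
  Def C P = Σ[ Γ ∈ List Sort ] Σ[ φ ∈ Formula Sg Γ ] Σ[ r ∈ All (Var C) Γ ]
            (∀ a → P a ⇔ Sat A φ (values C r a))

  -- Every function on T counts as a coordinate of params T: T is a set of parameters.
  params : Set ℓ → Ctx
  params T = record { Pt = T ; Var = λ s → T → ∣ s ∣ ; at = λ f → f }

  plain : List Sort → Ctx
  plain Γ = record { Pt = Env Γ ; Var = _∈ Γ ; at = λ v ρ → All.lookup ρ v }

  infixl 5 _⊗_ _▹_

  _⊗_ : Ctx → List Sort → Ctx
  C ⊗ Γ = record
    { Pt  = Pt C × Env Γ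
    ; Var = λ s → Var C s ⊎ s ∈ Γ
    ; at  = λ { (inj₁ v) (a , ρ) → at C v a ; (inj₂ v) (a , ρ) → All.lookup ρ v }
    }

  _▹_ : Ctx → Sort → Ctx
  C ▹ s = record
    { Pt  = Pt C × ∣ s ∣
    ; Var = λ s′ → Var C s′ ⊎ s′ ≡ s
    ; at  = λ { (inj₁ v) (a , x) → at C v a ; (inj₂ refl) (a , x) → x }
    }

  new : ∀ {s} {V : Sort → Set ℓ} → V s ⊎ s ≡ s
  new = inj₂ refl

  atom : ∀ {C Γ} (φ : Formula Sg Γ) (r : All (Var C) Γ) → Def C (λ a → Sat A φ (values C r a))
  atom φ r = _ , φ , r , λ _ → mk⇔ id id

  Def-⇔ : ∀ {C P Q} → (∀ a → P a ⇔ Q a) → Def C P → Def C Q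
  Def-⇔ h (Γ , φ , r , e) =
    Γ , φ , r , λ a → mk⇔ (to (e a) ∘ from (h a)) (to (h a) ∘ from (e a))

  pull : ∀ {C C′ P} (h : Pt C′ → Pt C) (k : ∀ {s} → Var C s → Var C′ s) →
         (∀ {s} (v : Var C s) a → at C v (h a) ≡ at C′ (k v) a) → Def C P → Def C′ (P ∘ h)
  pull {C} {C′} h k h≡ (Γ , φ , r , e) = Γ , φ , All.map k r , λ a →
    mk⇔ (λ p → subst (Sat A φ) (eq a) (to (e (h a)) p))
        (λ p → from (e (h a)) (subst (Sat A φ) (sym (eq a)) p))
    where
    eq : ∀ a → values C r (h a) ≡ values C′ (All.map k r) a
    eq a = trans (map-cong r (λ v → h≡ v a)) (sym (map-∘ r))

  Def-¬ : ∀ {C P} → Def C P → Def C (λ a → ¬ P a)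
  Def-¬ (Γ , φ , r , e) = Γ , ¬′ φ , r , λ a → mk⇔ (λ h → h ∘ from (e a)) (λ h → h ∘ to (e a))

  Def-× : ∀ {C P Q} → Def C P → Def C Q → Def C (λ a → P a × Q a)
  Def-× {C} (Γ , φ , r , e) (Δ , ψ , q , f) =
    Γ ++ Δ , rename kˡ φ ∧′ rename kʳ ψ , ++⁺ r q , λ a → mk⇔
      (λ (x , y) → from (Sat-rename kˡ φ _) (subst (Sat A φ) (sym (eqˡ a)) (to (e a) x)) ,
                   from (Sat-rename kʳ ψ _) (subst (Sat A ψ) (sym (eqʳ a)) (to (f a) y)))
      (λ (x , y) → from (e a) (subst (Sat A φ) (eqˡ a) (to (Sat-rename kˡ φ _) x)) ,
                   from (f a) (subst (Sat A ψ) (eqʳ a) (to (Sat-rename kʳ ψ _) y)))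
    where
    kˡ = All.tabulate {xs = Γ} (∈-++⁺ˡ {ys = Δ})
    kʳ = All.tabulate {xs = Δ} (∈-++⁺ʳ Γ)

    eqˡ : ∀ a → All.map (All.lookup (values C (++⁺ r q) a)) kˡ ≡ values C r a
    eqˡ a rewrite map-++ (λ v → at C v a) r q = map-lookup-tabulate {xs = ++⁺ (values C r a) (values C q a)} ∈-++⁺ˡ
        (lookup-++ˡ (values C r a) (values C q a))

    eqʳ : ∀ a → All.map (All.lookup (values C (++⁺ r q) a)) kʳ ≡ values C q a
    eqʳ a rewrite map-++ (λ v → at C v a) r q =
      map-lookup-tabulate {xs = ++⁺ (values C r a) (values C q a)} (∈-++⁺ʳ Γ)
        (lookup-++ʳ (values C r a) (values C q a))

  dne : {P : Set ℓ} → ¬ ¬ P → P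
  dne = decidable-stable em

  Def-→ : ∀ {C P Q} → Def C P → Def C Q → Def C (λ a → P a → Q a)
  Def-→ p q = Def-⇔ (λ a → mk⇔ (λ h x → dne (λ y → h (x , y))) (λ h (x , y) → y (h x)))
                    (Def-¬ (Def-× p (Def-¬ q)))

  Def-⊎ : ∀ {C P Q} → Def C P → Def C Q → Def C (λ a → P a ⊎ Q a)
  Def-⊎ p q = Def-⇔ (λ a → mk⇔ (λ h → dne (λ n → h (n ∘ inj₁ , n ∘ inj₂)))
                               (λ { (inj₁ x) (n , _) → n x ; (inj₂ y) (_ , n) → n y }))
                    (Def-¬ (Def-× (Def-¬ p) (Def-¬ q)))

  Def-↔ : ∀ {C P Q} → Def C P → Def C Q → Def C (λ a → (P a → Q a) × (Q a → P a))
  Def-↔ p q = Def-× (Def-→ p q) (Def-→ q p)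

  private
    shift : ∀ (Γ : List Sort) {Δ s s′} → s ∈ (Γ ++ Δ) → s ∈ (Γ ++ s′ ∷ Δ)
    shift []      v           = there v
    shift (_ ∷ Γ) (here refl) = here refl
    shift (_ ∷ Γ) (there v)   = there (shift Γ v)

    lookup-shift : ∀ {Γ Δ s s′} (ρ : Env Γ) (x : ∣ s′ ∣) (σ : Env Δ) (v : s ∈ (Γ ++ Δ)) →
                   All.lookup (++⁺ ρ (x ∷ σ)) (shift Γ v) ≡ All.lookup (++⁺ ρ σ) v
    lookup-shift []      x σ v           = refl
    lookup-shift (y ∷ ρ) x σ (here refl) = refl
    lookup-shift (y ∷ ρ) x σ (there v)   = lookup-shift ρ x σ v

    split : ∀ {C : Ctx} Γ {Γ₀} (r : All (Var (C ⊗ Γ)) Γ₀) →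
            Σ[ Δ ∈ List Sort ] Σ[ q ∈ All (Var C) Δ ] Σ[ k ∈ All (_∈ (Γ ++ Δ)) Γ₀ ]
            (∀ a ρ → All.map (All.lookup (++⁺ ρ (values C q a))) k ≡ values (C ⊗ Γ) r (a , ρ))
    split Γ []           = [] , [] , [] , λ _ _ → refl
    split {C} Γ (inj₁ v ∷ r) with Δ , q , k , e ← split {C} Γ r =
      _ ∷ Δ , v ∷ q , ∈-++⁺ʳ Γ (here refl) ∷ All.map (shift Γ) k , λ a ρ →
      cong₂ _∷_ (lookup-++ʳ ρ (at C v a ∷ values C q a) (here refl))
        (trans (map-∘ k) (trans (map-cong k (lookup-shift ρ (at C v a) (values C q a))) (e a ρ)))
    split {C} Γ (inj₂ v ∷ r) with Δ , q , k , e ← split {C} Γ r =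
      Δ , q , ∈-++⁺ˡ v ∷ k , λ a ρ → cong₂ _∷_ (lookup-++ˡ ρ (values C q a) v) (e a ρ)

  -- Collects the coordinates taken from `C` behind the block `Γ`. This is the shape in which
  -- `Definable` is stated and in which quantifiers over the block can be put in front of the
  -- formula.
  normalize : ∀ {C Γ P} → Def (C ⊗ Γ) P →
    Σ[ Δ ∈ List Sort ] Σ[ φ ∈ Formula Sg (Γ ++ Δ) ] Σ[ q ∈ All (Var C) Δ ]
    (∀ a ρ → P (a , ρ) ⇔ Sat A φ (++⁺ ρ (values C q a)))
  normalize {C} {Γ} (_ , φ , r , h) with Δ , q , k , e ← split {C} Γ r =
    Δ , rename k φ , q , λ a ρ → mk⇔
      (λ p → from (Sat-rename k φ _) (subst (Sat A φ) (sym (e a ρ)) (to (h (a , ρ)) p)))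
      (λ p → from (h (a , ρ)) (subst (Sat A φ) (e a ρ) (to (Sat-rename k φ _) p)))

  normalize₁ : ∀ {C s P} → Def (C ▹ s) P →
    Σ[ Δ ∈ List Sort ] Σ[ φ ∈ Formula Sg (s ∷ Δ) ] Σ[ q ∈ All (Var C) Δ ]
    (∀ a x → P (a , x) ⇔ Sat A φ (x ∷ values C q a))
  normalize₁ {C} {s} {P} d
    with Δ , φ , q , h ← normalize {C} {s ∷ []} {λ (a , ρ) → P (a , All.head ρ)}
           (pull (λ (a , ρ) → a , All.head ρ) (Sum.map₂ (λ { refl → here refl }))
             (λ { (inj₁ v) (a , x ∷ []) → refl ; (inj₂ refl) (a , x ∷ []) → refl }) d) =
    Δ , φ , q , λ a x → h a (x ∷ [])

  fibre-def : ∀ {Δ s} (φ : Formula Sg (s ∷ Δ)) → Def (plain Δ ▹ s) (λ (ρ , x) → Sat A φ (x ∷ ρ))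
  fibre-def {Δ} {s} φ = Def-⇔ (λ (ρ , x) → mk⇔ (subst (Sat A φ) (eq ρ x)) (subst (Sat A φ) (sym (eq ρ x))))
    (atom φ (inj₂ refl ∷ old))
    where
    old : All (Var (plain Δ ▹ s)) Δ
    old = All.tabulate inj₁
    eq : ∀ ρ x → values (plain Δ ▹ s) (inj₂ refl ∷ old) (ρ , x) ≡ x ∷ ρ
    eq ρ x = cong (x ∷_) (lookup-ext (λ v → trans (lookup-map old v)
      (cong (λ w → at (plain Δ ▹ s) w (ρ , x)) (lookup-tabulate inj₁ v))))

  Def-∃ : ∀ {C s P} → Def (C ▹ s) P → Def C (λ a → Σ[ x ∈ ∣ s ∣ ] P (a , x))
  Def-∃ {C} {s} d with Δ , φ , q , h ← normalize₁ {C} {s} d =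
    Δ , ∃′ s φ , q , λ a → mk⇔ (λ (x , p) → x , to (h a x) p) (λ (x , p) → x , from (h a x) p)

  Def-∃* : ∀ {C} Γ {P} → Def (C ⊗ Γ) P → Def C (λ a → Σ[ ρ ∈ Env Γ ] P (a , ρ))
  Def-∃* {C} Γ d with Δ , φ , q , h ← normalize {C} {Γ} d =
    Δ , ∃* Γ φ , q , λ a → mk⇔ (λ (ρ , p) → from (Sat-∃* Γ φ) (ρ , to (h a ρ) p))
                               (λ p → map₂ (from (h a _)) (to (Sat-∃* Γ φ) p))
    where
    ∃* : ∀ Γ {Δ} → Formula Sg (Γ ++ Δ) → Formula Sg Δ
    ∃* []      φ = φ
    ∃* (s ∷ Γ) φ = ∃* Γ (∃′ s φ)

    Sat-∃* : ∀ Γ {Δ} (φ : Formula Sg (Γ ++ Δ)) {σ} →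
             Sat A (∃* Γ φ) σ ⇔ (Σ[ ρ ∈ Env Γ ] Sat A φ (++⁺ ρ σ))
    Sat-∃* []      φ = mk⇔ (λ p → [] , p) (λ { ([] , p) → p })
    Sat-∃* (s ∷ Γ) φ = mk⇔
      (λ p → let ρ , x , p′ = to (Sat-∃* Γ (∃′ s φ)) p in x ∷ ρ , p′)
      (λ { (x ∷ ρ , p) → from (Sat-∃* Γ (∃′ s φ)) (ρ , x , p) })

  Def-∀ : ∀ {C s P} → Def (C ▹ s) P → Def C (λ a → (x : ∣ s ∣) → P (a , x))
  Def-∀ d = Def-⇔ (λ a → mk⇔ (λ h x → dne (λ n → h (x , n))) (λ h (x , n) → n (h x)))
                  (Def-¬ (Def-∃ (Def-¬ d)))

  Def-≐ : ∀ {C s P Q} → Def (C ▹ s) P → Def (C ▹ s) Q →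
          Def C (λ a → (λ x → P (a , x)) ≐ (λ x → Q (a , x)))
  Def-≐ {C} {s} {P} {Q} p q = Def-⇔
    (λ a → mk⇔ (λ h → (λ {x} → proj₁ (h x)) , (λ {x} → proj₂ (h x))) (λ (i , j) x → i {x} , j {x}))
    (Def-∀ {P = λ (a , x) → (P (a , x) → Q (a , x)) × (Q (a , x) → P (a , x))} (Def-↔ p q))

  -- Formulas have no constant for truth, so a sort is needed to express it: no element of that sort
  -- differs from itself.
  Def-⊤ : ∀ {C} → Sort → Def C (λ _ → Unit.⊤ {ℓ})
  Def-⊤ s = [] , ¬′ (∃′ s (¬′ (var (here refl) ≈′ var (here refl)))) , [] , λ a →
    mk⇔ (λ _ (x , n) → n (Setoid.refl (sortSetoid s))) (λ _ → Unit.tt)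

  toFormula : ∀ {Γ P} → Def (plain Γ) P → Σ[ φ ∈ Formula Sg Γ ] (∀ ρ → P ρ ⇔ Sat A φ ρ)
  toFormula (_ , φ , r , h) = rename r φ , λ ρ →
    mk⇔ (from (Sat-rename r φ ρ) ∘ to (h ρ)) (from (h ρ) ∘ to (Sat-rename r φ ρ))

  toDefinable : ∀ {T Γ P} → Def (params T ⊗ Γ) P → ∀ t → Definable A (λ ρ → P (t , ρ))
  toDefinable d t with Δ , φ , q , h ← normalize d = Δ , φ , values (params _) q t , h t

  fromDefinable : ∀ {Γ P} → Definable A {Γ} P → Def (params (Unit.⊤ {ℓ}) ⊗ Γ) (λ (_ , ρ) → P ρ)
  fromDefinable {Γ} (Δ , φ , d , h) = _ , φ , ++⁺ (All.tabulate inj₂) (All.map (λ x → inj₁ (λ _ → x)) d) ,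
    λ (_ , ρ) → subst (λ σ → _ ⇔ Sat A φ σ) (sym (eq ρ)) (h ρ)
    where
    eq : ∀ ρ → values (params Unit.⊤ ⊗ Γ) (++⁺ (All.tabulate inj₂) (All.map (λ x → inj₁ (λ _ → x)) d))
                 (Unit.tt , ρ) ≡ ++⁺ ρ d
    eq ρ = trans (map-++ _ (All.tabulate inj₂) _) (cong₂ ++⁺
      (lookup-ext (λ v → trans (lookup-map (All.tabulate inj₂) v)
        (cong (λ w → at (params Unit.⊤ ⊗ Γ) w (Unit.tt , ρ)) (lookup-tabulate inj₂ v))))
      (trans (map-∘ d) (map-id d)))
      where
      map-id : ∀ {Δ} (d : Env Δ) → All.map (λ x → x) d ≡ d
      map-id []      = refl
      map-id (x ∷ d) = cong (x ∷_) (map-id d)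

  plainDefinable : ∀ {Γ P} → Def (plain Γ) P → Definable A P
  plainDefinable {Γ} {P} d = toDefinable {T = Unit.⊤} {P = λ (_ , ρ) → P ρ}
    (pull (λ (_ , ρ) → ρ) inj₂ (λ _ _ → refl) d) Unit.tt

  -- Predicates on a setoid need not be invariant under its equality; the definable ones inherit
  -- this from their formula.
  Def-resp : ∀ {C s P} → Def (C ▹ s) P → ∀ a {x y} → Setoid._≈_ (sortSetoid s) x y →
             P (a , x) → P (a , y)
  Def-resp {C} {s} (_ , φ , r , h) a {x} {y} e p =
    from (h _) (Sat-resp A φ (eq r) (to (h _) p))
    where
    eq : ∀ {Γ} (r : All (Var (C ▹ s)) Γ) → values (C ▹ s) r (a , x) ≋ values (C ▹ s) r (a , y)
    eq []                     = []
    eq (_∷_ {s′} (inj₁ v) r)  = Setoid.refl (sortSetoid s′) ∷ eq r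
    eq (inj₂ refl ∷ r)        = e ∷ eq r

  Def-resp* : ∀ {C Γ P} → Def (C ⊗ Γ) P → ∀ a {ρ σ} → ρ ≋ σ → P (a , ρ) → P (a , σ)
  Def-resp* {C} {Γ} (_ , φ , r , h) a {ρ} {σ} e p =
    from (h _) (Sat-resp A φ (eq r) (to (h _) p))
    where
    eq : ∀ {Γ′} (r : All (Var (C ⊗ Γ)) Γ′) → values (C ⊗ Γ) r (a , ρ) ≋ values (C ⊗ Γ) r (a , σ)
    eq []                     = []
    eq (_∷_ {s′} (inj₁ v) r)  = Setoid.refl (sortSetoid s′) ∷ eq r
    eq (inj₂ v ∷ r)           = tupleEq-lookup sortSetoid e v ∷ eq r

  Def-≋ : ∀ {C Γ} → Sort → (r q : All (Var C) Γ) → Def C (λ a → values C r a ≋ values C q a)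
  Def-≋ s₀ []      []      = Def-⇔ (λ a → mk⇔ (λ _ → []) (λ _ → Unit.tt)) (Def-⊤ s₀)
  Def-≋ s₀ (v ∷ r) (w ∷ q) =
    Def-⇔ (λ a → mk⇔ (λ (e , es) → e ∷ es) (λ { (e ∷ es) → e , es }))
          (Def-× (atom (var (here refl) ≈′ var (there (here refl))) (v ∷ w ∷ [])) (Def-≋ s₀ r q))

  infix 4 _⇒_
  record _⇒_ (C′ C : Ctx) : Set ℓ where
    field
      ⟦_⟧ : Pt C′ → Pt C
      ren : ∀ {s} → Var C s → Var C′ s
      nat : ∀ {s} (v : Var C s) a → at C v (⟦_⟧ a) ≡ at C′ (ren v) a
  open _⇒_ public

  idᶜ : ∀ {C} → C ⇒ C
  idᶜ = record { ⟦_⟧ = id ; ren = id ; nat = λ _ _ → refl }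

  infixl 5 _↑ _↑*
  _↑ : ∀ {C C′ s} → C′ ⇒ C → C′ ▹ s ⇒ C
  m ↑ = record { ⟦_⟧ = λ (a , _) → ⟦ m ⟧ a ; ren = λ v → inj₁ (ren m v) ; nat = λ v (a , _) → nat m v a }

  _↑* : ∀ {C C′ Γ} → C′ ⇒ C → C′ ⊗ Γ ⇒ C
  m ↑* = record { ⟦_⟧ = λ (a , _) → ⟦ m ⟧ a ; ren = λ v → inj₁ (ren m v) ; nat = λ v (a , _) → nat m v a }

  infixl 5 _,,_
  _,,_ : ∀ {C C′ s} → C′ ⇒ C → Var C′ s → C′ ⇒ C ▹ s
  _,,_ {C} {C′} m w = record
    { ⟦_⟧ = λ a → ⟦ m ⟧ a , at C′ w a
    ; ren = λ { (inj₁ v) → ren m v ; (inj₂ refl) → w }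
    ; nat = λ { (inj₁ v) a → nat m v a ; (inj₂ refl) a → refl } }

  infix 6 _[_]
  _[_] : ∀ {C C′ P} → Def C P → (m : C′ ⇒ C) → Def C′ (λ a → P (⟦ m ⟧ a))
  d [ m ] = pull ⟦ m ⟧ (ren m) (nat m) d

-- Passing between formulas of `M` and formulas of `M ᵉᑫ`

module Imaginaries {ℓ : Level} (em : ExcludedMiddle ℓ) {Sg : Signature ℓ} (M : Structure Sg)
                   (s₀ : Signature.Sort Sg) where
  open Signature Sg
  private
    module M   = Structure M
    module Meq = Structure (M ᵉᑫ)
    module Dᵉ  = Definability em (M ᵉᑫ)
    Sgᵉ = eqSignature M
  open Definability em M

  home∈ : ∀ {s Γ} → s ∈ Γ → home {M = M} s ∈ map home Γ
  home∈ (here refl) = here refl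
  home∈ (there v)   = there (home∈ v)

  toHome : ∀ {Γ} → M.Env Γ → Meq.Env (map home Γ)
  toHome ρ = map⁺ ρ

  fromHome : ∀ {Γ} → Meq.Env (map home Γ) → M.Env Γ
  fromHome ρ = map⁻ ρ

  from∘to-home : ∀ {Γ} (ρ : M.Env Γ) → fromHome (toHome ρ) ≡ ρ
  from∘to-home []      = refl
  from∘to-home (x ∷ ρ) = cong (x ∷_) (from∘to-home ρ)

  lookup-home : ∀ {s Γ} (ρ : Meq.Env (map home Γ)) (v : s ∈ Γ) →
                All.lookup ρ (home∈ v) ≡ All.lookup (map⁻ {f = home} ρ) v
  lookup-home (x ∷ ρ) (here refl) = refl
  lookup-home (x ∷ ρ) (there v)   = lookup-home ρ v

  mutual
    liftTerm : ∀ {Γ s} → Term Sg Γ s → Term Sgᵉ (map home Γ) (home s)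
    liftTerm (var v)    = var (home∈ v)
    liftTerm (app f ts) = app (base f) (liftTerms ts)

    liftTerms : ∀ {Γ ss} → All (Term Sg Γ) ss → All (Term Sgᵉ (map home Γ)) (map home ss)
    liftTerms []       = []
    liftTerms (t ∷ ts) = liftTerm t ∷ liftTerms ts

  liftFormula : ∀ {Γ} → Formula Sg Γ → Formula Sgᵉ (map home Γ)
  liftFormula (t ≈′ u)    = liftTerm t ≈′ liftTerm u
  liftFormula (rel′ R ts) = rel′ (base R) (liftTerms ts)
  liftFormula (¬′ φ)      = ¬′ liftFormula φ
  liftFormula (φ ∧′ ψ)    = liftFormula φ ∧′ liftFormula ψ
  liftFormula (∃′ s φ)    = ∃′ (home s) (liftFormula φ)

  mutual
    eval-lift : ∀ {Γ s} (t : Term Sg Γ s) ρ → eval (M ᵉᑫ) (liftTerm t) ρ ≡ eval M t (map⁻ ρ)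
    eval-lift (var v)    ρ = lookup-home ρ v
    eval-lift (app f ts) ρ = cong (M.fun f) (evals-lift ts ρ)

    evals-lift : ∀ {Γ ss} (ts : All (Term Sg Γ) ss) ρ →
                 map⁻ (evals (M ᵉᑫ) (liftTerms ts) ρ) ≡ evals M ts (map⁻ ρ)
    evals-lift []       ρ = refl
    evals-lift (t ∷ ts) ρ = cong₂ _∷_ (eval-lift t ρ) (evals-lift ts ρ)

  Sat-lift : ∀ {Γ} (φ : Formula Sg Γ) ρ → Sat (M ᵉᑫ) (liftFormula φ) ρ ⇔ Sat M φ (map⁻ ρ)
  Sat-lift (_≈′_ {s} t u) ρ rewrite eval-lift t ρ | eval-lift u ρ = mk⇔ id id
  Sat-lift (rel′ R ts)    ρ rewrite evals-lift ts ρ = mk⇔ id id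
  Sat-lift (¬′ φ)         ρ = mk⇔ (λ h → h ∘ from (Sat-lift φ ρ)) (λ h → h ∘ to (Sat-lift φ ρ))
  Sat-lift (φ ∧′ ψ)       ρ =
    mk⇔ (λ (h , h′) → to (Sat-lift φ ρ) h , to (Sat-lift ψ ρ) h′)
        (λ (h , h′) → from (Sat-lift φ ρ) h , from (Sat-lift ψ ρ) h′)
  Sat-lift (∃′ s φ)       ρ = mk⇔ (λ (x , h) → x , to (Sat-lift φ (x ∷ ρ)) h)
                                  (λ (x , h) → x , from (Sat-lift φ (x ∷ ρ)) h)

  homeValues : ∀ (C : Dᵉ.Ctx) {Γ} → All (λ s → Dᵉ.Ctx.Var C (home s)) Γ → Dᵉ.Ctx.Pt C → M.Env Γ
  homeValues C r a = All.map (λ v → Dᵉ.Ctx.at C v a) r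

  Def-lift : ∀ {C Γ} (φ : Formula Sg Γ) (r : All (λ s → Dᵉ.Ctx.Var C (home s)) Γ) →
             Dᵉ.Def C (λ a → Sat M φ (homeValues C r a))
  Def-lift {C} φ r = Dᵉ.Def-⇔
    (λ a → subst (λ ρ → Sat (M ᵉᑫ) (liftFormula φ) (Dᵉ.values C (map⁺ r) a) ⇔ Sat M φ ρ) (eq r a) (Sat-lift φ _))
    (Dᵉ.atom (liftFormula φ) (map⁺ r))
    where
    eq : ∀ {Γ} (r : All (λ s → Dᵉ.Ctx.Var C (home s)) Γ) a →
         map⁻ (Dᵉ.values C (map⁺ r) a) ≡ homeValues C r a
    eq []      a = refl
    eq (v ∷ r) a = cong (_ ∷_) (eq r a)

  evals-vars : ∀ {Sg′ : Signature ℓ} (A : Structure Sg′) {Γ Δ} (ρ : Structure.Env A Δ)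
               (k : ∀ {s} → s ∈ Γ → s ∈ Δ) →
               evals A (All.tabulate (λ v → var (k v))) ρ ≡ All.tabulate (λ v → All.lookup ρ (k v))
  evals-vars A {[]}    ρ k = refl
  evals-vars A {s ∷ Γ} ρ k = cong (All.lookup ρ (k (here refl)) ∷_) (evals-vars A ρ (λ v → k (there v)))

  tabulate-lookup : ∀ {a p} {B : Set a} {P : B → Set p} {Γ} (ρ : All P Γ) →
                    All.tabulate (All.lookup ρ) ≡ ρ
  tabulate-lookup []      = refl
  tabulate-lookup (x ∷ ρ) = cong (x ∷_) (tabulate-lookup ρ)

  module _ {Sg′ : Signature ℓ} (A : Structure Sg′) where
    private module D′ = Definability em A

    values-block : ∀ {C Γ a} ρ → D′.values (C D′.⊗ Γ) (All.tabulate inj₂) (a , ρ) ≡ ρ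
    values-block {C} {Γ} {a} ρ = trans (eq Γ (λ v → inj₂ v)) (tabulate-lookup ρ)
      where
      eq : ∀ Γ′ (f : ∀ {s} → s ∈ Γ′ → D′.Ctx.Var (C D′.⊗ Γ) s) →
           D′.values (C D′.⊗ Γ) (All.tabulate f) (a , ρ) ≡
           All.tabulate (λ v → D′.Ctx.at (C D′.⊗ Γ) (f v) (a , ρ))
      eq []       f = refl
      eq (s ∷ Γ′) f = cong (D′.Ctx.at (C D′.⊗ Γ) (f (here refl)) (a , ρ) ∷_) (eq Γ′ (λ v → f (there v)))

  -- An element of a quotient sort is a representative under a coarser equality, so only properties
  -- invariant under `χ` are properties of the class. The formula says that some tuple projecting to
  -- the class has the property.
  Def-quot : ∀ {C Γ Δ χ e} (v : Dᵉ.Ctx.Var C (quot Γ χ e)) (r : All (λ s → Dᵉ.Ctx.Var C (home s)) Δ)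
             (φ : Formula Sg (Γ ++ Δ)) →
             (∀ ρ ρ′ σ → Sat M χ (++⁺ ρ ρ′) → Sat M φ (++⁺ ρ σ) → Sat M φ (++⁺ ρ′ σ)) →
             Dᵉ.Def C (λ a → Sat M φ (++⁺ (Dᵉ.Ctx.at C v a) (homeValues C r a)))
  Def-quot {C} {Γ} {Δ} {χ} {e} v r φ resp = Dᵉ.Def-⇔
    (λ a → let q = Dᵉ.Ctx.at C v a ; σ = homeValues C r a in mk⇔
      (λ (ρ , h , p) → resp (map⁻ ρ) q σ
        (IsEquivalence.sym e {q} {map⁻ ρ} (subst (λ τ → Sat M χ (++⁺ q τ)) (eq₁ a ρ) h))
        (subst (Sat M φ) (eq₂ a ρ) p))
      (λ p → toHome q ,
        subst (λ τ → Sat M χ (++⁺ q τ)) (sym (trans (eq₁ a (toHome q)) (from∘to-home q)))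
              (IsEquivalence.refl e {q}) ,
        subst (Sat M φ) (sym (trans (eq₂ a (toHome q)) (cong (λ τ → ++⁺ τ σ) (from∘to-home q)))) p))
    (Dᵉ.Def-∃* (map home Γ) (Dᵉ.Def-×
      (Dᵉ.atom (var (here refl) ≈′ app (proj Γ χ e) (All.tabulate (λ u → var (there u))))
               (inj₁ v ∷ All.tabulate inj₂))
      (Def-lift φ (++⁺ (All.tabulate (λ u → inj₂ (home∈ u))) (All.map inj₁ r)))))
    where
    C′ = C Dᵉ.⊗ map home Γ

    eq₁ : ∀ a ρ → map⁻ {f = home} (evals (M ᵉᑫ) (All.tabulate (λ u → var (there u)))
                   (Dᵉ.Ctx.at C v a ∷ Dᵉ.values C′ (All.tabulate inj₂) (a , ρ))) ≡ map⁻ ρ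
    eq₁ a ρ = cong (map⁻ {f = home})
      (trans (evals-vars (M ᵉᑫ) (Dᵉ.Ctx.at C v a ∷ Dᵉ.values C′ (All.tabulate inj₂) (a , ρ)) there)
      (trans (tabulate-lookup (Dᵉ.values C′ (All.tabulate inj₂) (a , ρ)))
             (values-block (M ᵉᑫ) {C} {map home Γ} {a} ρ)))

    eq₂ : ∀ a ρ → homeValues C′ (++⁺ (All.tabulate (λ u → inj₂ (home∈ u))) (All.map inj₁ r)) (a , ρ)
                  ≡ ++⁺ (map⁻ ρ) (homeValues C r a)
    eq₂ a ρ = trans
      (map-++ (λ u → Dᵉ.Ctx.at C′ u (a , ρ)) (All.tabulate (λ u → inj₂ (home∈ u))) (All.map inj₁ r))
      (cong₂ ++⁺
        (lookup-ext (λ u → trans (lookup-map (All.tabulate (λ u → inj₂ (home∈ u))) u)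
          (trans (cong (λ w → Dᵉ.Ctx.at C′ w (a , ρ)) (lookup-tabulate (λ u → inj₂ (home∈ u)) u))
                 (lookup-home ρ u))))
        (map-∘ r))

  flat : EqSort M → List Sort
  flat (home s)     = s ∷ []
  flat (quot Γ _ _) = Γ

  rep : ∀ s → Meq.∣ s ∣ → M.Env (flat s)
  rep (home s)     x = x ∷ []
  rep (quot Γ _ _) ρ = ρ

  unrep : ∀ s → M.Env (flat s) → Meq.∣ s ∣
  unrep (home s)     (x ∷ []) = x
  unrep (quot Γ _ _) ρ        = ρ

  rep-unrep : ∀ s ρ → rep s (unrep s ρ) ≡ ρ
  rep-unrep (home s)     (x ∷ []) = refl
  rep-unrep (quot Γ _ _) ρ        = refl

  unrep-rep : ∀ s x → unrep s (rep s x) ≡ x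
  unrep-rep (home s)     x = refl
  unrep-rep (quot Γ _ _) ρ = refl

  EqVars : Ctx → List (EqSort M) → Set ℓ
  EqVars C = All (λ s → All (Var C) (flat s))

  eqValues : ∀ (C : Ctx) {Γ} → EqVars C Γ → Pt C → Meq.Env Γ
  eqValues C r a = All.map (λ {s} q → unrep s (values C q a)) r

  weakenEq : ∀ {C : Ctx} {Γ} Δ → EqVars C Γ → EqVars (C ⊗ Δ) Γ
  weakenEq Δ = All.map (All.map inj₁)

  eqValues-weaken : ∀ {C : Ctx} {Γ} Δ (r : EqVars C Γ) a ρ →
                    eqValues (C ⊗ Δ) (weakenEq {C} Δ r) (a , ρ) ≡ eqValues C r a
  eqValues-weaken {C} Δ r a ρ = trans (map-∘ r)
    (map-cong r (λ {s} q → cong (unrep s) (map-∘ {g = λ v → at (C ⊗ Δ) v (a , ρ)} q)))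

  -- Equality here is that of representatives in `M`, not of classes. A projection is the identity
  -- on representatives, so every term of `M ᵉᑫ` has such a graph, and `Def-graph` can substitute it
  -- into predicates that do not respect classes.
  Graph : ∀ (C : Ctx) Γ → (Pt C → M.Env Γ) → Set ℓ
  Graph C Γ f = Def (C ⊗ Γ) (λ (a , ρ) → ρ M.≋ f a)

  private
    pull-weaken : ∀ {C : Ctx} {Γ Δ P} → Def (C ⊗ Γ) P → Def (C ⊗ Δ ⊗ Γ) (λ ((a , _) , ρ) → P (a , ρ))
    pull-weaken = pull (λ ((a , _) , ρ) → a , ρ) (Sum.map₁ inj₁)
      (λ { (inj₁ v) _ → refl ; (inj₂ v) _ → refl })

  Def-graph : ∀ {C Γ f} {P : Pt C × M.Env Γ → Set ℓ} → Graph C Γ f → Def (C ⊗ Γ) P →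
              Def C (λ a → P (a , f a))
  Def-graph {f = f} g d = Def-⇔
    (λ a → mk⇔ (λ (ρ , e , p) → Def-resp* d a e p)
               (λ p → f a , tupleEq-refl M.sortSetoid , p))
    (Def-∃* _ (Def-× g d))

  graph-block : ∀ {C Γ} (q : All (Var C) Γ) → Graph C Γ (values C q)
  graph-block {C} {Γ} q = Def-⇔
    (λ (a , ρ) → subst₂⇔ (values-block M {C} {Γ} {a} ρ) (map-∘ q))
    (Def-≋ s₀ (All.tabulate inj₂) (All.map inj₁ q))
    where
    subst₂⇔ : ∀ {ρ ρ′ σ σ′ : M.Env Γ} → ρ ≡ ρ′ → σ ≡ σ′ → (ρ M.≋ σ) ⇔ (ρ′ M.≋ σ′)
    subst₂⇔ refl refl = mk⇔ id id

  atom-block : ∀ {C Γ} (φ : Formula Sg Γ) → Def (C ⊗ Γ) (λ (a , ρ) → Sat M φ ρ)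
  atom-block {C} {Γ} φ = Def-⇔
    (λ (a , ρ) → subst (λ σ → Sat M φ σ ⇔ Sat M φ ρ) (sym (values-block M {C} {Γ} {a} ρ)) (mk⇔ id id))
    (atom φ (All.tabulate inj₂))

  mutual
    graph-term : ∀ {C Γ s} (r : EqVars C Γ) (t : Term Sgᵉ Γ s) →
                 Graph C (flat s) (λ a → rep s (eval (M ᵉᑫ) t (eqValues C r a)))
    graph-term {C} {s = s} r (var v) = Def-⇔
      (λ (a , ρ) → mk⇔ (subst (ρ M.≋_) (sym (eq a))) (subst (ρ M.≋_) (eq a)))
      (graph-block (All.lookup r v))
      where
      eq : ∀ a → rep s (All.lookup (eqValues C r a) v) ≡ values C (All.lookup r v) a
      eq a = trans (cong (rep s) (lookup-map r v)) (rep-unrep s _)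
    graph-term {C} r (app (base {ss} {s} f) ts) =
      Def-graph {P = λ (b , σ) → proj₂ b M.≋ M.fun f σ ∷ []} (pull-weaken (graph-terms r ss ts)) (Def-⇔
        (λ { ((a , x ∷ []) , ρ) → mk⇔ (λ e → subst (λ σ → x ≈ M.fun f σ) (eq ((a , x ∷ []) , ρ)) e ∷ [])
             (λ { (e ∷ []) → subst (λ σ → x ≈ M.fun f σ) (sym (eq ((a , x ∷ []) , ρ))) e }) })
        (atom (var (here refl) ≈′ app f (All.tabulate (λ v → var (there v))))
              (inj₁ (inj₂ (here refl)) ∷ All.tabulate inj₂)))
      where
      open Setoid (M.sortSetoid s) using (_≈_)
      eq : ∀ b → evals M (All.tabulate (λ v → var (there v)))
             (values (C ⊗ (s ∷ []) ⊗ ss) (inj₁ (inj₂ (here refl)) ∷ All.tabulate inj₂) b) ≡ proj₂ b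
      eq b@(a , ρ) = trans
        (evals-vars M (values (C ⊗ (s ∷ []) ⊗ ss) (inj₁ (inj₂ (here refl)) ∷ All.tabulate inj₂) b) there)
        (trans (tabulate-lookup (values (C ⊗ (s ∷ []) ⊗ ss) (All.tabulate inj₂) b))
               (values-block M {C ⊗ (s ∷ [])} {ss} {a} ρ))
    graph-term r (app (proj Γ φ e) ts) = graph-terms r Γ ts

    graph-terms : ∀ {C Γ} (r : EqVars C Γ) ss (ts : All (Term Sgᵉ Γ) (map home ss)) →
                  Graph C ss (λ a → map⁻ (evals (M ᵉᑫ) ts (eqValues C r a)))
    graph-terms r []       []       = Def-⇔ (λ { (a , []) → mk⇔ (λ _ → []) (λ _ → _) }) (Def-⊤ s₀)
    graph-terms {C} r (s ∷ ss) (t ∷ ts) = Def-⇔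
      (λ { (a , x ∷ ρ) → mk⇔ (λ { (e ∷ [] , es) → e ∷ es }) (λ { (e ∷ es) → e ∷ [] , es }) })
      (Def-×
        (pull {C ⊗ (s ∷ [])} {C ⊗ (s ∷ ss)} (λ { (a , ρ) → a , All.head ρ ∷ [] })
              (λ { (inj₁ v) → inj₁ v ; (inj₂ (here e)) → inj₂ (here e) })
              (λ { (inj₁ v) _ → refl ; (inj₂ (here refl)) (a , x ∷ ρ) → refl }) (graph-term r t))
        (pull {C ⊗ ss} {C ⊗ (s ∷ ss)} (λ { (a , ρ) → a , All.tail ρ })
              (Sum.map₂ there)
              (λ { (inj₁ v) _ → refl ; (inj₂ v) (a , x ∷ ρ) → refl }) (graph-terms r ss ts)))

  -- Equality on a quotient sort becomes its defining formula, and a quantifier over the sort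
  -- becomes a quantifier over tuples of representatives.
  Def-Sat : ∀ {C Γ} (r : EqVars C Γ) (φ : Formula Sgᵉ Γ) →
            Def C (λ a → Sat (M ᵉᑫ) φ (eqValues C r a))
  Def-Sat {C} r (_≈′_ {home s} t u) =
    Def-graph {P = λ (a , ρ) → All.head ρ ≈ eval (M ᵉᑫ) u (eqValues C r a)} (graph-term r t)
      (Def-graph {P = λ ((a , ρ) , σ) → All.head ρ ≈ All.head σ} (pull-weaken (graph-term r u)) (Def-⇔
      (λ { ((a , x ∷ []) , y ∷ []) → mk⇔ id id })
      (atom (var (here refl) ≈′ var (there (here refl)))
            (inj₁ (inj₂ (here refl)) ∷ inj₂ (here refl) ∷ []))))
    where open Setoid (M.sortSetoid s) using (_≈_)
  Def-Sat {C} r (_≈′_ {quot Γ χ e} t u) =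
    Def-graph {P = λ (a , ρ) → Sat M χ (++⁺ ρ (eval (M ᵉᑫ) u (eqValues C r a)))} (graph-term r t)
      (Def-graph {P = λ ((a , ρ) , σ) → Sat M χ (++⁺ ρ σ)} (pull-weaken (graph-term r u)) (Def-⇔
      (λ ((a , ρ) , σ) → subst (λ τ → Sat M χ τ ⇔ Sat M χ (++⁺ ρ σ)) (sym (eq a ρ σ)) (mk⇔ id id))
      (atom χ (++⁺ (All.tabulate (λ v → inj₁ (inj₂ v))) (All.tabulate inj₂)))))
    where
    eq : ∀ a ρ σ → values (C ⊗ Γ ⊗ Γ) (++⁺ (All.tabulate (λ v → inj₁ (inj₂ v))) (All.tabulate inj₂)) ((a , ρ) , σ)
                   ≡ ++⁺ ρ σ
    eq a ρ σ = trans (map-++ _ (All.tabulate (λ v → inj₁ (inj₂ v))) _) (cong₂ ++⁺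
      (lookup-ext (λ v → trans (lookup-map (All.tabulate (λ v → inj₁ (inj₂ v))) v)
        (cong (λ w → at (C ⊗ Γ ⊗ Γ) w ((a , ρ) , σ)) (lookup-tabulate (λ v → inj₁ (inj₂ v)) v))))
      (values-block M {C ⊗ Γ} {Γ} {a , ρ} σ))
  Def-Sat r (rel′ (base {ss} R) ts) = Def-graph {P = λ (a , ρ) → M.rel R ρ} (graph-terms r ss ts)
    (Def-⇔ (λ (a , ρ) → subst (λ σ → M.rel R σ ⇔ M.rel R ρ) (sym (eq ρ)) (mk⇔ id id))
           (atom-block (rel′ R (All.tabulate (λ v → var v)))))
    where
    eq : ∀ ρ → evals M (All.tabulate (λ v → var v)) ρ ≡ ρ
    eq ρ = trans (evals-vars M ρ (λ v → v)) (tabulate-lookup ρ)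
  Def-Sat r (¬′ φ)   = Def-¬ (Def-Sat r φ)
  Def-Sat r (φ ∧′ ψ) = Def-× (Def-Sat r φ) (Def-Sat r ψ)
  Def-Sat {C} {Γ} r (∃′ s φ) = Def-⇔
    (λ a → mk⇔ (λ (ρ , p) → unrep s ρ , subst (Sat (M ᵉᑫ) φ) (eq a ρ) p)
               (λ (x , p) → rep s x , subst (Sat (M ᵉᑫ) φ)
                 (sym (trans (eq a (rep s x)) (cong (_∷ _) (unrep-rep s x)))) p))
    (Def-∃* (flat s) (Def-Sat {C ⊗ flat s} r′ φ))
    where
    r′ : EqVars (C ⊗ flat s) (s ∷ Γ)
    r′ = All.tabulate inj₂ ∷ weakenEq {C} (flat s) r
    eq : ∀ a ρ → eqValues (C ⊗ flat s) r′ (a , ρ) ≡ unrep s ρ ∷ eqValues C r a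
    eq a ρ = cong₂ _∷_ (cong (unrep s) (values-block M {C} {flat s} {a} ρ))
                       (eqValues-weaken {C} (flat s) r a ρ)

-- Counting classes and convex components by colourings

module Colouring {ℓ : Level} (em : ExcludedMiddle ℓ) where

  -- For an equivalence relation this says that there are at most `k` classes. A separating map is
  -- easier to combine than a count: bounds multiply, and they pass to coarser relations.
  Colouring : {B : Set ℓ} {r : Level} → ℕ → Rel B r → Set (ℓ ⊔ r)
  Colouring {B} k R = Σ[ c ∈ (B → Fin k) ] (∀ {b b′} → c b ≡ c b′ → R b b′)

  module _ {B : Set ℓ} where

    recolour : ∀ {k r q} {R : Rel B r} {Q : Rel B q} → (∀ {b b′} → R b b′ → Q b b′) → Colouring k R → Colouring k Q
    recolour h (c , p) = c , h ∘ p

    infixr 4 _⊗ᶜ_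
    _⊗ᶜ_ : ∀ {k m r q} {R : Rel B r} {Q : Rel B q} → Colouring k R → Colouring m Q →
           Colouring (k ℕ.* m) (λ b b′ → R b b′ × Q b b′)
    (c , p) ⊗ᶜ (d , q) = (λ b → combine (c b) (d b)) , λ {b} {b′} e →
      let e₁ , e₂ = combine-injective (c b) (d b) (c b′) (d b′) e in p e₁ , q e₂

    bit : (P : Pred B ℓ) → Colouring 2 (λ b b′ → P b ⇔ P b′)
    bit P = (λ b → colour (em {P b})) , λ {b} {b′} → same em em
      where
      colour : ∀ {X : Set ℓ} → Dec X → Fin 2
      colour (yes _) = zero
      colour (no _)  = suc zero
      same : ∀ {X Y : Set ℓ} (d : Dec X) (d′ : Dec Y) → colour d ≡ colour d′ → X ⇔ Y
      same (yes x) (yes y) _ = mk⇔ (λ _ → y) (λ _ → x)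
      same (no x)  (no y)  _ = mk⇔ (⊥-elim ∘ x) (⊥-elim ∘ y)

    bits : ∀ {r} (P : Fin r → Pred B ℓ) → Colouring (2 ℕ.^ r) (λ b b′ → ∀ i → P i b ⇔ P i b′)
    bits {zero}  P = (λ _ → zero) , λ _ ()
    bits {suc r} P = recolour (λ { (e , es) → λ { zero → e ; (suc i) → es i } })
                              (bit (P zero) ⊗ᶜ bits (P ∘ suc))

    module _ {k} (c : B → Fin k) where
      private
        pick : ∀ {j} → Dec (Σ[ b ∈ B ] c b ≡ j) → Σ[ b ∈ B ] c b ≡ j → Σ[ b ∈ B ] c b ≡ j
        -- The witness comes from excluded middle for the colour `j`, not from the given element,
        -- and so is the same for all elements of that colour.
        pick (yes p) _ = p
        pick (no _)  q = q

        pick-same : ∀ {j} (d : Dec (Σ[ b ∈ B ] c b ≡ j)) q q′ → pick d q ≡ pick d q′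
        pick-same (yes p) q q′ = refl
        pick-same (no n)  q q′ = ⊥-elim (n q)

      representative : B → B
      representative b = proj₁ (pick {c b} em (b , refl))

      representative-colour : ∀ b → c (representative b) ≡ c b
      representative-colour b = proj₂ (pick {c b} em (b , refl))

      representative-cong : ∀ {b b′} → c b ≡ c b′ → representative b ≡ representative b′
      representative-cong {b} {b′} e =
        trans (transport e) (cong proj₁ (pick-same em (b , e) (b′ , refl)))
        where
        transport : ∀ {j} (e : c b ≡ j) → representative b ≡ proj₁ (pick {j} em (b , e))
        transport refl = refl

  module Convexity {A : Set ℓ} (_<_ : Rel A ℓ) (<-trans : Transitive _<_) where

    -- Says that `W` is a union of at most `N` convex sets, namely the convex hulls of the colours
    -- within `W`. Points outside `W` may have any colour.
    ConvexColouring : ℕ → Pred A ℓ → Set ℓ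
    ConvexColouring N W = Σ[ κ ∈ (A → Fin N) ]
      (∀ {x y z} → κ x ≡ κ z → x < y → y < z → W x → W z → W y)

    -- A chain of `j + 1` points of `W` descending from `z`, with a point outside `W` between
    -- neighbours. Unlike a decomposition into convex sets, this is a first-order condition.
    Alternates : ℕ → Pred A ℓ → Pred A ℓ
    Alternates zero    W z = W z
    Alternates (suc j) W z =
      W z × (Σ[ y ∈ A ] (y < z × ¬ W y × (Σ[ x ∈ A ] (x < y × Alternates j W x))))

    module _ {W : Pred A ℓ} where

      alternates-pred : ∀ j {z} → Alternates (suc j) W z → Alternates j W z
      alternates-pred zero    (w , _)                       = w
      alternates-pred (suc j) (w , y , y<z , n , x , x<y , a) =
        w , y , y<z , n , x , x<y , alternates-pred j a

      private
        chain : ∀ j {z} → Alternates j W z → Σ[ xs ∈ (Fin (suc j) → A) ]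
          (xs zero ≡ z × (∀ i → W (xs i)) ×
           (∀ {i i′} → i Fin.< i′ → Σ[ y ∈ A ] (xs i′ < y × y < xs i × ¬ W y)))
        chain zero    {z} w = (λ _ → z) , refl , (λ _ → w) , λ { {zero} {zero} () }
        chain (suc j) {z} (w , y , y<z , n , x , x<y , a)
          with xs , refl , ws , between ← chain j a =
          (λ { zero → z ; (suc i) → xs i }) , refl ,
          (λ { zero → w ; (suc i) → ws i }) ,
          λ { {zero} {suc zero} _ → y , x<y , y<z , n
            ; {zero} {suc (suc i)} _ → let y′ , x<y′ , y′<x , _ = between {zero} {suc i} (ℕ.s≤s ℕ.z≤n)
                                       in y , <-trans x<y′ (<-trans y′<x x<y) , y<z , n
            ; {suc i} {suc i′} (ℕ.s≤s l) → between l }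

      -- Two of the `N + 1` points of a chain share a colour, yet a point outside `W` lies between
      -- them.
      convex-¬alternates : ∀ {N z} → ConvexColouring N W → ¬ Alternates N W z
      convex-¬alternates {N} (κ , convex) a
        with xs , _ , ws , between ← chain N a
        with i , i′ , i<i′ , e ← pigeonhole (ℕ.n<1+n N) (κ ∘ xs)
        with y , l , l′ , n ← between i<i′ = n (convex (sym e) l l′ (ws i′) (ws i))

      private
        Rank : A → ℕ → Set ℓ
        Rank z j = Alternates j W z × ¬ Alternates (suc j) W z

        rank : ∀ N z → W z → ¬ Alternates (suc N) W z → Σ[ j ∈ ℕ ] (j ℕ.< suc N × Rank z j)
        rank zero    z w n = zero , ℕ.s≤s ℕ.z≤n , w , n
        rank (suc N) z w n with em {Alternates (suc N) W z}
        ... | yes a = suc N , ℕ.n<1+n _ , a , n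
        ... | no n′ with j , l , r ← rank N z w n′ = j , ℕ.m<n⇒m<1+n l , r

      -- A point of `W` is coloured by the length of the longest chain descending from it. A point
      -- outside `W` between two points of equal length would lengthen the chain of the upper one.
      ¬alternates-convex : ∀ {N} → (∀ z → ¬ Alternates (suc N) W z) → ConvexColouring (suc N) W
      ¬alternates-convex {N} n = (λ z → colour z em) ,
        λ {x} {y} {z} e x<y y<z wx wz → case-em x<y y<z wx wz
          (spec x em wx) (spec z em wz) (cong Fin.toℕ e)
        where
        colour : ∀ z → Dec (W z) → Fin (suc N)
        colour z (yes w) = Fin.fromℕ< (proj₁ (proj₂ (rank N z w (n z))))
        colour z (no _)  = zero

        spec : ∀ z (d : Dec (W z)) → W z → Rank z (Fin.toℕ (colour z d))
        spec z (yes w) _ with j , l , r ← rank N z w (n z) = subst (Rank z) (sym (toℕ-fromℕ< l)) r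
        spec z (no n)  w = ⊥-elim (n w)

        case-em : ∀ {x y z i j} → x < y → y < z → W x → W z → Rank x i → Rank z j → i ≡ j → W y
        case-em {x} {y} x<y y<z wx wz (a , _) (_ , n) refl with em {W y}
        ... | yes w = w
        ... | no n′ = ⊥-elim (n (wz , y , y<z , n′ , x , x<y , a))

-- Realising descending chains of formulas by tuples

module Saturation {ℓ : Level} {Sg : Signature ℓ} (M : Structure Sg) (sat : ℵ₀-Saturated M) where
  open Structure M

  -- The tail of the tuple is realised first; the head is then a 1-type over it.
  realise : ∀ Γ (χ : ℕ → Formula Sg Γ) → (∀ n ρ → Sat M (χ (suc n)) ρ → Sat M (χ n) ρ) →
            (∀ n → Σ[ ρ ∈ Env Γ ] Sat M (χ n) ρ) → Σ[ ρ ∈ Env Γ ] (∀ n → Sat M (χ n) ρ)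
  realise []      χ desc h = [] , λ n → at-[] {χ n} (h n)
    where
    at-[] : ∀ {φ : Formula Sg []} → Σ[ ρ ∈ Env [] ] Sat M φ ρ → Sat M φ []
    at-[] ([] , p) = p
  realise (s ∷ Γ) χ desc h = x ∷ ρ , λ n → p (χ n) (n , refl)
    where
    split : ∀ {φ : Formula Sg (s ∷ Γ)} → Σ[ ρ ∈ Env (s ∷ Γ) ] Sat M φ ρ →
            Σ[ ρ ∈ Env Γ ] Sat M (∃′ s φ) ρ
    split (x ∷ ρ , p) = ρ , x , p

    desc* : ∀ {m n} → m ℕ.≤′ n → ∀ ρ → Sat M (χ n) ρ → Sat M (χ m) ρ
    desc* (ℕ.≤′-reflexive refl) ρ p = p
    desc* (ℕ.≤′-step m≤n)       ρ p = desc* m≤n ρ (desc _ ρ p)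

    -- The chain descends, so finitely many of its formulas all follow from the one with the largest
    -- index.
    bound : ∀ φs → All (λ φ → ∃[ n ] φ ≡ χ n) φs →
            Σ[ N ∈ ℕ ] (∀ ρ → Sat M (χ N) ρ → All (λ φ → Sat M φ ρ) φs)
    bound []       []              = zero , λ _ _ → []
    bound (φ ∷ φs) ((n , refl) ∷ hs) with N , b ← bound φs hs =
      n ℕ.⊔ N , λ ρ p → desc* (ℕ.≤⇒≤′ (ℕ.m≤m⊔n n N)) ρ p ∷ b ρ (desc* (ℕ.≤⇒≤′ (ℕ.m≤n⊔m n N)) ρ p)

    finite : ∀ ρ → (∀ n → Sat M (∃′ s (χ n)) ρ) → ∀ φs → All (λ φ → ∃[ n ] φ ≡ χ n) φs →
             Σ[ x ∈ ∣ s ∣ ] All (λ φ → Sat M φ (x ∷ ρ)) φs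
    finite ρ h φs hs with N , b ← bound φs hs with x , p ← h N = x , b (x ∷ ρ) p

    tails : Σ[ ρ ∈ Env Γ ] (∀ n → Sat M (∃′ s (χ n)) ρ)
    tails = realise Γ (λ n → ∃′ s (χ n)) (λ n ρ (x , p) → x , desc n (x ∷ ρ) p) (λ n → split {χ n} (h n))

    ρ = proj₁ tails

    heads : Σ[ x ∈ ∣ s ∣ ] (∀ φ → (∃[ n ] φ ≡ χ n) → Sat M φ (x ∷ ρ))
    heads = sat ρ (λ φ → ∃[ n ] φ ≡ χ n) (finite ρ (proj₂ tails))

    x = proj₁ heads
    p = proj₂ heads

-- Weak o-minimality, uniformly in definable families

module WeakOMinimality {ℓ : Level} (em : ExcludedMiddle ℓ) (L : Language ℓ) (M : Structure (oneSorted L))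
         (G : ExpandsOrderedGroup L M) (sat : ℵ₀-Saturated M) (wom : WeaklyOMinimal L M G) where
  open ExpandsOrderedGroup G
  open Structure M
  open Definability em M
  open Imaginaries em M Unit.tt
  open Colouring em
  private module Dᵉ = Definability em (M ᵉᑫ)

  pt : Signature.Sort (oneSorted L)
  pt = Unit.tt

  module < = IsStrictTotalOrder isStrictTotalOrder
  open Convexity _<_ <.trans public

  infix 4 _<ᵈ_
  _<ᵈ_ : ∀ {C} (v w : Var C pt) → Def C (λ a → at C v a < at C w a)
  v <ᵈ w = atom (rel′ less (var (here refl) ∷ var (there (here refl)) ∷ [])) (v ∷ w ∷ [])

  definableSubset : ∀ {C P} → Def (C ▹ pt) P → ∀ a → DefinableSubset L M (λ x → P (a , x))
  definableSubset {C} {P} (Γ , φ , r , h) a = Dᵉ.toDefinable {T = Unit.⊤} {P = λ (_ , ρ) → P (a , All.head ρ)}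
    (Dᵉ.Def-⇔ (λ { (_ , x ∷ []) → mk⇔ (λ p → from (h (a , x)) (subst (Sat M φ) (eq x r) p))
                                       (λ p → subst (Sat M φ) (sym (eq x r)) (to (h (a , x)) p)) })
      (Def-lift φ (r′ r)))
    Unit.tt
    where
    C′ = Dᵉ.params (Unit.⊤ {ℓ}) Dᵉ.⊗ (homeSort L M ∷ [])
    r′ : ∀ {Γ} → All (Var (C ▹ pt)) Γ → All (λ s → Dᵉ.Ctx.Var C′ (home s)) Γ
    r′ = All.map (λ { (inj₁ v) → inj₁ (λ _ → at C v a) ; (inj₂ refl) → inj₂ (here refl) })
    eq : ∀ x {Γ} (r : All (Var (C ▹ pt)) Γ) →
         homeValues C′ (r′ r) (Unit.tt , x ∷ []) ≡ values (C ▹ pt) r (a , x)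
    eq x r = trans (map-∘ r) (map-cong r (λ { (inj₁ v) → refl ; (inj₂ refl) → refl }))

  convexColouring : ∀ {U : Pred (Point L M) ℓ} → DefinableSubset L M U → ∃[ k ] ConvexColouring k U
  convexColouring {U} d with k , C , convex , cover ← wom U d =
    -- The colour `zero` is the default for points outside `U`, which lie in none of the convex
    -- sets.
    suc k , (λ x → colour em) , λ {x} {y} {z} e x<y y<z wx wz → spec em em e x<y y<z wx wz
    where
    colour : ∀ {x} → Dec (U x) → Fin (suc k)
    colour {x} (yes u) = suc (proj₁ (to (cover x) u))
    colour {x} (no _)  = zero
    spec : ∀ {x y z} (d : Dec (U x)) (d′ : Dec (U z)) → colour d ≡ colour d′ →
           x < y → y < z → U x → U z → U y
    spec {x} {y} {z} (yes u) (yes v) e x<y y<z _ _ with to (cover x) u | to (cover z) v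
    spec {x} {y} {z} (yes u) (yes v) refl x<y y<z _ _ | i , p | .i , q = from (cover y) (i , convex i p q x<y y<z)
    spec (no n) _ _ _ _ u _ = ⊥-elim (n u)
    spec _ (no n) _ _ _ _ v = ⊥-elim (n v)

  -- If arbitrarily long chains occurred in the family, saturation would yield one parameter tuple
  -- whose set has chains of every length, against weak o-minimality for that set. The points of `C`
  -- are first replaced by parameter tuples in `M`, because the tuple found by saturation need not
  -- come from a point of `C`.
  uniformConvexColouring : ∀ {C W} → Def (C ▹ pt) W → ∃[ N ] (∀ a → ConvexColouring N (λ x → W (a , x)))
  uniformConvexColouring {C} {W} d with Δ , ψ , q , h ← normalize₁ {C} d =
    result (λ j → toFormula (Def-∃ (alternates-def j)))
    where
    V : Env Δ → Pred (Point L M) ℓ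
    V e x = Sat M ψ (x ∷ e)

    V-def : Def (plain Δ ▹ pt) (λ (e , x) → V e x)
    V-def = fibre-def ψ

    alternates-def : ∀ j → Def (plain Δ ▹ pt) (λ (e , x) → Alternates j (V e) x)
    alternates-def zero    = V-def
    alternates-def (suc j) = Def-× V-def (Def-∃ (Def-× (new <ᵈ inj₁ new) (Def-×
      (Def-¬ (V-def [ idᶜ ↑ ↑ ,, new ]))
      (Def-∃ (Def-× (new <ᵈ inj₁ new) (alternates-def j [ idᶜ ↑ ↑ ↑ ,, new ]))))))

    Chains : Set ℓ
    Chains = (j : ℕ) → Σ[ φ ∈ Formula (oneSorted L) Δ ]
             (∀ e → (Σ[ x ∈ Point L M ] Alternates j (V e) x) ⇔ Sat M φ e)

    result : Chains → ∃[ N ] (∀ a → ConvexColouring N (λ x → W (a , x)))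
    result χ with em {∃[ N ] (∀ e x → ¬ Alternates (suc N) (V e) x)}
    ... | yes (N , n) = suc N , λ a →
      let κ , p = ¬alternates-convex (n (values C q a)) in
      κ , λ {x} {y} {z} e x<y y<z wx wz →
        from (h a y) (p e x<y y<z (to (h a x) wx) (to (h a z) wz))
    ... | no n
      with e , all ← Saturation.realise M sat Δ (λ j → proj₁ (χ j))
             (λ j ρ p → to (proj₂ (χ j) ρ) (map₂ (alternates-pred j) (from (proj₂ (χ (suc j)) ρ) p)))
             (λ j → dne (λ m → n (j , λ e x a → m (e , to (proj₂ (χ j) e) (x , alternates-pred j a)))))
      with k , c ← convexColouring (definableSubset V-def e)
      with x , a ← from (proj₂ (χ k) e) (all k) = ⊥-elim (convex-¬alternates c a)

-- Ordered groups

record OrderedGroup (ℓ : Level) : Set (Level.suc ℓ) where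
  infix  4 _≈_ _<_
  infixl 6 _∙_
  field
    Carrier            : Set ℓ
    _≈_ _<_            : Rel Carrier ℓ
    _∙_                : Carrier → Carrier → Carrier
    e                  : Carrier
    _⁻¹                : Carrier → Carrier
    isGroup            : IsGroup _≈_ _∙_ e _⁻¹
    isStrictTotalOrder : IsStrictTotalOrder _≈_ _<_
    ∙-monoˡ-<          : ∀ z {x y} → x < y → x ∙ z < y ∙ z
    ∙-monoʳ-<          : ∀ z {x y} → x < y → z ∙ x < z ∙ y

  module ∙ = IsGroup isGroup
  module < = IsStrictTotalOrder isStrictTotalOrder

  increase : ∀ {ε} u → e < ε → u < u ∙ ε
  increase u e<ε = <.<-respˡ-≈ (∙.identityʳ u) (∙-monoʳ-< u e<ε)

  ∙-cancelʳ-< : ∀ z {x y} → x ∙ z < y ∙ z → x < y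
  ∙-cancelʳ-< z {x} {y} l with <.compare x y
  ... | tri< x<y _ _ = x<y
  ... | tri≈ _ x≈y _ = ⊥-elim (<.irrefl (∙.∙-congʳ x≈y) l)
  ... | tri> _ _ y<x = ⊥-elim (<.asym l (∙-monoˡ-< z y<x))

  ∙-cancelʳ-≈ : ∀ z {x y} → x ∙ z ≈ y ∙ z → x ≈ y
  ∙-cancelʳ-≈ z {x} {y} q with <.compare x y
  ... | tri< x<y _ _ = ⊥-elim (<.irrefl q (∙-monoˡ-< z x<y))
  ... | tri≈ _ x≈y _ = x≈y
  ... | tri> _ _ y<x = ⊥-elim (<.irrefl (∙.sym q) (∙-monoˡ-< z y<x))

-- Finite families of cuts with a common stabilizer

module Cuts {ℓ : Level} (em : ExcludedMiddle ℓ) (K : OrderedGroup ℓ)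
            (root : ∀ δ → Σ[ η ∈ OrderedGroup.Carrier K ] OrderedGroup._≈_ K (OrderedGroup._∙_ K η η) δ)
            {B : Set ℓ} (U : B → Pred (OrderedGroup.Carrier K) ℓ)
            (U-resp : ∀ b {x y} → OrderedGroup._≈_ K x y → U b x → U b y)
            (U-down : ∀ b {x y} → OrderedGroup._<_ K y x → U b x → U b y) where
  open OrderedGroup K
  open Colouring em
  open Convexity _<_ <.trans

  private
    dne : {P : Set ℓ} → ¬ ¬ P → P
    dne = decidable-stable em

  Stab : B → Pred Carrier ℓ
  Stab b g = ∀ u → U b u ⇔ U b (u ∙ g)

  Margin : Carrier → Pred Carrier ℓ
  Margin ε x = Σ[ b ∈ B ] (¬ U b x × (Σ[ u ∈ Carrier ] (u ∙ ε ≈ x × U b u)))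

  infix 4 _⊏_
  _⊏_ : Rel B ℓ
  b ⊏ b′ = Σ[ x ∈ Carrier ] (¬ U b x × U b′ x)

  above : ∀ b {x y} → ¬ U b x → U b y → y < x
  above b {x} {y} n u with <.compare y x
  ... | tri< y<x _ _ = y<x
  ... | tri≈ _ y≈x _ = ⊥-elim (n (U-resp b y≈x u))
  ... | tri> _ _ x<y = ⊥-elim (n (U-down b x<y u))

  ⊏⇒⊆ : ∀ {b b′} → b ⊏ b′ → U b ⊆ U b′
  ⊏⇒⊆ {b} {b′} (x , n , u) v = U-down b′ (above b n v) u

  ¬⊏⇒⊆ : ∀ {b b′} → ¬ b ⊏ b′ → U b′ ⊆ U b
  ¬⊏⇒⊆ n u = dne (λ m → n (_ , m , u))

  -- Cuts are linearly ordered by inclusion. Without a chain of three, a colour contains at most two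
  -- of them, told apart by whether a larger cut has the same colour.
  twoPerColour : ∀ {N} (κ : B → Fin N) →
    (∀ {b₁ b₂ b₃} → b₁ ⊏ b₂ → b₂ ⊏ b₃ → κ b₁ ≡ κ b₂ → κ b₂ ≡ κ b₃ → ⊥) →
    Colouring (N ℕ.* 2) (λ b b′ → U b ≐ U b′)
  twoPerColour κ noTriple = recolour {Q = λ b b′ → U b ≐ U b′}
    (λ {b} {b′} (q , p) → ¬⊏⇒⊆ (maximal (sym q) (from p ∘ toP (sym q))) , ¬⊏⇒⊆ (maximal q (to p ∘ toP q)))
    ((κ , id) ⊗ᶜ bit NotLast)
    where
    NotLast : Pred B ℓ
    NotLast b = Σ[ b′ ∈ B ] (b ⊏ b′ × Lift ℓ (κ b ≡ κ b′))
    toP : ∀ {b b′} → κ b ≡ κ b′ → b ⊏ b′ → NotLast b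
    toP q l = _ , l , lift q
    maximal : ∀ {b b′} → κ b ≡ κ b′ → (b ⊏ b′ → NotLast b′) → ¬ b ⊏ b′
    maximal q h l with b″ , l′ , lift q′ ← h l = noTriple l l′ q q′

  module _ (stab : ∀ {b b′ g} → Stab b g → Stab b′ g) where

    Wide : Pred Carrier ℓ
    Wide δ = e < δ × (∀ b → ¬ Stab b δ)

    Gap : Carrier → Rel B ℓ
    Gap ε b b′ = Σ[ u ∈ Carrier ] (¬ U b u × U b′ (u ∙ ε))

    -- Not every strict inclusion is good: two cuts may differ by a single coset of the stabilizer,
    -- and then no step outside the stabilizer fits between them. This is why chains of three cuts
    -- are considered.
    Good : Rel B ℓ
    Good b b′ = Σ[ δ ∈ Carrier ] (Wide δ × Gap δ b b′)

    gap-shrink : ∀ {δ ε b b′} → ¬ δ < ε → Gap δ b b′ → Gap ε b b′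
    gap-shrink {δ} {ε} {b} {b′} n (u , m , v) with <.compare ε δ
    ... | tri< ε<δ _ _ = u , m , U-down b′ (∙-monoʳ-< u ε<δ) v
    ... | tri≈ _ ε≈δ _ = u , m , U-resp b′ (∙.∙-congˡ (∙.sym ε≈δ)) v
    ... | tri> _ _ δ<ε = ⊥-elim (n δ<ε)

    -- K modulo the stabilizer is densely ordered because K has square roots.
    good-half : ∀ {b₁ b₂ b₃} → b₁ ⊏ b₂ → b₂ ⊏ b₃ → Good b₁ b₂ ⊎ Good b₂ b₃
    good-half {b₁} {b₂} {b₃} (y , y∉ , y∈) (z , z∉ , z∈)
      -- Half of the step from `y` to `z`. It does not stabilize `U b₂`, since two such steps lead
      -- from `y` inside to `z` outside. The position of `y ∙ η` decides which of the two pairs is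
      -- good.
      with η , ηη≈δ ← root (y ⁻¹ ∙ z) = split em
      where
      yηη≈z : y ∙ η ∙ η ≈ z
      yηη≈z = ∙.trans (∙.assoc y η η) (∙.trans (∙.∙-congˡ ηη≈δ)
        (∙.trans (∙.sym (∙.assoc y (y ⁻¹) z)) (∙.trans (∙.∙-congʳ (∙.inverseʳ y)) (∙.identityˡ z))))
      e<η : e < η
      e<η with <.compare e η
      ... | tri< l _ _ = l
      ... | tri≈ _ q _ = ⊥-elim (<.irrefl (∙.trans (∙.sym (∙.identityʳ y)) (∙.trans (∙.∙-congˡ q)
              (∙.trans (∙.sym (∙.identityʳ _)) (∙.trans (∙.∙-congˡ q) yηη≈z)))) (above b₂ z∉ y∈))
      ... | tri> _ _ l = ⊥-elim (<.asym (above b₂ z∉ y∈) (<.<-respˡ-≈ yηη≈z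
              (<.trans (<.<-respʳ-≈ (∙.identityʳ _) (∙-monoʳ-< (y ∙ η) l))
                       (<.<-respʳ-≈ (∙.identityʳ _) (∙-monoʳ-< y l)))))
      wide : Wide η
      wide = e<η , λ b s → let t = stab {b} {b₂} s in
        z∉ (U-resp b₂ yηη≈z (to (t (y ∙ η)) (to (t y) y∈)))
      split : Dec (U b₂ (y ∙ η)) → Good b₁ b₂ ⊎ Good b₂ b₃
      split (yes u) = inj₁ (η , wide , y , y∉ , u)
      split (no n)  = inj₂ (η , wide , y ∙ η , n , U-resp b₃ (∙.sym yηη≈z) z∈)

    module _ {k} (c : Colouring k (λ b b′ → U b ≐ U b′)) where

      -- There are finitely many cuts up to equality, so an `ε` is chosen for each colour and the
      -- least one taken. `δ` is the value at colours that do not occur and the start of the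
      -- minimum.
      uniform : ∀ {δ} → Wide δ → (Q : B → Pred Carrier ℓ) →
                (∀ {b b′ ε} → U b ≐ U b′ → Q b ε → Q b′ ε) →
                (∀ {b δ ε} → ¬ δ < ε → Q b δ → Q b ε) →
                (∀ b → Σ[ ε ∈ Carrier ] (Wide ε × Q b ε)) →
                Σ[ ε ∈ Carrier ] (Wide ε × (∀ b → Q b ε))
      uniform {δ} w Q Q-resp Q-down h =
        let ε , wε , least = minimum k (λ i → proj₁ (value i)) (λ i → proj₁ (proj₂ (value i))) in
        ε , wε , λ b → Q-down (least (proj₁ c b)) (proj₂ (proj₂ (value (proj₁ c b))) b refl)
        where
        minimum : ∀ n (f : Fin n → Carrier) → (∀ i → Wide (f i)) →
                  Σ[ ε ∈ Carrier ] (Wide ε × (∀ i → ¬ f i < ε))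
        minimum zero    f ws = δ , w , λ ()
        minimum (suc n) f ws with ε , wε , l ← minimum n (f ∘ suc) (ws ∘ suc) | <.compare (f zero) ε
        ... | tri< q _ _  = f zero , ws zero , λ { zero → <.irrefl ∙.refl ; (suc i) r → l i (<.trans r q) }
        ... | tri≈ r _ _  = ε , wε , λ { zero → r ; (suc i) → l i }
        ... | tri> r _ _  = ε , wε , λ { zero → r ; (suc i) → l i }

        value : ∀ i → Σ[ ε ∈ Carrier ] (Wide ε × (∀ b → proj₁ c b ≡ i → Q b ε))
        value i with em {Σ[ b ∈ B ] proj₁ c b ≡ i}
        ... | yes (b , refl) = let ε , wε , q = h b in ε , wε , λ b′ r → Q-resp (proj₂ c (sym r)) q
        ... | no n           = δ , w , λ b r → ⊥-elim (n (b , r))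

      -- Goodness concerns pairs of cuts, so `uniform` is applied twice: to the upper cut with the
      -- lower one fixed, then to the lower one.
      smallGap : ∀ {δ} → Wide δ → Σ[ ε ∈ Carrier ] (Wide ε × (∀ b b′ → Good b b′ → Gap ε b b′))
      smallGap {δ} w = uniform w (λ b ε → ∀ b′ → Good b b′ → Gap ε b b′)
        (λ {b} {b″} (i , j) h b′ (δ , w , u , n , v) → let u′ , n′ , v′ = h b′ (δ , w , u , (λ x → n (i x)) , v)
                                          in u′ , (λ x → n′ (j x)) , v′)
        (λ l h b′ g → gap-shrink l (h b′ g))
        (λ b → uniform w (λ b′ ε → Good b b′ → Gap ε b b′)
          (λ (i , j) h (δ , w , u , n , v) → let u′ , n′ , v′ = h (δ , w , u , n , j v) in u′ , n′ , i v′)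
          (λ l h g → gap-shrink l (h g))
          (λ b′ → gapFor b b′ em))
        where
        gapFor : ∀ b b′ → Dec (Good b b′) → Σ[ ε ∈ Carrier ] (Wide ε × (Good b b′ → Gap ε b b′))
        gapFor b b′ (yes (ε , wε , g)) = ε , wε , λ _ → g
        gapFor b b′ (no n)             = δ , w , λ g → ⊥-elim (n g)

      -- Otherwise repeated halving would yield infinitely many cuts strictly between b and b′.
      gap-escapes : ∀ {ε b b′} → (∀ b b′ → Good b b′ → Gap ε b b′) → Good b b′ →
                    ¬ (∀ y → (Σ[ u ∈ Carrier ] (u ∙ ε ≈ y × ¬ U b u)) → U b′ y → Margin ε y)
      gap-escapes {ε} {b} {b′} small g full =
        let i , j , i<j , q = pigeonhole (ℕ.n<1+n k) (λ i → proj₁ c (mid (states (Fin.toℕ i))))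
        in distinct i<j (proj₂ c q)
        where
        record State : Set ℓ where
          field
            lo hi : B
            good  : Good lo hi
            b⊆lo  : U b ⊆ U lo
            hi⊆b′ : U hi ⊆ U b′
        open State

        between : (s : State) → Σ[ d ∈ B ] (lo s ⊏ d × d ⊏ hi s)
        -- The gap gives `u` outside the lower cut with `u ∙ ε` in the upper one. As `u ∙ ε` lies in
        -- some margin, a cut `d` contains `u` but not `u ∙ ε`.
        between s with u , n , v ← small _ _ (good s)
          with d , n′ , u′ , r , v′ ← full (u ∙ ε) (u , ∙.refl , n ∘ b⊆lo s) (hi⊆b′ s v) =
          d , (u , n , U-resp d (∙-cancelʳ-≈ ε r) v′) , (u ∙ ε , n′ , v)

        mid : State → B
        mid s = proj₁ (between s)

        -- The middle cut of a stage becomes an end of the next interval, so every later middle cut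
        -- lies strictly to one side of it.
        Next : State → State → Set ℓ
        Next s t = U (lo s) ⊆ U (lo t) × U (hi t) ⊆ U (hi s) × (lo t ≡ mid s ⊎ hi t ≡ mid s)

        step : (s : State) → Σ[ t ∈ State ] Next s t
        step s with between s in eq
        ... | d , l , l′ with good-half l l′
        ... | inj₁ g = record { lo = lo s ; hi = d ; good = g ; b⊆lo = b⊆lo s ; hi⊆b′ = hi⊆b′ s ∘ ⊏⇒⊆ l′ } ,
                       id , ⊏⇒⊆ l′ , inj₂ (cong proj₁ (sym eq))
        ... | inj₂ g = record { lo = d ; hi = hi s ; good = g ; b⊆lo = ⊏⇒⊆ l ∘ b⊆lo s ; hi⊆b′ = hi⊆b′ s } ,
                       ⊏⇒⊆ l , id , inj₁ (cong proj₁ (sym eq))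

        states : ℕ → State
        states zero    = record { lo = b ; hi = b′ ; good = g ; b⊆lo = id ; hi⊆b′ = id }
        states (suc n) = proj₁ (step (states n))

        nested : ∀ {m n} → m ℕ.≤′ n → U (lo (states m)) ⊆ U (lo (states n)) ×
                                      U (hi (states n)) ⊆ U (hi (states m))
        nested (ℕ.≤′-reflexive refl) = id , id
        nested {n = suc n} (ℕ.≤′-step l) =
          let p , q = nested l ; p′ , q′ , _ = proj₂ (step (states n)) in p′ ∘ p , q ∘ q′

        distinct : ∀ {m n} → m ℕ.< n → ¬ U (mid (states m)) ≐ U (mid (states n))
        distinct {m} {n} l (i , j) with nested (ℕ.≤⇒≤′ l) | proj₂ (proj₂ (proj₂ (step (states m))))
        ... | p , q | inj₁ r = let x , n∉ , n∈ = proj₁ (proj₂ (between (states n))) in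
                               n∉ (p (subst (λ d → U d x) (sym r) (j n∈)))
        ... | p , q | inj₂ r = let x , n∉ , n∈ = proj₂ (proj₂ (between (states n))) in
                               n∉ (i (subst (λ d → U d x) r (q n∈)))

      -- A cut is coloured by the piece of `Margin ε` containing a chosen point of its own margin.
      -- If three nested cuts had the same colour, convexity would put everything between the outer
      -- two points into margins, although one of the two pairs is good and therefore leaves a point
      -- uncovered.
      fewCuts : ∀ {N} → (∀ ε → ConvexColouring N (Margin ε)) →
                Colouring (suc N ℕ.* 2) (λ b b′ → U b ≐ U b′)
      fewCuts {N} margin with em {Σ[ δ ∈ Carrier ] Wide δ}
      -- Without wide elements no pair is good, hence there is no chain of three and one colour
      -- suffices. The successor provides this colour whatever `N` is.
      ... | no n = twoPerColour {suc N} (λ _ → zero) (λ l l′ _ _ → narrow (good-half l l′))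
        where
        narrow : ∀ {b₁ b₂ b₃} → Good b₁ b₂ ⊎ Good b₂ b₃ → ⊥
        narrow (inj₁ (δ , w , _)) = n (δ , w)
        narrow (inj₂ (δ , w , _)) = n (δ , w)
      ... | yes (_ , w) with ε , (e<ε , wide) , small ← smallGap w = twoPerColour {suc N}
        (λ b → suc (proj₁ (margin ε) (proj₁ (point b)))) noTriple
        where
        point : ∀ b → Σ[ x ∈ Carrier ] (¬ U b x × (Σ[ u ∈ Carrier ] (u ∙ ε ≈ x × U b u)))
        -- If the margin of `b` were empty, `ε` would stabilize `U b`.
        point b = dne (λ n → wide b (λ u → mk⇔ (λ v → dne (λ m → n (u ∙ ε , m , u , ∙.refl , v)))
                                                (U-down b (increase u e<ε))))
        noTriple : ∀ {b₁ b₂ b₃} → b₁ ⊏ b₂ → b₂ ⊏ b₃ →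
          suc (proj₁ (margin ε) (proj₁ (point b₁))) ≡ suc (proj₁ (margin ε) (proj₁ (point b₂))) →
          suc (proj₁ (margin ε) (proj₁ (point b₂))) ≡ suc (proj₁ (margin ε) (proj₁ (point b₃))) → ⊥
        noTriple {b₁} {b₂} {b₃} l l′ q q′ = refute (good-half l l′)
          where
          full : ∀ {b b′} → U b₁ ⊆ U b → U b′ ⊆ U b₃ →
                 ∀ y → (Σ[ u ∈ Carrier ] (u ∙ ε ≈ y × ¬ U b u)) → U b′ y → Margin ε y
          full i j y (u , r , n) v =
            let x₁ , n₁ , u₁ , r₁ , v₁ = point b₁ ; x₃ , n₃ , w₃ = point b₃ in
            proj₂ (margin ε) (suc-injective (trans q q′))
              (<.<-respˡ-≈ r₁ (<.<-respʳ-≈ r (∙-monoˡ-< ε (above b₁ (n ∘ i) v₁))))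
              (above b₃ n₃ (j v)) (b₁ , n₁ , u₁ , r₁ , v₁) (b₃ , n₃ , w₃)
          refute : Good b₁ b₂ ⊎ Good b₂ b₃ → ⊥
          refute (inj₁ g) = gap-escapes small g (full id (⊏⇒⊆ l′))
          refute (inj₂ g) = gap-escapes small g (full (⊏⇒⊆ l) id)

-- Subgroups with finitely many convex components

module ConvexSubgroups {ℓ : Level} (em : ExcludedMiddle ℓ) (K : OrderedGroup ℓ) where
  open OrderedGroup K
  open Colouring em
  open Convexity _<_ <.trans
  private
    group : Group ℓ ℓ
    group = record { isGroup = isGroup }
  open GroupProperties group using (⁻¹-involutive; ⁻¹-anti-homo-∙)

  record Subgroup (H : Pred Carrier ℓ) : Set ℓ where
    field
      resp     : ∀ {x y} → x ≈ y → H x → H y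
      e-mem    : H e
      ∙-closed : ∀ {x y} → H x → H y → H (x ∙ y)
      ⁻¹-closed : ∀ {x} → H x → H (x ⁻¹)

  positive-inverse : ∀ {x} → x < e → e < x ⁻¹
  positive-inverse {x} x<e =
    <.<-respˡ-≈ (∙.inverseʳ x) (<.<-respʳ-≈ (∙.identityˡ (x ⁻¹)) (∙-monoˡ-< (x ⁻¹) x<e))

  -- Two powers aⁱ < aʲ lie in the same convex piece of H, which hence contains aⁱx.
  subgroup-convex : ∀ {H N} → Subgroup H → ConvexColouring N H → ∀ {a x} → H a → e < x → x < a → H x
  subgroup-convex {H} {N} sub (κ , convex) {a} {x} h e<x x<a =
    let i , j , i<j , q = pigeonhole (ℕ.n<1+n N) (λ i → κ (power (Fin.toℕ i)))
        n = Fin.toℕ i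
    in resp (∙.trans (∙.sym (∙.assoc _ _ _)) (∙.trans (∙.∙-congʳ (∙.inverseˡ _)) (∙.identityˡ x)))
         (∙-closed (⁻¹-closed (power-mem n))
           (convex q (increase (power n) e<x) (upTo (∙-monoʳ-< (power n) x<a) (ℕ.≤⇒≤′ i<j))
                   (power-mem n) (power-mem (Fin.toℕ j))))
    where
    open Subgroup sub
    power : ℕ → Carrier
    power zero    = e
    power (suc n) = power n ∙ a
    power-mem : ∀ n → H (power n)
    power-mem zero    = e-mem
    power-mem (suc n) = ∙-closed (power-mem n) h
    upTo : ∀ {m n z} → z < power m → m ℕ.≤′ n → z < power n
    upTo l (ℕ.≤′-reflexive refl) = l
    upTo l (ℕ.≤′-step m≤n)       = <.trans (upTo l m≤n) (increase _ (<.trans e<x x<a))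

  from-positive : ∀ {H} → Subgroup H → (∀ {x} → e < x → H x) → ∀ x → H x
  from-positive sub pos x with <.compare e x
  ... | tri< l _ _ = pos l
  ... | tri≈ _ q _ = Subgroup.resp sub q (Subgroup.e-mem sub)
  ... | tri> _ _ l = Subgroup.resp sub (⁻¹-involutive x) (Subgroup.⁻¹-closed sub (pos (positive-inverse l)))

  Centralizer : Carrier → Pred Carrier ℓ
  Centralizer g x = x ∙ g ≈ g ∙ x

  centralizer-subgroup : ∀ g → Subgroup (Centralizer g)
  centralizer-subgroup g = record
    { resp     = λ x≈y q → ∙.trans (∙.∙-congʳ (∙.sym x≈y)) (∙.trans q (∙.∙-congˡ x≈y))
    ; e-mem    = ∙.trans (∙.identityˡ g) (∙.sym (∙.identityʳ g))
    ; ∙-closed = λ {x} {y} p q → ∙.trans (∙.assoc x y g) (∙.trans (∙.∙-congˡ q)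
        (∙.trans (∙.sym (∙.assoc x g y)) (∙.trans (∙.∙-congʳ p) (∙.assoc g x y))))
    ; ⁻¹-closed = λ {x} q → ∙.trans (∙.sym (∙.identityʳ _)) (∙.trans (∙.∙-congˡ (∙.sym (∙.inverseʳ x)))
        (∙.trans (∙.sym (∙.assoc _ x (x ⁻¹))) (∙.∙-congʳ
          (∙.trans (∙.assoc (x ⁻¹) g x) (∙.trans (∙.∙-congˡ (∙.sym q))
            (∙.trans (∙.sym (∙.assoc (x ⁻¹) x g)) (∙.trans (∙.∙-congʳ (∙.inverseˡ x)) (∙.identityˡ g))))))))
    }

  -- The centralizer of `y` contains `y`, hence by convexity all positive elements below `y`. So
  -- positive elements commute, and any other element is trivial or the inverse of a positive one.
  commutative : (∀ g → ∃[ N ] ConvexColouring N (Centralizer g)) → ∀ x y → x ∙ y ≈ y ∙ x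
  commutative colouring = λ x y → from-positive (centralizer-subgroup y)
    (λ e<x → ∙.sym (from-positive (centralizer-subgroup _) (λ e<y → positive e<y e<x) y)) x
    where
    below : ∀ {x y} → e < x → x < y → x ∙ y ≈ y ∙ x
    below {x} {y} e<x x<y = subgroup-convex (centralizer-subgroup y) (proj₂ (colouring y)) ∙.refl e<x x<y
    positive : ∀ {x y} → e < x → e < y → x ∙ y ≈ y ∙ x
    positive {x} {y} e<x e<y with <.compare x y
    ... | tri< l _ _ = below e<x l
    ... | tri≈ _ q _ = ∙.∙-cong q (∙.sym q)
    ... | tri> _ _ l = ∙.sym (below e<y l)

  Square : Pred Carrier ℓ
  Square x = Σ[ η ∈ Carrier ] η ∙ η ≈ x

  -- By commutativity the squares form a subgroup, and for positive `x` it contains `x ∙ x`, which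
  -- lies above `x`.
  roots : (∀ x y → x ∙ y ≈ y ∙ x) → ∀ {N} → ConvexColouring N Square → ∀ x → Square x
  roots comm colouring = from-positive squares
    (λ {x} e<x → subgroup-convex squares colouring {x ∙ x} (x , ∙.refl) e<x (increase x e<x))
    where
    squares : Subgroup Square
    squares = record
      { resp      = λ x≈y (η , q) → η , ∙.trans q x≈y
      ; e-mem     = e , ∙.identityˡ e
      ; ∙-closed  = λ (η , q) (θ , r) → η ∙ θ , ∙.trans (∙.assoc η θ (η ∙ θ)) (∙.trans
          (∙.∙-congˡ (∙.trans (∙.sym (∙.assoc θ η θ)) (∙.trans (∙.∙-congʳ (comm θ η)) (∙.assoc η θ θ))))
          (∙.trans (∙.sym (∙.assoc η η (θ ∙ θ))) (∙.∙-cong q r)))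
      ; ⁻¹-closed = λ (η , q) → η ⁻¹ , ∙.trans (∙.sym (⁻¹-anti-homo-∙ η η)) (∙.⁻¹-cong q)
      }

-- Uniform bounds for families

module Bounded {ℓ : Level} (em : ExcludedMiddle ℓ) where
  open Colouring em

  Finite : {B : Set ℓ} → Rel B ℓ → Set ℓ
  Finite R = ∃[ k ] Colouring k R

  Bounded : {T B : Set ℓ} → (T → Rel B ℓ) → Set ℓ
  Bounded R = ∃[ N ] (∀ t → Finite (R t) → Colouring N (R t))

  -- A class of `R` is coloured throughout by the colouring that belongs to its chosen
  -- representative; colours taken from different representatives could not be compared.
  glue : ∀ {B : Set ℓ} {k m} {R Q : Rel B ℓ} → Colouring k R →
         (∀ b₀ → Colouring {Σ[ b ∈ B ] R b₀ b} m (λ b b′ → Q (proj₁ b) (proj₁ b′))) →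
         Colouring (k ℕ.* m) Q
  glue {B} {k} {m} {R} {Q} (c , p) d =
    (λ b → combine (c b) (proj₁ (d (r b)) (b , near b))) , λ {b} {b′} q →
      let q₁ , q₂ = combine-injective (c b) _ (c b′) _ q in
      go (representative-cong c q₁) (near b) (near b′) q₂
    where
    r = representative c
    near : ∀ b → R (r b) b
    near b = p (representative-colour c b)
    go : ∀ {r r′ b b′} → r ≡ r′ → (x : R r b) (y : R r′ b′) →
         proj₁ (d r) (b , x) ≡ proj₁ (d r′) (b′ , y) → Q b b′
    go {r} refl x y q = proj₂ (d r) q

  module _ (K : OrderedGroup ℓ) where
    open OrderedGroup K
    open Convexity _<_ <.trans

    -- `Same` plays the role of equality of stabilizers. It is left abstract because in a field it
    -- is equality of valuation rings, which determine the stabilizers. The number of pieces of the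
    -- margins is uniform in `t`, in the class of `b₀` and in `ε`, so the resulting bound does not
    -- see the size of the member.
    boundedCuts :
      (∀ δ → Σ[ η ∈ Carrier ] η ∙ η ≈ δ) →
      {T B : Set ℓ} (U : T → B → Pred Carrier ℓ) →
      (∀ t b {x y} → x ≈ y → U t b x → U t b y) →
      (∀ t b {x y} → y < x → U t b x → U t b y) →
      (Same : T → Rel B ℓ) →
      (∀ t {b b′} → U t b ≐ U t b′ → Same t b b′) →
      (∀ t {b b′} g → Same t b b′ → (∀ u → U t b u ⇔ U t b (u ∙ g)) ⇔ (∀ u → U t b′ u ⇔ U t b′ (u ∙ g))) →
      Bounded Same →
      ∃[ N ] (∀ t b₀ ε → ConvexColouring N (λ x →
        Σ[ b ∈ B ] (Same t b₀ b × ¬ U t b x × (Σ[ u ∈ Carrier ] (u ∙ ε ≈ x × U t b u))))) →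
      Bounded (λ t b b′ → U t b ≐ U t b′)
    boundedCuts root U resp down Same same stab (N₁ , same-bounded) (N₂ , margin) =
      _ , λ t (k , c , p) → glue (same-bounded t (k , c , same t ∘ p)) (λ b₀ →
        let open Cuts em K root {Σ[ b ∈ _ ] Same t b₀ b} (λ b → U t (proj₁ b))
                   (λ b → resp t (proj₁ b)) (λ b → down t (proj₁ b)) in
        fewCuts (λ { {b , s} {b′ , s′} {g} → to (stab t g s′) ∘ from (stab t g s) }) {k} (c ∘ proj₁ , p)
          (λ ε → let κ , convex = margin t b₀ ε in κ , λ q l l′ w w′ →
            fromW (convex q l l′ (toW w) (toW w′))))
      where
      toW : ∀ {t b₀ ε x} →
        (Σ[ b ∈ Σ[ b ∈ _ ] Same t b₀ b ] (¬ U t (proj₁ b) x × (Σ[ u ∈ Carrier ] (u ∙ ε ≈ x × U t (proj₁ b) u)))) →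
        Σ[ b ∈ _ ] (Same t b₀ b × ¬ U t b x × (Σ[ u ∈ Carrier ] (u ∙ ε ≈ x × U t b u)))
      toW ((b , s) , n , v) = b , s , n , v
      fromW : ∀ {t b₀ ε x} →
        Σ[ b ∈ _ ] (Same t b₀ b × ¬ U t b x × (Σ[ u ∈ Carrier ] (u ∙ ε ≈ x × U t b u))) →
        Σ[ b ∈ Σ[ b ∈ _ ] Same t b₀ b ] (¬ U t (proj₁ b) x × (Σ[ u ∈ Carrier ] (u ∙ ε ≈ x × U t (proj₁ b) u)))
      fromW (b , s , n , v) = (b , s) , n , v

-- Cuts in the ordered group `M`

module Additive {ℓ : Level} (em : ExcludedMiddle ℓ) (L : Language ℓ) (M : Structure (oneSorted L))
         (G : ExpandsOrderedGroup L M) (sat : ℵ₀-Saturated M) (wom : WeaklyOMinimal L M G) where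
  open Structure M
  open Definability em M
  open Colouring em
  open Bounded em
  open WeakOMinimality em L M G sat wom
  module G = ExpandsOrderedGroup G
  open G using (_≈_; _<_; _+_)

  K₊ : OrderedGroup ℓ
  K₊ = record { isGroup = G.isGroup ; isStrictTotalOrder = G.isStrictTotalOrder
              ; ∙-monoˡ-< = G.+-monoˡ-< ; ∙-monoʳ-< = G.+-monoʳ-< }

  module K₊ = OrderedGroup K₊

  plusᵈ : ∀ {C} (u v w : Var C pt) → Def C (λ a → at C u a + at C v a ≈ at C w a)
  plusᵈ u v w = atom (app G.plus (var (here refl) ∷ var (there (here refl)) ∷ []) ≈′ var (there (there (here refl))))
                     (u ∷ v ∷ w ∷ [])

  halve : ∀ x → Σ[ y ∈ Point L M ] y + y ≈ x
  halve = ConvexSubgroups.roots em K₊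
    (ConvexSubgroups.commutative em K₊ (λ g → map₂ (λ h → h g) centralizers)) (proj₂ squares G.0#)
    where
    centralizers : ∃[ N ] (∀ g → ConvexColouring N (λ x → x + g ≈ g + x))
    centralizers = uniformConvexColouring {C = params (Point L M)}
      (atom (app G.plus (var (here refl) ∷ var (there (here refl)) ∷ []) ≈′
             app G.plus (var (there (here refl)) ∷ var (here refl) ∷ [])) (new ∷ inj₁ id ∷ []))
    squares : ∃[ N ] (Point L M → ConvexColouring N (λ x → Σ[ y ∈ Point L M ] y + y ≈ x))
    squares = uniformConvexColouring {C = params (Point L M)} (Def-∃ (plusᵈ new new (inj₁ new)))

  -- The hypothesis of the theorem in the form used for counting: it speaks of families of sets and
  -- not of sets of imaginaries. As `T` is arbitrary, auxiliary data can be added to the index.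
  AllBounded : Pred (Pred (Point L M) ℓ) ℓ → Set (Level.suc ℓ)
  AllBounded 𝓒 = ∀ {T : Set ℓ} {Δ} (H : T → Env Δ → Pred (Point L M) ℓ) →
    Def (params T ⊗ Δ ▹ pt) (λ ((t , b) , x) → H t b x) → (∀ t b → 𝓒 (H t b)) →
    Bounded (λ t b b′ → H t b ≐ H t b′)

  ConvexSubgroup : Pred (Pred (Point L M) ℓ) ℓ
  ConvexSubgroup H = Convex L M G H × IsSubgroup L M G H

  -- The parameters of a margin: the member `t`, a cut `b₀` that fixes the stabilizer, and the shift
  -- `ε`.
  Param : Set ℓ → List (Signature.Sort (oneSorted L)) → Set ℓ
  Param T Δ = T × Env Δ × Point L M

  module _ {T : Set ℓ} {Δ : List (Signature.Sort (oneSorted L))} where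

    cut : params (Param T Δ) ▹ pt ⊗ Δ ⇒ params T ⊗ Δ
    cut = record
      { ⟦_⟧ = λ (((t , _) , _) , b) → t , b
      ; ren = λ { (inj₁ f) → inj₁ (inj₁ (λ (t , _) → f t)) ; (inj₂ v) → inj₂ v }
      ; nat = λ { (inj₁ f) _ → refl ; (inj₂ v) _ → refl } }

    cut₀ : params (Param T Δ) ▹ pt ⊗ Δ ⇒ params T ⊗ Δ
    cut₀ = record
      { ⟦_⟧ = λ (((t , b₀ , _) , _) , _) → t , b₀
      ; ren = λ { (inj₁ f) → inj₁ (inj₁ (λ (t , _) → f t))
                ; (inj₂ v) → inj₁ (inj₁ (λ (_ , b₀ , _) → All.lookup b₀ v)) }
      ; nat = λ { (inj₁ f) _ → refl ; (inj₂ v) _ → refl } }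

  module _ {T : Set ℓ} {Δ} (U : T → Env Δ → Pred (Point L M) ℓ)
           (U-def : Def (params T ⊗ Δ ▹ pt) (λ ((t , b) , x) → U t b x))
           (U-down : ∀ t b {x y} → y < x → U t b x → U t b y) where

    U-resp : ∀ t b {x y} → x ≈ y → U t b x → U t b y
    U-resp t b = Def-resp U-def (t , b)

    -- The sum is named by a variable `w` because definability is tracked through coordinates and
    -- not through terms.
    Stabilizer : T → Env Δ → Pred (Point L M) ℓ
    Stabilizer t b g = ∀ u w → u + g ≈ w → (U t b u → U t b w) × (U t b w → U t b u)

    stabilizer-def : Def (params T ⊗ Δ ▹ pt) (λ ((t , b) , g) → Stabilizer t b g)
    stabilizer-def = Def-∀ (Def-∀ (Def-→ (plusᵈ (inj₁ new) (inj₁ (inj₁ new)) new)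
      (Def-↔ (U-def [ idᶜ ↑ ↑ ↑ ,, inj₁ new ]) (U-def [ idᶜ ↑ ↑ ↑ ,, new ]))))

    stabilizer-⇔ : ∀ {t b g} → Stabilizer t b g ⇔ (∀ u → U t b u ⇔ U t b (u + g))
    stabilizer-⇔ {t} {b} {g} = mk⇔
      (λ s u → mk⇔ (proj₁ (s u (u + g) K₊.∙.refl)) (proj₂ (s u (u + g) K₊.∙.refl)))
      (λ s u w q → U-resp t b q ∘ to (s u) , from (s u) ∘ U-resp t b (K₊.∙.sym q))

    -- For convexity, downward closure of the cut yields one implication from the larger stabilizing
    -- element and the other from the smaller one.
    stabilizer-convex : ∀ t b → ConvexSubgroup (Stabilizer t b)
    stabilizer-convex t b =
      (λ {x} {y} {z} sx sz x<y y<z → from stabilizer-⇔ (λ u → mk⇔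
        (λ v → U-down t b (G.+-monoʳ-< u y<z) (to (to stabilizer-⇔ sz u) v))
        (λ v → from (to stabilizer-⇔ sx u) (U-down t b (G.+-monoʳ-< u x<y) v)))) ,
      record
        { 0#-mem = from stabilizer-⇔ (λ u → mk⇔ (U-resp t b (K₊.∙.sym (K₊.∙.identityʳ u)))
                                                  (U-resp t b (K₊.∙.identityʳ u)))
        ; +-closed = λ {x} {y} sx sy → from stabilizer-⇔ (λ u → mk⇔
            (U-resp t b (K₊.∙.assoc u x y) ∘ to (to stabilizer-⇔ sy (u + x)) ∘ to (to stabilizer-⇔ sx u))
            (from (to stabilizer-⇔ sx u) ∘ from (to stabilizer-⇔ sy (u + x)) ∘ U-resp t b (K₊.∙.sym (K₊.∙.assoc u x y))))
        ; -‿closed = λ {x} sx → from stabilizer-⇔ (λ u →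
            let q = K₊.∙.trans (K₊.∙.assoc u (G.- x) x) (K₊.∙.trans (K₊.∙.∙-congˡ (K₊.∙.inverseˡ x)) (K₊.∙.identityʳ u)) in
            mk⇔ (from (to stabilizer-⇔ sx (u + (G.- x))) ∘ U-resp t b (K₊.∙.sym q))
                (U-resp t b q ∘ to (to stabilizer-⇔ sx (u + (G.- x)))))
        }

    private
      margins : ∃[ N ] (∀ ((t , b₀ , ε) : Param T Δ) → ConvexColouring N (λ x →
        Σ[ b ∈ Env Δ ] (Stabilizer t b₀ ≐ Stabilizer t b × ¬ U t b x × (Σ[ u ∈ Point L M ] (u + ε ≈ x × U t b u)))))
      margins = uniformConvexColouring (Def-∃* Δ (Def-×
        (Def-≐ (stabilizer-def [ cut₀ ↑ ,, new ]) (stabilizer-def [ cut ↑ ,, new ]))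
        (Def-× (Def-¬ (U-def [ cut ,, inj₁ new ]))
          (Def-∃ (Def-× (plusᵈ new (inj₁ (inj₁ (inj₁ (λ (_ , _ , ε) → ε)))) (inj₁ (inj₁ new)))
                        (U-def [ cut ↑ ,, new ]))))))

    cutsBounded : AllBounded ConvexSubgroup → Bounded (λ t b b′ → U t b ≐ U t b′)
    cutsBounded bounded = boundedCuts K₊ halve U U-resp U-down (λ t b b′ → Stabilizer t b ≐ Stabilizer t b′)
      (λ t (i , j) → (λ s u w q → i ∘ proj₁ (s u w q) ∘ j , i ∘ proj₂ (s u w q) ∘ j) ,
                     (λ s u w q → j ∘ proj₁ (s u w q) ∘ i , j ∘ proj₂ (s u w q) ∘ i))
      (λ t g (i , j) → mk⇔ (to stabilizer-⇔ ∘ i ∘ from stabilizer-⇔) (to stabilizer-⇔ ∘ j ∘ from stabilizer-⇔))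
      (bounded Stabilizer stabilizer-def stabilizer-convex)
      (proj₁ margins , λ t b₀ ε → proj₂ margins (t , b₀ , ε))

-- Convex subgroups of an ordered field through their valuation rings

module Multiplicative {ℓ : Level} (em : ExcludedMiddle ℓ) (L : Language ℓ) (M : Structure (oneSorted L))
         (G : ExpandsOrderedGroup L M) (sat : ℵ₀-Saturated M) (wom : WeaklyOMinimal L M G)
         (F : ExpandsOrderedField L M G) where
  open Structure M
  open Definability em M
  open Colouring em
  open Bounded em
  open WeakOMinimality em L M G sat wom
  open Additive em L M G sat wom
  open G using (_≈_; _<_; _+_; -_; 0#)
  module F = ExpandsOrderedField F
  open F using (_*_; 1#; *-pos)
  private
    ring : CommutativeRing ℓ ℓ
    ring = record { isCommutativeRing = F.isCommutativeRing }
    module R = CommutativeRing ring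
    module O₊ = K₊.<
  open RingProperties R.ring using (-‿distribˡ-*; -‿distribʳ-*; -‿involutive)
  open SetoidReasoning R.setoid
  open ConvexSubgroups em K₊ using (positive-inverse)

  *-monoʳ-< : ∀ z {x y} → 0# < z → x < y → z * x < z * y
  *-monoʳ-< z {x} {y} 0<z x<y = K₊.∙-cancelʳ-< (- (z * x))
    (O₊.<-respˡ-≈ (R.sym (R.-‿inverseʳ (z * x))) (O₊.<-respʳ-≈ expand (*-pos 0<z
      (O₊.<-respˡ-≈ (R.-‿inverseʳ x) (G.+-monoˡ-< (- x) x<y)))))
    where
    expand : z * (y + (- x)) ≈ z * y + (- (z * x))
    expand = R.trans (R.distribˡ z y (- x)) (R.+-congˡ (R.sym (-‿distribʳ-* z x)))

  *-monoˡ-< : ∀ z {x y} → 0# < z → x < y → x * z < y * z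
  *-monoˡ-< z 0<z x<y = O₊.<-respˡ-≈ (R.*-comm z _) (O₊.<-respʳ-≈ (R.*-comm z _) (*-monoʳ-< z 0<z x<y))

  neg*neg : ∀ x y → (- x) * (- y) ≈ x * y
  neg*neg x y = R.trans (R.sym (-‿distribˡ-* x (- y)))
    (R.trans (R.-‿cong (R.sym (-‿distribʳ-* x y))) (-‿involutive (x * y)))

  0<1 : 0# < 1#
  0<1 with O₊.compare 0# 1#
  ... | tri< l _ _ = l
  ... | tri≈ _ q _ = ⊥-elim (F.0≉1 q)
  ... | tri> _ _ l = O₊.<-respʳ-≈ (R.trans (neg*neg 1# 1#) (R.*-identityˡ 1#))
                       (*-pos (positive-inverse l) (positive-inverse l))

  inverse-positive : ∀ {x y} → 0# < x → x * y ≈ 1# → 0# < y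
  inverse-positive {x} {y} 0<x q with O₊.compare 0# y
  ... | tri< l _ _ = l
  ... | tri≈ _ r _ = ⊥-elim (F.0≉1 (R.trans (R.sym (R.zeroʳ x)) (R.trans (R.*-congˡ r) q)))
  ... | tri> _ _ l = ⊥-elim (O₊.asym 0<1 (O₊.<-respʳ-≈ (R.zeroʳ x)
                       (O₊.<-respˡ-≈ q (*-monoʳ-< x 0<x l))))

  Positive : Set ℓ
  Positive = Σ[ x ∈ Point L M ] 0# < x

  private
    recip : (x : Positive) → Σ[ y ∈ Point L M ] proj₁ x * y ≈ 1#
    recip (x , 0<x) = F.inverse x (λ q → O₊.irrefl (R.sym q) 0<x)

  K× : OrderedGroup ℓ
  K× = record
    { Carrier = Positive
    ; _≈_ = λ x y → proj₁ x ≈ proj₁ y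
    ; _<_ = λ x y → proj₁ x < proj₁ y
    ; _∙_ = λ (x , p) (y , q) → x * y , *-pos p q
    ; e = 1# , 0<1
    ; _⁻¹ = λ x → proj₁ (recip x) , inverse-positive (proj₂ x) (proj₂ (recip x))
    ; isGroup = record
      { isMonoid = record
        { isSemigroup = record
          { isMagma = record { isEquivalence = On.isEquivalence proj₁ R.isEquivalence ; ∙-cong = R.*-cong }
          ; assoc = λ x y z → R.*-assoc _ _ _ }
        ; identity = (λ x → R.*-identityˡ _) , (λ x → R.*-identityʳ _) }
      ; inverse = (λ x → R.trans (R.*-comm _ _) (proj₂ (recip x))) , (λ x → proj₂ (recip x))
      ; ⁻¹-cong = λ {x} {y} → cong⁻¹ x y }
    ; isStrictTotalOrder = On.isStrictTotalOrder proj₁ G.isStrictTotalOrder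
    ; ∙-monoˡ-< = λ (z , p) l → *-monoˡ-< z p l
    ; ∙-monoʳ-< = λ (z , p) l → *-monoʳ-< z p l
    }
    where
    cong⁻¹ : ∀ x y → proj₁ x ≈ proj₁ y → proj₁ (recip x) ≈ proj₁ (recip y)
    cong⁻¹ x y q = begin
      proj₁ (recip x)                               ≈⟨ R.*-identityʳ _ ⟨
      proj₁ (recip x) * 1#                          ≈⟨ R.*-congˡ (proj₂ (recip y)) ⟨
      proj₁ (recip x) * (proj₁ y * proj₁ (recip y)) ≈⟨ R.*-assoc _ _ _ ⟨
      proj₁ (recip x) * proj₁ y * proj₁ (recip y)   ≈⟨ R.*-congʳ (R.*-congˡ q) ⟨
      proj₁ (recip x) * proj₁ x * proj₁ (recip y)   ≈⟨ R.*-congʳ (R.*-comm _ _) ⟩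
      proj₁ x * proj₁ (recip x) * proj₁ (recip y)   ≈⟨ R.*-congʳ (proj₂ (recip x)) ⟩
      1# * proj₁ (recip y)                          ≈⟨ R.*-identityˡ _ ⟩
      proj₁ (recip y)                               ∎

  module K× = OrderedGroup K×

  timesᵈ : ∀ {C} (u v w : Var C pt) → Def C (λ a → at C u a * at C v a ≈ at C w a)
  timesᵈ u v w = atom (app F.times (var (here refl) ∷ var (there (here refl)) ∷ []) ≈′ var (there (there (here refl))))
                      (u ∷ v ∷ w ∷ [])

  private
    module C× = Convexity K×._<_ (λ {x} {y} {z} → K×.<.trans {x} {y} {z})

  restrict : ∀ {N W} {V : Pred Positive ℓ} → (∀ x → V x ⇔ W (proj₁ x)) →
             ConvexColouring N W → C×.ConvexColouring N V
  restrict h (κ , convex) = (λ x → κ (proj₁ x)) , λ {x} {y} {z} q l l′ v w →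
    from (h y) (convex q l l′ (to (h x) v) (to (h z) w))

  squareRoot : ∀ x → Σ[ y ∈ Positive ] y K×.∙ y K×.≈ x
  squareRoot = ConvexSubgroups.roots em K× (λ x y → R.*-comm _ _)
    (restrict (λ x → mk⇔ (λ ((y , p) , q) → y , p , q) (λ (y , p , q) → (y , p) , q)) (proj₂ squares G.0#))
    where
    squares : ∃[ N ] (Point L M → ConvexColouring N (λ x → Σ[ y ∈ Point L M ] (0# < y × y * y ≈ x)))
    squares = uniformConvexColouring {C = params (Point L M)}
      (Def-∃ (Def-× (inj₁ (inj₁ (λ _ → 0#)) <ᵈ new) (timesᵈ new new (inj₁ new))))

  ConvexValuationSubring : Pred (Pred (Point L M) ℓ) ℓ
  ConvexValuationSubring O = Convex L M G O × IsValuationSubring L M G F O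

  module Multiplier {H : Pred (Point L M) ℓ} (H-resp : ∀ {x y} → x ≈ y → H x → H y)
                    (H-sub : ConvexSubgroup H) where
    convex = proj₁ H-sub
    open IsSubgroup (proj₂ H-sub)

    Multipliers : Pred (Point L M) ℓ
    Multipliers x = ∀ h w → x * h ≈ w → H h → H w

    -‿cancel : ∀ {x} → H (- x) → H x
    -‿cancel h = H-resp (-‿involutive _) (-‿closed h)

    multiplies : ∀ {x} → (∀ h → 0# < h → H h → H (x * h)) → Multipliers x
    multiplies {x} f h w q p with O₊.compare 0# h
    ... | tri< l _ _ = H-resp q (f h l p)
    ... | tri≈ _ r _ = H-resp (R.trans (R.sym (R.zeroʳ x)) (R.trans (R.*-congˡ r) q)) 0#-mem
    ... | tri> _ _ l = H-resp q (-‿cancel (H-resp (R.sym (-‿distribʳ-* x h))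
                         (f (- h) (positive-inverse l) (-‿closed p))))

    multipliers-subgroup : IsSubgroup L M G Multipliers
    multipliers-subgroup = record
      { 0#-mem   = λ h w q _ → H-resp (R.trans (R.sym (R.zeroˡ h)) q) 0#-mem
      ; +-closed = λ {x} {y} f g h w q p → H-resp (R.trans (R.sym (R.distribʳ h x y)) q)
                     (+-closed (f h _ R.refl p) (g h _ R.refl p))
      ; -‿closed = λ {x} f h w q p → H-resp (R.trans (-‿distribˡ-* x h) q) (-‿closed (f h _ R.refl p))
      }

    multipliers-convex : Convex L M G Multipliers
    multipliers-convex f g x<y y<z = multiplies (λ h 0<h p →
      convex (f h _ R.refl p) (g h _ R.refl p) (*-monoˡ-< h 0<h x<y) (*-monoˡ-< h 0<h y<z))

    1-multiplies : Multipliers 1#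
    1-multiplies h w q p = H-resp (R.trans (R.sym (R.*-identityˡ h)) q) p

    private
      -- One of `x` and its inverse lies above 0 and not above 1, and the multipliers form a convex
      -- set containing 0 and 1.
      positive-valuation : ∀ x y → 0# < x → x * y ≈ 1# → Multipliers x ⊎ Multipliers y
      positive-valuation x y 0<x q with O₊.compare x 1#
      ... | tri< l _ _ = inj₁ (multipliers-convex (IsSubgroup.0#-mem multipliers-subgroup) 1-multiplies 0<x l)
      ... | tri≈ _ r _ = inj₁ (λ h w s → 1-multiplies h w (R.trans (R.*-congʳ (R.sym r)) s))
      ... | tri> _ _ l = inj₂ (multipliers-convex (IsSubgroup.0#-mem multipliers-subgroup) 1-multiplies 0<y
              (O₊.<-respˡ-≈ (R.*-identityˡ y) (O₊.<-respʳ-≈ q (*-monoˡ-< y 0<y l))))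
        where 0<y = inverse-positive 0<x q

    multipliers-valuation : ConvexValuationSubring Multipliers
    multipliers-valuation = multipliers-convex , record
      { isSubgroup = multipliers-subgroup
      ; 1#-mem     = 1-multiplies
      ; *-closed   = λ {x} {y} f g h w q p →
          f (y * h) w (R.trans (R.sym (R.*-assoc x y h)) q) (g h _ R.refl p)
      ; valuation  = valuation
      }
      where
      negate : ∀ {x} → Multipliers (- x) → Multipliers x
      negate {x} f h w q = IsSubgroup.-‿closed multipliers-subgroup f h w
        (R.trans (R.*-congʳ (-‿involutive x)) q)
      valuation : ∀ x y → x * y ≈ 1# → Multipliers x ⊎ Multipliers y
      valuation x y q with O₊.compare 0# x
      ... | tri< l _ _ = positive-valuation x y l q
      ... | tri≈ _ r _ = ⊥-elim (F.0≉1 (R.trans (R.sym (R.zeroˡ y)) (R.trans (R.*-congʳ r) q)))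
      ... | tri> _ _ l = Sum.map negate negate
              (positive-valuation (- x) (- y) (positive-inverse l) (R.trans (neg*neg x y) q))

    -- The stabilizer in `K×` of the positive part of `H`. It consists of the positive units of the
    -- ring of multipliers, and so depends on that ring only.
    Stable : Positive → Set ℓ
    Stable g = ∀ u → H (proj₁ u) ⇔ H (proj₁ (u K×.∙ g))

    stable⇒multiplies : ∀ {g} → Stable g → Multipliers (proj₁ g)
    stable⇒multiplies s = multiplies (λ h 0<h p → H-resp (R.*-comm _ _) (to (s (h , 0<h)) p))

    stable-⁻¹ : ∀ {g} → Stable g → Stable (g K×.⁻¹)
    stable-⁻¹ {g} s u = mk⇔
      (λ p → from (s (u K×.∙ (g K×.⁻¹))) (H-resp (R.sym q) p))
      (λ p → H-resp q (to (s (u K×.∙ (g K×.⁻¹))) p))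
      where
      q : proj₁ ((u K×.∙ (g K×.⁻¹)) K×.∙ g) ≈ proj₁ u
      q = R.trans (R.*-assoc _ _ _) (R.trans (R.*-congˡ (K×.∙.inverseˡ g)) (R.*-identityʳ _))

    multiplies⇒stable : ∀ {g} → Multipliers (proj₁ g) → Multipliers (proj₁ (g K×.⁻¹)) → Stable g
    multiplies⇒stable {g} f f′ u = mk⇔ (f (proj₁ u) _ (R.*-comm _ _))
      (f′ (proj₁ u * proj₁ g) (proj₁ u)
        (R.trans (R.*-comm _ _) (R.trans (R.*-assoc _ _ _) (R.trans (R.*-congˡ (K×.∙.inverseʳ g)) (R.*-identityʳ _)))))

    -- Ensures that the passage to `K×` loses nothing: convex subgroups with the same positive
    -- elements are equal.
    from-positives : ∀ {P : Pred (Point L M) ℓ} → (∀ {x y} → x ≈ y → P x → P y) → IsSubgroup L M G P →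
                     (∀ (u : Positive) → H (proj₁ u) → P (proj₁ u)) → ∀ {x} → H x → P x
    from-positives resp sub f {x} p with O₊.compare 0# x
    ... | tri< l _ _ = f (x , l) p
    ... | tri≈ _ q _ = resp q (IsSubgroup.0#-mem sub)
    ... | tri> _ _ l = resp (-‿involutive x)
                         (IsSubgroup.-‿closed sub (f (- x , positive-inverse l) (-‿closed p)))

  convexSubgroupsBounded : AllBounded ConvexValuationSubring → AllBounded ConvexSubgroup
  convexSubgroupsBounded bounded {T} {Δ} H H-def H-sub =
    let N , β = positivesBounded in
    N , λ t (k , c , p) → recolour (fromU t) (β t (k , c , toU t ∘ p))
    where
    H-resp : ∀ t b {x y} → x ≈ y → H t b x → H t b y
    H-resp t b = Def-resp H-def (t , b)

    module Mult t b = Multiplier {H t b} (H-resp t b) (H-sub t b)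

    U : T → Env Δ → Pred Positive ℓ
    U t b u = H t b (proj₁ u)

    toU : ∀ t {b b′} → H t b ≐ H t b′ → U t b ≐ U t b′
    toU t (i , j) = i , j

    fromU : ∀ t {b b′} → U t b ≐ U t b′ → H t b ≐ H t b′
    fromU t {b} {b′} (i , j) =
      Mult.from-positives t b (H-resp t b′) (proj₂ (H-sub t b′)) (λ u → i {u}) ,
      Mult.from-positives t b′ (H-resp t b) (proj₂ (H-sub t b)) (λ u → j {u})

    O : T → Env Δ → Pred (Point L M) ℓ
    O t b = Mult.Multipliers t b

    O-def : Def (params T ⊗ Δ ▹ pt) (λ ((t , b) , x) → O t b x)
    O-def = Def-∀ (Def-∀ (Def-→ (timesᵈ (inj₁ (inj₁ new)) (inj₁ new) new)
      (Def-→ (H-def [ idᶜ ↑ ↑ ↑ ,, inj₁ new ]) (H-def [ idᶜ ↑ ↑ ↑ ,, new ]))))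

    same : ∀ t {b b′} → U t b ≐ U t b′ → O t b ≐ O t b′
    same t u = let i , j = fromU t u in
      (λ f h w q → i ∘ f h w q ∘ j) , (λ f h w q → j ∘ f h w q ∘ i)

    stable : ∀ t {b b′} g → O t b ≐ O t b′ → Mult.Stable t b g → Mult.Stable t b′ g
    stable t {b} {b′} g (i , j) s = Mult.multiplies⇒stable t b′ {g}
      (i (Mult.stable⇒multiplies t b {g} s)) (i (Mult.stable⇒multiplies t b {g K×.⁻¹} (Mult.stable-⁻¹ t b {g} s)))

    -- The margin in `K×`, written as a subset of `M` so that weak o-minimality applies to it;
    -- `restrict` carries the colouring back to the positive elements.
    Margin : Param T Δ → Pred (Point L M) ℓ
    Margin (t , b₀ , ε) x = Σ[ b ∈ Env Δ ] (O t b₀ ≐ O t b × ¬ H t b x ×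
      (Σ[ u ∈ Point L M ] (0# < u × u * ε ≈ x × H t b u)))

    margins : ∃[ N ] (∀ p → ConvexColouring N (Margin p))
    margins = uniformConvexColouring (Def-∃* Δ (Def-×
      (Def-≐ (O-def [ cut₀ ↑ ,, new ]) (O-def [ cut ↑ ,, new ]))
      (Def-× (Def-¬ (H-def [ cut ,, inj₁ new ]))
        (Def-∃ (Def-× (inj₁ (inj₁ (inj₁ (λ _ → 0#))) <ᵈ new)
          (Def-× (timesᵈ new (inj₁ (inj₁ (inj₁ (λ (_ , _ , ε) → ε)))) (inj₁ (inj₁ new)))
                 (H-def [ cut ↑ ,, new ])))))))

    positivesBounded : Bounded (λ t b b′ → U t b ≐ U t b′)
    positivesBounded = boundedCuts K× squareRoot U (λ t b → H-resp t b)
      (λ t b {x} {y} y<x h → proj₁ (H-sub t b) (IsSubgroup.0#-mem (proj₂ (H-sub t b))) h (proj₂ y) y<x)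
      (λ t b b′ → O t b ≐ O t b′) (same)
      (λ t g (i , j) → mk⇔ (stable t g (i , j)) (stable t g (j , i)))
      (bounded O O-def (λ t b → Mult.multipliers-valuation t b))
      (proj₁ margins , λ t b₀ ε → restrict
        (λ x → mk⇔ (λ (b , s , n , (u , p) , w) → b , s , n , u , p , w)
                   (λ (b , s , n , u , p , w) → b , s , n , (u , p) , w))
        (proj₂ margins (t , b₀ , proj₁ ε)))

-- Definable families of subsets of powers of `M`

module Families {ℓ : Level} (em : ExcludedMiddle ℓ) (L : Language ℓ) (M : Structure (oneSorted L))
         (G : ExpandsOrderedGroup L M) (sat : ℵ₀-Saturated M) (wom : WeaklyOMinimal L M G) where
  open Structure M
  open Definability em M
  open Colouring em
  open Bounded em
  open WeakOMinimality em L M G sat wom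
  open Additive em L M G sat wom
  open G using (_≈_; _<_; _+_)

  module LineSets {T : Set ℓ} {Δ} (D : T → Env Δ → Pred (Point L M) ℓ)
                  (D-def : Def (params T ⊗ Δ ▹ pt) (λ ((t , b) , x) → D t b x)) where

    -- The upper end of the maximal convex set around a on which membership in D t b is constant.
    Reach : T → Env (pt ∷ Δ) → Pred (Point L M) ℓ
    Reach t e x = ∀ y → ¬ y < All.head e → ¬ x < y →
      (D t (All.tail e) y → D t (All.tail e) (All.head e)) × (D t (All.tail e) (All.head e) → D t (All.tail e) y)

    reach-def : Def (params T ⊗ (pt ∷ Δ) ▹ pt) (λ ((t , e) , x) → Reach t e x)
    reach-def = Def-⇔ (λ { ((t , a ∷ b) , x) → mk⇔ id id })
      (Def-∀ (Def-→ (Def-¬ (new <ᵈ a)) (Def-→ (Def-¬ (inj₁ new <ᵈ new))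
        (Def-↔ (D-def [ set ,, new ]) (D-def [ set ,, a ])))))
      where
      a : Var (params T ⊗ (pt ∷ Δ) ▹ pt ▹ pt) pt
      a = inj₁ (inj₁ (inj₂ (here refl)))
      set : params T ⊗ (pt ∷ Δ) ▹ pt ▹ pt ⇒ params T ⊗ Δ
      set = record
        { ⟦_⟧ = λ (((t , e) , _) , _) → t , All.tail e
        ; ren = λ { (inj₁ f) → inj₁ (inj₁ (inj₁ f)) ; (inj₂ v) → inj₁ (inj₁ (inj₂ (there v))) }
        ; nat = λ { (inj₁ f) _ → refl ; (inj₂ v) (((t , a ∷ b) , _) , _) → refl } }

    reach-down : ∀ t e {x y} → y < x → Reach t e x → Reach t e y
    reach-down t e y<x r z n m = r z n (λ x<z → m (<.trans y<x x<z))

    D-resp : ∀ t b {x y} → x ≈ y → D t b x → D t b y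
    D-resp t b = Def-resp D-def (t , b)

    private
      inside : ∃[ N ] (∀ ((t , b) : T × Env Δ) → ConvexColouring N (D t b))
      inside = uniformConvexColouring D-def

      outside : ∃[ N ] (∀ ((t , b) : T × Env Δ) → ConvexColouring N (λ x → ¬ D t b x))
      outside = uniformConvexColouring (Def-¬ D-def)

    SamePiece : ∀ {N N′ t b} → ConvexColouring N (D t b) → ConvexColouring N′ (λ x → ¬ D t b x) →
                Rel (Point L M) ℓ
    SamePiece {t = t} {b} (κ , _) (κ′ , _) a a′ =
      (κ a ≡ κ a′ × κ′ a ≡ κ′ a′) × (D t b a ⇔ D t b a′)

    samePiece : ∀ {N N′ t b} (κ : ConvexColouring N (D t b)) (κ′ : ConvexColouring N′ (λ x → ¬ D t b x)) →
                ∀ {a a′ y} → SamePiece κ κ′ a a′ → a < y → y < a′ → D t b y ⇔ D t b a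
    samePiece {t = t} {b} (κ , convex) (κ′ , convex′) {a} {a′} {y} ((q , q′) , e) a<y y<a′ = mk⇔
      (λ d → dne (λ n → convex′ q′ a<y y<a′ n (n ∘ from e) d))
      (λ d → convex q a<y y<a′ d (to e d))

    samePiece-sym : ∀ {N N′ t b} (κ : ConvexColouring N (D t b)) (κ′ : ConvexColouring N′ (λ x → ¬ D t b x)) →
                    ∀ {a a′} → SamePiece κ κ′ a a′ → SamePiece κ κ′ a′ a
    samePiece-sym _ _ ((q , q′) , e) = (sym q , sym q′) , mk⇔ (from e) (to e)

    -- The end depends on the piece containing `a` and not on `a` itself: when `a` is replaced by
    -- `a′`, the only new points to check lie between the two, where membership is constant.
    reach-⊆ : ∀ {N N′ t b₀} (κ : ConvexColouring N (D t b₀)) (κ′ : ConvexColouring N′ (λ x → ¬ D t b₀ x)) →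
              ∀ {a a′ b b′} → D t b₀ ≐ D t b → D t b₀ ≐ D t b′ → SamePiece κ κ′ a a′ →
              ∀ {x} → Reach t (a ∷ b) x → Reach t (a′ ∷ b′) x
    reach-⊆ {t = t} {b₀} κ κ′ {a} {a′} {b} {b′} (i , j) (i′ , j′) s@(_ , e) {x} r y n m =
      i′ ∘ to e ∘ to at-y ∘ j′ , i′ ∘ from at-y ∘ from e ∘ j′
      where
      at-y : D t b₀ y ⇔ D t b₀ a
      at-y with <.compare y a
      ... | tri≈ _ q _ = mk⇔ (D-resp t b₀ q) (D-resp t b₀ (K₊.∙.sym q))
      ... | tri> n′ _ _ = mk⇔ (j ∘ proj₁ (r y n′ m) ∘ i) (j ∘ proj₂ (r y n′ m) ∘ i)
      ... | tri< y<a _ _ with <.compare a′ y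
      ...   | tri< a′<y _ _ = let f = samePiece κ κ′ (samePiece-sym κ κ′ s) a′<y y<a in
                              mk⇔ (from e ∘ to f) (from f ∘ to e)
      ...   | tri≈ _ q _ = mk⇔ (from e ∘ D-resp t b₀ (K₊.∙.sym q)) (D-resp t b₀ q ∘ to e)
      ...   | tri> _ _ y<a′ = ⊥-elim (n y<a′)

    -- Cuts are bounded only in finite members, so finiteness must pass from the sets to their ends.
    -- Each set has finitely many pieces, and a piece has one upper end.
    reach-finite : ∀ t → Finite (λ b b′ → D t b ≐ D t b′) → Finite (λ e e′ → Reach t e ≐ Reach t e′)
    reach-finite t (k , c , p) = _ , glue {R = λ e e′ → D t (All.tail e) ≐ D t (All.tail e′)}
      (c ∘ All.tail , p) (λ e₀ → pieces e₀ (proj₂ inside (t , All.tail e₀)) (proj₂ outside (t , All.tail e₀)))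
      where
      pieces : ∀ e₀ {N N′} → ConvexColouring N (D t (All.tail e₀)) →
               ConvexColouring N′ (λ x → ¬ D t (All.tail e₀) x) →
               Colouring {Σ[ e ∈ Env (pt ∷ Δ) ] D t (All.tail e₀) ≐ D t (All.tail e)} (N ℕ.* N′ ℕ.* 2)
                 (λ e e′ → Reach t (proj₁ e) ≐ Reach t (proj₁ e′))
      pieces e₀ κ κ′ = recolour {Q = λ e e′ → Reach t (proj₁ e) ≐ Reach t (proj₁ e′)}
        (λ { {a ∷ b , s} {a′ ∷ b′ , s′} q →
               reach-⊆ κ κ′ s s′ q , reach-⊆ κ κ′ s′ s (samePiece-sym κ κ′ q) })
        ((_⊗ᶜ_ {R = λ e e′ → proj₁ κ (point e) ≡ proj₁ κ (point e′)}
                {Q = λ e e′ → proj₁ κ′ (point e) ≡ proj₁ κ′ (point e′)}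
                ((λ e → proj₁ κ (point e)) , id) ((λ e → proj₁ κ′ (point e)) , id))
          ⊗ᶜ bit (λ e → D t (All.tail e₀) (point e)))
        where
        point : Σ[ e ∈ Env (pt ∷ Δ) ] D t (All.tail e₀) ≐ D t (All.tail e) → Point L M
        point (e , _) = All.head e

    -- The `N` cuts divide the line into at most `2 ^ N` atoms. Two points of one atom are not
    -- separated by the end of the piece starting at the lower one, so each `D t b` is a union of
    -- atoms and is determined by the set of atoms that it meets.
    setsColouring : ∀ t {N} → Colouring N (λ e e′ → Reach t e ≐ Reach t e′) →
                    Colouring (2 ℕ.^ (2 ℕ.^ N)) (λ b b′ → D t b ≐ D t b′)
    setsColouring t {N} (c , p) = recolour {Q = λ b b′ → D t b ≐ D t b′}
      (λ q → included (to ∘ q) , included (from ∘ q)) (bits Meets)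
      where
      Atom : Fin N → Pred (Point L M) ℓ
      Atom i x = Σ[ e ∈ Env (pt ∷ Δ) ] (c e ≡ i × Reach t e x)

      atoms : Colouring (2 ℕ.^ N) (λ x x′ → ∀ i → Atom i x ⇔ Atom i x′)
      atoms = bits Atom

      sameReach : ∀ {x x′} → proj₁ atoms x ≡ proj₁ atoms x′ → ∀ e → Reach t e x → Reach t e x′
      sameReach q e r with e′ , q′ , r′ ← to (proj₂ atoms q (c e)) (e , refl , r) = proj₁ (p q′) r′

      Meets : Fin (2 ℕ.^ N) → Pred (Env Δ) ℓ
      Meets j b = Σ[ x ∈ Point L M ] (proj₁ atoms x ≡ j × D t b x)

      reach-self : ∀ x b → Reach t (x ∷ b) x
      reach-self x b y n m with <.compare x y
      ... | tri< l _ _ = ⊥-elim (m l)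
      ... | tri≈ _ q _ = D-resp t b (K₊.∙.sym q) , D-resp t b q
      ... | tri> _ _ l = ⊥-elim (n l)

      included : ∀ {b b′} → (∀ j → Meets j b → Meets j b′) → ∀ {x} → D t b x → D t b′ x
      included {b} {b′} h {x} d with x′ , q , d′ ← h (proj₁ atoms x) (x , refl , d) with <.compare x x′
      ... | tri< l _ _ = proj₁ (sameReach (sym q) (x ∷ b′) (reach-self x b′) x′ (<.asym l) (<.irrefl K₊.∙.refl)) d′
      ... | tri≈ _ r _ = D-resp t b′ (K₊.∙.sym r) d′
      ... | tri> _ _ l = proj₂ (sameReach q (x′ ∷ b′) (reach-self x′ b′) x (<.asym l) (<.irrefl K₊.∙.refl)) d′

    setsBounded : AllBounded ConvexSubgroup → Bounded (λ t b b′ → D t b ≐ D t b′)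
    setsBounded bounded = let N , β = cutsBounded Reach reach-def reach-down bounded in
      _ , λ t f → setsColouring t (β t (reach-finite t f))

  Disjoint : ∀ {Γ Δ} → (Env Δ → Pred (Env Γ) ℓ) → Set ℓ
  Disjoint S = ∀ b b′ ρ → S b ρ → S b′ ρ → S b ≐ S b′

  -- The number of sets in the family is bounded by the number of projections to the first
  -- coordinate times the number of fibres over a point common to the sets with equal projection.
  familyBounded : AllBounded ConvexSubgroup → ∀ Γ {T : Set ℓ} {Δ} (S : T → Env Δ → Pred (Env Γ) ℓ) →
    Def (params T ⊗ Δ ⊗ Γ) (λ ((t , b) , ρ) → S t b ρ) →
    ∃[ N ] (∀ t → Disjoint (S t) → Finite (λ b b′ → S t b ≐ S t b′) → Colouring N (λ b b′ → S t b ≐ S t b′))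
  -- There is one empty tuple, hence two sets of empty tuples.
  familyBounded bounded [] S S-def = 2 , λ t _ _ →
    recolour {Q = λ b b′ → S t b ≐ S t b′} (λ q → (λ { {[]} → to q }) , (λ { {[]} → from q })) (bit (λ b → S t b []))
  familyBounded bounded (s ∷ Γ) {T} {Δ} S S-def =
    combined (LineSets.setsBounded D D-def bounded) (familyBounded bounded Γ S′ S′-def)
    where
    -- The point `a` joins the index of the family, so the induction hypothesis bounds the fibres
    -- over all points at once.
    S′ : T × Point L M → Env Δ → Pred (Env Γ) ℓ
    S′ (t , a) b ρ = S t b (a ∷ ρ)

    S′-def : Def (params (T × Point L M) ⊗ Δ ⊗ Γ) (λ ((t , b) , ρ) → S′ t b ρ)
    S′-def = pull (λ (((t , a) , b) , ρ) → (t , b) , a ∷ ρ)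
      (λ { (inj₁ (inj₁ f)) → inj₁ (inj₁ (λ (t , _) → f t)) ; (inj₁ (inj₂ v)) → inj₁ (inj₂ v)
         ; (inj₂ (here refl)) → inj₁ (inj₁ proj₂) ; (inj₂ (there v)) → inj₂ v })
      (λ { (inj₁ (inj₁ f)) _ → refl ; (inj₁ (inj₂ v)) _ → refl
         ; (inj₂ (here refl)) _ → refl ; (inj₂ (there v)) _ → refl }) S-def

    D : T → Env Δ → Pred (Point L M) ℓ
    D t b a = Σ[ ρ ∈ Env Γ ] S t b (a ∷ ρ)

    D-def : Def (params T ⊗ Δ ▹ pt) (λ ((t , b) , a) → D t b a)
    D-def = Def-∃* Γ (pull (λ (((t , b) , a) , ρ) → (t , b) , a ∷ ρ)
      (λ { (inj₁ v) → inj₁ (inj₁ v) ; (inj₂ (here refl)) → inj₁ (inj₂ refl) ; (inj₂ (there v)) → inj₂ v })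
      (λ { (inj₁ v) _ → refl ; (inj₂ (here refl)) _ → refl ; (inj₂ (there v)) _ → refl }) S-def)

    Result : ℕ → Set ℓ
    Result N = ∀ t → Disjoint (S t) → Finite (λ b b′ → S t b ≐ S t b′) → Colouring N (λ b b′ → S t b ≐ S t b′)

    combined : Bounded (λ t b b′ → D t b ≐ D t b′) →
      ∃[ N ] (∀ t → Disjoint (S′ t) → Finite (λ b b′ → S′ t b ≐ S′ t b′) →
                    Colouring N (λ b b′ → S′ t b ≐ S′ t b′)) →
      ∃[ N ] Result N
    combined (N , β) (N′ , β′) = _ , λ t disjoint (k , c , p) →
      let fibre : ∀ a → Colouring N′ (λ b b′ → S′ (t , a) b ≐ S′ (t , a) b′)
          fibre a = β′ (t , a)
            (λ b b′ ρ x y → let i , j = disjoint b b′ (a ∷ ρ) x y in i , j)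
            (k , c , λ q → let i , j = p q in i , j)
      in glue (β t (k , c , λ q → let i , j = p q in (λ (ρ , x) → ρ , i x) , (λ (ρ , x) → ρ , j x)))
              (λ b₀ → fibres t disjoint b₀ fibre em)
      where
      fibres : ∀ t → Disjoint (S t) → ∀ b₀ → (∀ a → Colouring N′ (λ b b′ → S′ (t , a) b ≐ S′ (t , a) b′)) →
               Dec (Σ[ a ∈ Point L M ] D t b₀ a) →
               Colouring {Σ[ b ∈ Env Δ ] D t b₀ ≐ D t b} (suc N′) (λ b b′ → S t (proj₁ b) ≐ S t (proj₁ b′))
      -- All sets considered here have `a` in their projection. Equal fibres over `a` therefore
      -- share a tuple, and sets that meet are equal.
      fibres t disjoint b₀ fibre (yes (a , d)) = (λ (b , _) → suc (proj₁ (fibre a) b)) ,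
        λ { {b , i , _} {b′ , _} q → let ρ , x = i d in
            disjoint b b′ (a ∷ ρ) x (proj₁ (proj₂ (fibre a) (suc-injective q)) x) }
      -- Sets with empty projection are empty; the added colour `zero` serves this case.
      fibres t disjoint b₀ fibre (no n) = (λ _ → zero) ,
        λ { {b , _ , j} {b′ , _ , j′} _ →
            (λ { {a ∷ ρ} x → ⊥-elim (n (a , j (ρ , x))) }) , (λ { {a ∷ ρ} x → ⊥-elim (n (a , j′ (ρ , x))) }) }

-- Counting the elements of a setoid

module Counting {ℓ : Level} (em : ExcludedMiddle ℓ) (S : Setoid ℓ ℓ) where
  open Setoid S renaming (Carrier to A; refl to ≈-refl; sym to ≈-sym; trans to ≈-trans)

  Size : ℕ → Set ℓ
  Size k = Inverse (≡.setoid (Fin k)) S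

  Points : ℕ → Set ℓ
  Points n = Injection (≡.setoid (Fin n)) S

  -- Distinct points are chosen greedily: either a further one exists or those found exhaust the
  -- setoid. This links `Infinite`, which denies a bijection with any `Fin k`, to `MoreThan`, which
  -- asks for an injection.
  points-or-size : ∀ n → Points n ⊎ (Σ[ k ∈ ℕ ] (k ℕ.< n × Size k))
  points-or-size zero = inj₁ (record { to = λ () ; cong = λ { {()} } ; injective = λ { {()} } })
  points-or-size (suc n) with points-or-size n
  ... | inj₂ (k , k<n , s) = inj₂ (k , ℕ.m<n⇒m<1+n k<n , s)
  ... | inj₁ ι = extend em
    where
    open Injection ι using (injective) renaming (to to point)
    extend : Dec (Σ[ x ∈ A ] (∀ i → ¬ point i ≈ x)) → Points (suc n) ⊎ (Σ[ k ∈ ℕ ] (k ℕ.< suc n × Size k))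
    extend (yes (x , fresh)) = inj₁ (record
      { to = λ { zero → x ; (suc i) → point i }
      ; cong = λ { refl → ≈-refl }
      ; injective = λ { {zero} {zero} _ → refl ; {zero} {suc j} q → ⊥-elim (fresh j (≈-sym q))
                      ; {suc i} {zero} q → ⊥-elim (fresh i q) ; {suc i} {suc j} q → cong suc (injective q) } })
    extend (no none) = inj₂ (n , ℕ.n<1+n n , record
      { to = point ; from = λ x → proj₁ (hit x)
      ; to-cong = λ { refl → ≈-refl }
      ; from-cong = λ {x} {y} q → injective (≈-trans (proj₂ (hit x)) (≈-trans q (≈-sym (proj₂ (hit y)))))
      ; inverse = (λ { {x} refl → proj₂ (hit x) }) ,
                  (λ {i} {y} q → injective (≈-trans (proj₂ (hit y)) q)) })
      where
      hit : ∀ x → Σ[ i ∈ Fin n ] point i ≈ x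
      hit x = decidable-stable em (λ m → none (x , λ i q → m (i , q)))

  Separating : ℕ → Set ℓ
  Separating N = Σ[ κ ∈ (A → Fin N) ] (∀ {x y} → κ x ≡ κ y → x ≈ y)

  separating⇒¬points : ∀ {N} → Separating N → ¬ Points (suc N)
  separating⇒¬points {N} (κ , sep) ι
    with i , j , i<j , q ← pigeonhole (ℕ.n<1+n N) (κ ∘ Injection.to ι) =
    Fin.<⇒≢ i<j (Injection.injective ι (sep q))

  size⇒separating : ∀ {k} → Size k → Separating k
  size⇒separating s = Inverse.from s , λ {x} {y} q →
    ≈-trans (≈-sym (Inverse.strictlyInverseˡ s x)) (≈-trans (Inverse.to-cong s q) (Inverse.strictlyInverseˡ s y))

  ¬points⇒separating : ∀ {N} → ¬ Points (suc N) → Separating N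
  ¬points⇒separating {N} n with points-or-size (suc N)
  ... | inj₁ ι = ⊥-elim (n ι)
  ... | inj₂ (k , ℕ.s≤s k≤N , s) = let κ , sep = size⇒separating s in
        (λ x → Fin.inject≤ (κ x) k≤N) , λ q → sep (inject≤-injective k≤N k≤N _ _ q)

  infinite⇒points : ¬ (∃[ k ] Size k) → ∀ n → Points n
  infinite⇒points inf n with points-or-size n
  ... | inj₁ ι           = ι
  ... | inj₂ (k , _ , s) = ⊥-elim (inf (k , s))

-- Convex subgroups and valuation rings as imaginaries

module Codes {ℓ : Level} (em : ExcludedMiddle ℓ) (L : Language ℓ) (M : Structure (oneSorted L))
         (G : ExpandsOrderedGroup L M) (sat : ℵ₀-Saturated M) (wom : WeaklyOMinimal L M G) where
  open Structure M
  open Definability em M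
  open Imaginaries em M Unit.tt
  open Colouring em
  open Bounded em
  open WeakOMinimality em L M G sat wom
  open Additive em L M G sat wom
  private
    module Meq = Structure (M ᵉᑫ)
    module Dᵉ  = Definability em (M ᵉᑫ)

  ≐-refl : ∀ {A : Set ℓ} {P : Pred A ℓ} → P ≐ P
  ≐-refl = id , id

  ≐-sym : ∀ {A : Set ℓ} {P Q : Pred A ℓ} → P ≐ Q → Q ≐ P
  ≐-sym (i , j) = j , i

  ≐-trans : ∀ {A : Set ℓ} {P Q R : Pred A ℓ} → P ≐ Q → Q ≐ R → P ≐ R
  ≐-trans (i , j) (i′ , j′) = i′ ∘ i , j ∘ j′

  module CodeSort {Γ} (ψ : Formula (oneSorted L) (pt ∷ Γ)) where

    V : Env Γ → Pred (Point L M) ℓ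
    V e x = Sat M ψ (x ∷ e)

    V-def : Def (plain Γ ▹ pt) (λ (e , x) → V e x)
    V-def = fibre-def ψ

    -- A set is coded by the class of the tuples that define it, so the quotient by `χ` makes coding
    -- injective.
    Code : Set ℓ
    Code = Σ[ χ ∈ Formula (oneSorted L) (Γ ++ Γ) ] (∀ a b → Sat M χ (++⁺ a b) ⇔ (V a ≐ V b))

    code : Code
    code = encode (toFormula (Def-≐ (V-def [ left ↑ ,, new ]) (V-def [ right ↑ ,, new ])))
      where
      left : plain (Γ ++ Γ) ⇒ plain Γ
      left = record { ⟦_⟧ = λ ρ → proj₁ (++⁻ Γ ρ) ; ren = ∈-++⁺ˡ ; nat = λ v ρ → lookup-++⁻ˡ Γ ρ v }
      right : plain (Γ ++ Γ) ⇒ plain Γ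
      right = record { ⟦_⟧ = λ ρ → proj₂ (++⁻ Γ ρ) ; ren = ∈-++⁺ʳ Γ ; nat = λ v ρ → lookup-++⁻ʳ Γ ρ v }

      encode : Σ[ χ ∈ Formula (oneSorted L) (Γ ++ Γ) ]
               (∀ ρ → (V (proj₁ (++⁻ Γ ρ)) ≐ V (proj₂ (++⁻ Γ ρ))) ⇔ Sat M χ ρ) → Code
      encode (χ , h) = χ , λ a b → mk⇔
        (λ p → subst (λ (a , b) → V a ≐ V b) (++⁻∘++⁺ a b) (from (h (++⁺ a b)) p))
        (λ p → to (h (++⁺ a b)) (subst (λ (a , b) → V a ≐ V b) (sym (++⁻∘++⁺ a b)) p))

    module _ (coded : Code) where
      private
        χ      = proj₁ coded
        χ-spec = proj₂ coded

      equivalence : DefinesEquivalence M χ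
      equivalence = record
        { refl  = λ {a} → from (χ-spec a a) ≐-refl
        ; sym   = λ {a} {b} p → from (χ-spec b a) (≐-sym (to (χ-spec a b) p))
        ; trans = λ {a} {b} {c} p q → from (χ-spec a c) (≐-trans (to (χ-spec a b) p) (to (χ-spec b c) q))
        }

      Q : EqSort M
      Q = quot Γ χ equivalence

      -- A property of the parameter tuple is a property of the code once it depends only on the set
      -- that the tuple defines.
      Def-code : ∀ {C Δ} {P : Env Γ → Env Δ → Set ℓ} (v : Dᵉ.Ctx.Var C Q) (r : All (λ s → Dᵉ.Ctx.Var C (home s)) Δ) →
        Def (plain Γ ⊗ Δ) (λ (e , ρ) → P e ρ) → (∀ {e e′ ρ} → V e ≐ V e′ → P e ρ → P e′ ρ) →
        Dᵉ.Def C (λ a → P (Dᵉ.Ctx.at C v a) (homeValues C r a))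
      Def-code {C} {Δ} {P} v r d resp = convert (toFormula (d [ split ]))
        where
        split : plain (Γ ++ Δ) ⇒ plain Γ ⊗ Δ
        split = record
          { ⟦_⟧ = λ ρ → ++⁻ Γ ρ
          ; ren = λ { (inj₁ v) → ∈-++⁺ˡ v ; (inj₂ v) → ∈-++⁺ʳ Γ v }
          ; nat = λ { (inj₁ v) ρ → lookup-++⁻ˡ Γ ρ v ; (inj₂ v) ρ → lookup-++⁻ʳ Γ ρ v } }
        convert : Σ[ φ ∈ Formula (oneSorted L) (Γ ++ Δ) ]
                  (∀ ρ → P (proj₁ (++⁻ Γ ρ)) (proj₂ (++⁻ Γ ρ)) ⇔ Sat M φ ρ) →
                  Dᵉ.Def C (λ a → P (Dᵉ.Ctx.at C v a) (homeValues C r a))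
        convert (φ , h) = Dᵉ.Def-⇔ (λ a → mk⇔ (from (h′ _ _)) (to (h′ _ _)))
          (Def-quot v r φ (λ e e′ ρ q p → to (h′ e′ ρ) (resp (to (χ-spec e e′) q) (from (h′ e ρ) p))))
          where
          h′ : ∀ e ρ → P e ρ ⇔ Sat M φ (++⁺ e ρ)
          h′ e ρ = mk⇔
            (λ p → to (h (++⁺ e ρ)) (subst (λ (e , ρ) → P e ρ) (sym (++⁻∘++⁺ e ρ)) p))
            (λ p → subst (λ (e , ρ) → P e ρ) (++⁻∘++⁺ e ρ) (from (h (++⁺ e ρ)) p))

  module _ (𝓒 : Pred (Pred (Point L M) ℓ) ℓ)
           (𝓒-resp : ∀ {H H′} → H ≐ H′ → 𝓒 H → 𝓒 H′)
           (𝓒-def : ∀ {C P} → Def (C ▹ pt) P → Def C (λ a → 𝓒 (λ x → P (a , x)))) where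

    module _ (finite : CollectionUniformFiniteness L M (onLine L M (λ H → DefinableSubset L M H × 𝓒 H)))
             {Δ Θ} (ψ : Formula (oneSorted L) (pt ∷ Δ ++ Θ)) where
      open CodeSort {Δ ++ Θ} ψ

      private
        Γ = Δ ++ Θ

      module _ (coded : Code) where

        -- The codes for all parameters at once, so that every `Y θ` lies inside one and the same
        -- set of imaginaries.
        X : Pred (Meq.Env (Q coded ∷ [])) ℓ
        X qs = 𝓒 (V (All.head qs))

        X-def : Definable (M ᵉᑫ) X
        X-def = Dᵉ.plainDefinable (Dᵉ.Def-⇔ (λ { (q ∷ []) → mk⇔ id id })
          (Def-code coded {Dᵉ.plain (Q coded ∷ [])} {[]} {λ e _ → 𝓒 (V e)} (here refl) []
            (𝓒-def V-def [ idᶜ ↑* ]) 𝓒-resp))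

        codesOf𝓒 : ImaginariesFrom L M (onLine L M (λ H → DefinableSubset L M H × 𝓒 H)) X
        codesOf𝓒 = 1 , (λ qs ms → X qs × V (All.head qs) (All.head ms)) ,
          Dᵉ.plainDefinable (Dᵉ.Def-⇔ (λ { (q ∷ x ∷ []) → mk⇔ id id })
            (Def-code coded {Dᵉ.plain (Q coded ∷ homeSort L M ∷ [])} {pt ∷ []} {λ e ρ → 𝓒 (V e) × V e (All.head ρ)}
              (here refl) (there (here refl) ∷ [])
              (Def-⇔ (λ { (e , x ∷ []) → mk⇔ id id })
                (Def-× (𝓒-def V-def [ idᶜ ↑* ]) (V-def [ idᶜ ↑* ,, inj₂ (here refl) ])))
              (λ q (p , v) → 𝓒-resp q p , proj₁ q v))) ,
          (λ qs ms → proj₁) ,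
          (λ { (q ∷ []) (q′ ∷ []) c c′ (i , j) →
               from (proj₂ coded q q′) ((λ {x} v → proj₂ (i {x ∷ []} (c , v))) ,
                                         (λ {x} v → proj₂ (j {x ∷ []} (c′ , v)))) ∷ [] }) ,
          (λ { (q ∷ []) c → definableSubset (Def-× (𝓒-def V-def [ idᶜ ↑ ]) V-def) q ,
                             𝓒-resp ((λ v → c , v) , proj₂) c })

        -- For fixed `θ` and varying `b`, the elements are the classes that a colouring of the
        -- family has to separate.
        Y : Meq.Env (map home Θ) → Pred (Meq.Env (Q coded ∷ [])) ℓ
        Y θ qs = X qs × (Σ[ b ∈ Env Δ ] V (All.head qs) ≐ V (++⁺ b (fromHome θ)))

        Y-def : DefinableRel (M ᵉᑫ) {Q coded ∷ []} {map home Θ} (λ qs θ → Unit.⊤ {ℓ} × Y θ qs)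
        Y-def = Dᵉ.plainDefinable (Dᵉ.Def-⇔
          (λ { (q ∷ θ) → mk⇔ (λ (c , b , s) → Unit.tt , c , b , subst (λ σ → V q ≐ V (++⁺ b σ)) (eq q θ) s)
                             (λ (_ , c , b , s) → c , b , subst (λ σ → V q ≐ V (++⁺ b σ)) (sym (eq q θ)) s) })
          (Def-code coded {C} {Θ} {λ e σ → 𝓒 (V e) × (Σ[ b ∈ Env Δ ] V e ≐ V (++⁺ b σ))}
            (here refl) r
            (Def-× (𝓒-def V-def [ idᶜ ↑* ]) (Def-∃* Δ (Def-≐ (V-def [ idᶜ ↑* ↑* ↑ ,, new ]) (V-def [ join ↑ ,, new ]))))
            (λ q (c , b , s) → 𝓒-resp q c , b , ≐-trans (≐-sym q) s)))
          where
          C = Dᵉ.plain (Q coded ∷ map home Θ)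
          r : All (λ s → Dᵉ.Ctx.Var C (home s)) Θ
          r = All.tabulate (λ v → there (home∈ v))
          eq : ∀ q θ → homeValues C r (q ∷ θ) ≡ fromHome θ
          eq q θ = lookup-ext (λ v → trans (lookup-map r v)
            (trans (cong (All.lookup (q ∷ θ)) (lookup-tabulate (λ v → there (home∈ v)) v)) (lookup-home θ v)))
          join : plain Γ ⊗ Θ ⊗ Δ ⇒ plain Γ
          join = record
            { ⟦_⟧ = λ ((_ , σ) , b) → ++⁺ b σ
            ; ren = λ v → place (∈-++⁻ Δ v)
            ; nat = λ v ((e , σ) , b) → trans (lookup-split b σ v) (placed e σ b (∈-++⁻ Δ v)) }
            where
            place : ∀ {s} → s ∈ Δ ⊎ s ∈ Θ → Var (plain Γ ⊗ Θ ⊗ Δ) s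
            place (inj₁ v) = inj₂ v
            place (inj₂ v) = inj₁ (inj₂ v)
            placed : ∀ e σ b {s} (v : s ∈ Δ ⊎ s ∈ Θ) →
                     [ All.lookup b , All.lookup σ ]′ v ≡ at (plain Γ ⊗ Θ ⊗ Δ) (place v) ((e , σ) , b)
            placed e σ b (inj₁ v) = refl
            placed e σ b (inj₂ v) = refl

        bound : ∃[ n ] (∀ θ → Unit.⊤ {ℓ} → Infinite (M ᵉᑫ) (Y θ) ⇔ MoreThan (M ᵉᑫ) n (Y θ))
        bound = finite X X-def codesOf𝓒 {map home Θ} (λ _ → Unit.⊤) Y
          (Dᵉ.plainDefinable (Dᵉ.Def-⊤ (homeSort L M))) Y-def (λ _ _ _ → proj₁)

        module _ {T : Set ℓ} (H : T → Env Δ → Pred (Point L M) ℓ) (e : T → Env Θ)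
                 (H-spec : ∀ t b → H t b ≐ V (++⁺ b (e t))) (H-mem : ∀ t b → 𝓒 (H t b)) where

          private
            spec : ∀ t b → H t b ≐ V (++⁺ b (fromHome (toHome (e t))))
            spec t b = subst (λ σ → H t b ≐ V (++⁺ b σ)) (sym (from∘to-home (e t))) (H-spec t b)

          module Members t = Counting em (subsetSetoid (M ᵉᑫ) (Y (toHome (e t))))

          member : ∀ t → Env Δ → Σ (Meq.Env (Q coded ∷ [])) (Y (toHome (e t)))
          member t b = ++⁺ b (fromHome (toHome (e t))) ∷ [] , 𝓒-resp (spec t b) (H-mem t b) , b , ≐-refl

          -- A finite family has finitely many codes, so the equivalence rules out more than `n` of
          -- them, and separating the codes colours the family.
          familyColouring : ∀ t {n} → Infinite (M ᵉᑫ) (Y (toHome (e t))) ⇔ MoreThan (M ᵉᑫ) n (Y (toHome (e t))) →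
                            Finite (λ b b′ → H t b ≐ H t b′) → Colouring n (λ b b′ → H t b ≐ H t b′)
          familyColouring t {n} h (k , c , p) =
            let κ , sep = Members.¬points⇒separating t (λ ι → Members.separating⇒¬points t separating
                            (Members.infinite⇒points t (from h ι) (suc k)))
            in (λ b → κ (member t b)) , λ {b} {b′} q → decode b b′ (sep q)
            where
            decode : ∀ b b′ → proj₁ (member t b) Meq.≋ proj₁ (member t b′) → H t b ≐ H t b′
            decode b b′ (q ∷ []) = ≐-trans (spec t b) (≐-trans (to (proj₂ coded _ _) q) (≐-sym (spec t b′)))
            encode : ∀ {x y : Σ (Meq.Env (Q coded ∷ [])) (Y (toHome (e t)))} →
                     c (proj₁ (proj₂ (proj₂ x))) ≡ c (proj₁ (proj₂ (proj₂ y))) → proj₁ x Meq.≋ proj₁ y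
            encode {q ∷ [] , _ , b , s} {q′ ∷ [] , _ , b′ , s′} r =
              from (proj₂ coded q q′) (≐-trans s (≐-trans (≐-sym (spec t b)) (≐-trans (p r)
                (≐-trans (spec t b′) (≐-sym s′))))) ∷ []
            separating : Members.Separating t k
            separating = (λ (_ , _ , b , _) → c b) , λ {x} {y} → encode {x} {y}

    allBounded : CollectionUniformFiniteness L M (onLine L M (λ H → DefinableSubset L M H × 𝓒 H)) → AllBounded 𝓒
    -- The data of `t` that matter form a tuple of fixed length in `M`; a bound for all such tuples
    -- is a bound for all `t`.
    allBounded finite {T} {Δ} H H-def H-mem = unfold (normalize (H-def [ shape ]))
      where
      shape : params T ⊗ (pt ∷ Δ) ⇒ params T ⊗ Δ ▹ pt
      shape = record
        { ⟦_⟧ = λ (t , e) → (t , All.tail e) , All.head e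
        ; ren = λ { (inj₁ (inj₁ f)) → inj₁ f ; (inj₁ (inj₂ v)) → inj₂ (there v) ; (inj₂ refl) → inj₂ (here refl) }
        ; nat = λ { (inj₁ (inj₁ f)) _ → refl ; (inj₁ (inj₂ v)) (_ , x ∷ _) → refl ; (inj₂ refl) (_ , x ∷ _) → refl } }
      unfold : Σ[ Θ ∈ List _ ] Σ[ ψ ∈ Formula (oneSorted L) (pt ∷ Δ ++ Θ) ] Σ[ q ∈ All (Var (params T)) Θ ]
               (∀ t e → H t (All.tail e) (All.head e) ⇔ Sat M ψ (++⁺ e (values (params T) q t))) →
               Bounded (λ t b b′ → H t b ≐ H t b′)
      unfold (Θ , ψ , q , h) = result (CodeSort.code ψ)
        where
        result : CodeSort.Code ψ → Bounded (λ t b b′ → H t b ≐ H t b′)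
        result coded = finish (bound finite ψ coded)
          where
          finish : ∃[ n ] (∀ θ → Unit.⊤ {ℓ} →
                     Infinite (M ᵉᑫ) (Y finite ψ coded θ) ⇔ MoreThan (M ᵉᑫ) n (Y finite ψ coded θ)) →
                   Bounded (λ t b b′ → H t b ≐ H t b′)
          finish (n , bnd) = n , λ t → familyColouring finite ψ coded H (values (params T) q)
            (λ t b → (λ {x} → to (h t (x ∷ b))) , (λ {x} → from (h t (x ∷ b)))) H-mem t
            (bnd (toHome (values (params T) q t)) Unit.tt)

-- From `M ᵉᑫ` to tuples of representatives in `M`

module Transfer {ℓ : Level} (em : ExcludedMiddle ℓ) {Sg : Signature ℓ} (M : Structure Sg)
                (s₀ : Signature.Sort Sg) where
  open Signature Sg
  private
    module M   = Structure M
    module Meq = Structure (M ᵉᑫ)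
    module Dᵉ  = Definability em (M ᵉᑫ)
  open Definability em M
  open Imaginaries em M s₀

  transfer : ∀ {C Cᵉ P} (f : Pt C → Dᵉ.Ctx.Pt Cᵉ) (q : ∀ {s} → Dᵉ.Ctx.Var Cᵉ s → All (Var C) (flat s)) →
    (∀ {s} (v : Dᵉ.Ctx.Var Cᵉ s) a → unrep s (values C (q v) a) ≡ Dᵉ.Ctx.at Cᵉ v (f a)) →
    Dᵉ.Def Cᵉ P → Def C (λ a → P (f a))
  transfer {C} {Cᵉ} f q eq (Γ , φ , r , h) = Def-⇔
    (λ a → mk⇔ (λ p → from (h (f a)) (subst (Sat (M ᵉᑫ) φ) (e a) p))
               (λ p → subst (Sat (M ᵉᑫ) φ) (sym (e a)) (to (h (f a)) p)))
    (Def-Sat (All.map q r) φ)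
    where
    e : ∀ a → eqValues C (All.map q r) a ≡ Dᵉ.values Cᵉ r (f a)
    e a = trans (map-∘ r) (map-cong r (λ v → eq v a))

  flats : List (EqSort M) → List Sort
  flats []      = []
  flats (s ∷ Γ) = flat s ++ flats Γ

  unflat : ∀ Γ → M.Env (flats Γ) → Meq.Env Γ
  unflat []      ρ = []
  unflat (s ∷ Γ) ρ = unrep s (proj₁ (++⁻ (flat s) ρ)) ∷ unflat Γ (proj₂ (++⁻ (flat s) ρ))

  reflat : ∀ Γ → Meq.Env Γ → M.Env (flats Γ)
  reflat []      []      = []
  reflat (s ∷ Γ) (x ∷ ρ) = ++⁺ (rep s x) (reflat Γ ρ)

  unflat-reflat : ∀ Γ ρ → unflat Γ (reflat Γ ρ) ≡ ρ
  unflat-reflat []      []      = refl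
  unflat-reflat (s ∷ Γ) (x ∷ ρ) = trans
    (cong (λ (σ , τ) → unrep s σ ∷ unflat Γ τ) (++⁻∘++⁺ (rep s x) (reflat Γ ρ)))
    (cong₂ _∷_ (unrep-rep s x) (unflat-reflat Γ ρ))

  index : ∀ {s Γ} → s ∈ Γ → ∀ {s′} → s′ ∈ flat s → s′ ∈ flats Γ
  index (here refl) w = ∈-++⁺ˡ w
  index (there {x = s} v) w = ∈-++⁺ʳ (flat s) (index v w)

  lookup-index : ∀ {s Γ} (ρ : M.Env (flats Γ)) (v : s ∈ Γ) {s′} (w : s′ ∈ flat s) →
                 All.lookup ρ (index v w) ≡ All.lookup (rep s (All.lookup (unflat Γ ρ) v)) w
  lookup-index {s} {s ∷ Γ} ρ (here refl) w = trans (sym (lookup-++⁻ˡ (flat s) ρ w))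
    (cong (λ σ → All.lookup σ w) (sym (rep-unrep s _)))
  lookup-index {Γ = s′ ∷ Γ} ρ (there v) w = trans (sym (lookup-++⁻ʳ (flat s′) ρ (index v w)))
    (lookup-index (proj₂ (++⁻ (flat s′) ρ)) v w)

  Def-unflat : ∀ {T : Set ℓ} {Γ} {P : (T × Meq.Env Γ) × Meq.Env Γ → Set ℓ} →
    Dᵉ.Def (Dᵉ.params T Dᵉ.⊗ Γ Dᵉ.⊗ Γ) P →
    Def (params T ⊗ flats Γ ⊗ flats Γ) (λ ((t , ρ) , σ) → P ((t , unflat Γ ρ) , unflat Γ σ))
  Def-unflat {T} {Γ} = transfer {C} {Dᵉ.params T Dᵉ.⊗ Γ Dᵉ.⊗ Γ} (λ ((t , ρ) , σ) → (t , unflat Γ ρ) , unflat Γ σ)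
    (λ {s} v → All.tabulate (coordinate {s} v))
    (λ { {s} (inj₁ (inj₁ g)) a → at-rep s (coordinate {s} (inj₁ (inj₁ g))) a (λ w → refl)
       ; {s} (inj₁ (inj₂ v)) a@((_ , ρ) , _) → at-rep s (coordinate {s} (inj₁ (inj₂ v))) a (lookup-index ρ v)
       ; {s} (inj₂ v) a@(_ , σ) → at-rep s (coordinate {s} (inj₂ v)) a (lookup-index σ v) })
    where
    C = params T ⊗ flats Γ ⊗ flats Γ
    coordinate : ∀ {s} → Dᵉ.Ctx.Var (Dᵉ.params T Dᵉ.⊗ Γ Dᵉ.⊗ Γ) s → ∀ {s′} → s′ ∈ flat s → Var C s′
    coordinate {s} (inj₁ (inj₁ g)) w = inj₁ (inj₁ (λ t → All.lookup (rep s (g t)) w))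
    coordinate (inj₁ (inj₂ v)) w = inj₁ (inj₂ (index v w))
    coordinate (inj₂ v)        w = inj₂ (index v w)
    at-rep : ∀ s {x} (f : ∀ {s′} → s′ ∈ flat s → Var C s′) a →
             (∀ {s′} (w : s′ ∈ flat s) → at C (f w) a ≡ All.lookup (rep s x) w) →
             unrep s (values C (All.tabulate f) a) ≡ x
    at-rep s {x} f a h = trans
      (cong (unrep s) (lookup-ext (λ w → trans (lookup-map (All.tabulate f) w)
        (trans (cong (λ v → at C v a) (lookup-tabulate f w)) (h w)))))
      (unrep-rep s x)

-- Uniform finiteness of `M ᵉᑫ`

module Finiteness {ℓ : Level} (em : ExcludedMiddle ℓ) (L : Language ℓ) (M : Structure (oneSorted L))
         (G : ExpandsOrderedGroup L M) (sat : ℵ₀-Saturated M) (wom : WeaklyOMinimal L M G) where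
  open Structure M
  open Definability em M
  open Colouring em
  open Bounded em
  open WeakOMinimality em L M G sat wom
  open Additive em L M G sat wom
  open Families em L M G sat wom
  open Codes em L M G sat wom using (allBounded)
  open Transfer em M Unit.tt
  open G using (_≈_; _<_; _+_; -_; 0#)
  private
    module Meq = Structure (M ᵉᑫ)
    module Dᵉ  = Definability em (M ᵉᑫ)

  module _ (bounded : AllBounded ConvexSubgroup) {Γ Θ} (T : Pred (Meq.Env Θ) ℓ)
           (Y : Meq.Env Θ → Pred (Meq.Env Γ) ℓ)
           (Y-def : DefinableRel (M ᵉᑫ) {Γ} {Θ} (λ x t → T t × Y t x)) where

    private
      -- The set of all representatives of the element given by `b` if it belongs to `Y t`, and the
      -- empty set otherwise, so that `b` may range over all tuples.
      S : Meq.Env Θ → Env (flats Γ) → Pred (Env (flats Γ)) ℓ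
      S t b c = (T t × Y t (unflat Γ b)) × unflat Γ b Meq.≋ unflat Γ c

      C = Dᵉ.params (Meq.Env Θ) Dᵉ.⊗ Γ Dᵉ.⊗ Γ

      joined : C Dᵉ.⇒ Dᵉ.params (Unit.⊤ {ℓ}) Dᵉ.⊗ (Γ ++ Θ)
      joined = record
        { ⟦_⟧ = λ ((t , x) , _) → Unit.tt , ++⁺ x t
        ; ren = λ { (inj₁ g) → inj₁ (inj₁ (λ _ → g Unit.tt)) ; (inj₂ v) → place (∈-++⁻ Γ v) }
        ; nat = λ { (inj₁ g) _ → refl ; (inj₂ v) a@((t , x) , _) → trans (lookup-split x t v) (placed a (∈-++⁻ Γ v)) } }
        where
        place : ∀ {s} → s ∈ Γ ⊎ s ∈ Θ → Dᵉ.Ctx.Var C s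
        place (inj₁ v) = inj₁ (inj₂ v)
        place (inj₂ v) = inj₁ (inj₁ (λ t → All.lookup t v))
        placed : ∀ (a : Dᵉ.Ctx.Pt C) {s} (v : s ∈ Γ ⊎ s ∈ Θ) →
                 [ All.lookup (proj₂ (proj₁ a)) , All.lookup (proj₁ (proj₁ a)) ]′ v ≡ Dᵉ.Ctx.at C (place v) a
        placed a (inj₁ v) = refl
        placed a (inj₂ v) = refl

      members : Dᵉ.Def C (λ ((t , x) , _) → T t × Y t x)
      members = Dᵉ.Def-⇔
        (λ ((t , x) , _) → mk⇔ (subst (λ (x , t) → T t × Y t x) (++⁻∘++⁺ x t))
                               (subst (λ (x , t) → T t × Y t x) (sym (++⁻∘++⁺ x t))))
        (Dᵉ._[_] {P = λ (_ , ρ) → uncurry (λ x t → T t × Y t x) (++⁻ Γ ρ)} (Dᵉ.fromDefinable Y-def) joined)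

      equal : Dᵉ.Def C (λ ((_ , x) , y) → x Meq.≋ y)
      equal = Dᵉ.Def-⇔ (λ ((t , x) , y) → mk⇔ (subst₂ (blockˡ ((t , x) , y)) (blockʳ ((t , x) , y)))
                                                (subst₂ (sym (blockˡ ((t , x) , y))) (sym (blockʳ ((t , x) , y)))))
        (Dᵉ.Def-≋ (homeSort L M) firsts seconds)
        where
        firsts seconds : All (Dᵉ.Ctx.Var C) Γ
        firsts  = All.tabulate (λ v → inj₁ (inj₂ v))
        seconds = All.tabulate (λ v → inj₂ v)
        subst₂ : ∀ {x x′ y y′ : Meq.Env Γ} → x ≡ x′ → y ≡ y′ → x Meq.≋ y → x′ Meq.≋ y′
        subst₂ refl refl e = e
        blockˡ : ∀ a → Dᵉ.values C firsts a ≡ proj₂ (proj₁ a)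
        blockˡ a = lookup-ext (λ v → trans (lookup-map firsts v)
          (cong (λ w → Dᵉ.Ctx.at C w a) (lookup-tabulate {P = Dᵉ.Ctx.Var C} (λ v → inj₁ (inj₂ v)) v)))
        blockʳ : ∀ a → Dᵉ.values C seconds a ≡ proj₂ a
        blockʳ a = lookup-ext (λ v → trans (lookup-map seconds v)
          (cong (λ w → Dᵉ.Ctx.at C w a) (lookup-tabulate {P = Dᵉ.Ctx.Var C} inj₂ v)))

      S-def : Def (params (Meq.Env Θ) ⊗ flats Γ ⊗ flats Γ) (λ ((t , b) , c) → S t b c)
      S-def = Def-unflat {P = λ ((t , x) , y) → (T t × Y t x) × x Meq.≋ y} (Dᵉ.Def-× members equal)

      ≋-sym : ∀ {x y : Meq.Env Γ} → x Meq.≋ y → y Meq.≋ x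
      ≋-sym = tupleEq-sym Meq.sortSetoid

      ≋-trans : ∀ {x y z : Meq.Env Γ} → x Meq.≋ y → y Meq.≋ z → x Meq.≋ z
      ≋-trans = tupleEq-trans Meq.sortSetoid

      S-disjoint : ∀ t → Disjoint (S t)
      S-disjoint t b b′ c (y , q) (y′ , q′) =
        (λ (_ , r) → y′ , ≋-trans q′ (≋-trans (≋-sym q) r)) ,
        (λ (_ , r) → y , ≋-trans q (≋-trans (≋-sym q′) r))

      module Members t = Counting em (subsetSetoid (M ᵉᑫ) (Y t))

      S-finite : ∀ t → ∃[ k ] Members.Size t k → Finite (λ b b′ → S t b ≐ S t b′)
      -- The additional colour is that of the empty set.
      S-finite t (k , size) = ℕ.suc k , (λ b → colour b em) , λ {b} {b′} → same em em
        where
        κ = proj₁ (Members.size⇒separating t size)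
        sep = proj₂ (Members.size⇒separating t size)
        colour : ∀ b → Dec (Y t (unflat Γ b)) → Fin (ℕ.suc k)
        colour b (yes y) = suc (κ (unflat Γ b , y))
        colour b (no _)  = zero
        same : ∀ {b b′} (d : Dec (Y t (unflat Γ b))) (d′ : Dec (Y t (unflat Γ b′))) →
               colour b d ≡ colour b′ d′ → S t b ≐ S t b′
        same (yes y) (yes y′) q = let e = sep (suc-injective q) in
          (λ ((m , _) , r) → (m , y′) , ≋-trans (≋-sym e) r) ,
          (λ ((m , _) , r) → (m , y) , ≋-trans e r)
        same (no n) (no n′) q = (λ ((_ , y) , _) → ⊥-elim (n y)) , (λ ((_ , y) , _) → ⊥-elim (n′ y))

      separating : ∀ t {N} → T t → Colouring N (λ b b′ → S t b ≐ S t b′) → Members.Separating t N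
      separating t {N} m (c , p) = (λ (x , _) → c (reflat Γ x)) , λ { {x , y} {x′ , y′} q → decode x x′ y y′ (p q) }
        where
        decode : ∀ x x′ → Y t x → Y t x′ → S t (reflat Γ x) ≐ S t (reflat Γ x′) → x Meq.≋ x′
        decode x x′ y y′ (i , j)
          with _ , r ← i {reflat Γ x} ((m , subst (Y t) (sym (unflat-reflat Γ x)) y) , tupleEq-refl Meq.sortSetoid)
          rewrite unflat-reflat Γ x | unflat-reflat Γ x′ = ≋-sym r

      -- If `Y t` is finite, its elements are separated by the colours of their sets, so it has no
      -- `N + 1` points. An infinite set has any number of points.
      conclude : ∃[ N ] (∀ t → Disjoint (S t) → Finite (λ b b′ → S t b ≐ S t b′) →
                            Colouring N (λ b b′ → S t b ≐ S t b′)) →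
                 ∃[ n ] (∀ t → T t → Infinite (M ᵉᑫ) (Y t) ⇔ MoreThan (M ᵉᑫ) n (Y t))
      conclude (N , β) = N , λ t m → mk⇔
        (λ inf → Members.infinite⇒points t inf (ℕ.suc N))
        (λ ι size → Members.separating⇒¬points t (separating t m (β t (S-disjoint t) (S-finite t size))) ι)

    uniformBound : ∃[ n ] (∀ t → T t → Infinite (M ᵉᑫ) (Y t) ⇔ MoreThan (M ᵉᑫ) n (Y t))
    uniformBound = conclude (familyBounded bounded (flats Γ) S S-def)

  uniformFiniteness : AllBounded ConvexSubgroup → UniformFiniteness (M ᵉᑫ)
  uniformFiniteness bounded X X-def T Y T-def Y-def Y⊆X = uniformBound bounded T Y Y-def

  private
    group : Group ℓ ℓ
    group = record { isGroup = G.isGroup }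
  open GroupProperties group using (inverseʳ-unique; identityˡ-unique)
  open Group group using (∙-cong; identityˡ; inverseʳ) renaming (refl to ≈-refl; sym to ≈-sym; trans to ≈-trans)

  convex-resp : ∀ {H H′} → H ≐ H′ → Convex L M G H → Convex L M G H′
  convex-resp (i , j) c p q x<y y<z = i (c (j p) (j q) x<y y<z)

  subgroup-resp : ∀ {H H′} → H ≐ H′ → IsSubgroup L M G H → IsSubgroup L M G H′
  subgroup-resp (i , j) s = record
    { 0#-mem = i (IsSubgroup.0#-mem s)
    ; +-closed = λ p q → i (IsSubgroup.+-closed s (j p) (j q))
    ; -‿closed = λ p → i (IsSubgroup.-‿closed s (j p)) }

  module _ {C P} (P-def : Def (C ▹ pt) P) where
    private
      resp : ∀ a {x y} → x ≈ y → P (a , x) → P (a , y)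
      resp = Def-resp P-def

    convex-def : Def C (λ a → Convex L M G (λ x → P (a , x)))
    convex-def = Def-⇔
      (λ a → mk⇔ (λ h {x} {y} {z} p q l l′ → h x y z p q l l′) (λ h x y z → h {x} {y} {z}))
      (Def-∀ (Def-∀ (Def-∀ (Def-→ (P-def [ idᶜ ↑ ↑ ↑ ,, inj₁ (inj₁ new) ])
        (Def-→ (P-def [ idᶜ ↑ ↑ ↑ ,, new ])
        (Def-→ (inj₁ (inj₁ new) <ᵈ inj₁ new) (Def-→ (inj₁ new <ᵈ new) (P-def [ idᶜ ↑ ↑ ↑ ,, inj₁ new ]))))))))

    -- 0 is the only idempotent, which makes the conditions on 0 and on negatives first-order.
    subgroup-def : Def C (λ a → IsSubgroup L M G (λ x → P (a , x)))
    subgroup-def = Def-⇔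
      (λ a → mk⇔
        (λ (z , s , n) → record
          { 0#-mem = z 0# (identityˡ 0#)
          ; +-closed = λ {x} {y} p q → s x y (x + y) ≈-refl p q
          ; -‿closed = λ {x} p → n x (- x) (x + (- x)) ≈-refl
              (≈-trans (∙-cong (inverseʳ x) ≈-refl) (identityˡ _)) p })
        (λ s → let open IsSubgroup s in
          (λ x q → resp a (≈-sym (identityˡ-unique x x q)) 0#-mem) ,
          (λ x y z q p p′ → resp a q (+-closed p p′)) ,
          (λ x y z q q′ p → resp a (≈-sym (inverseʳ-unique x y (≈-trans q (identityˡ-unique z z q′)))) (-‿closed p))))
      (Def-× (Def-∀ (Def-→ (plusᵈ new new new) (P-def [ idᶜ ↑ ,, new ])))
      (Def-× (Def-∀ (Def-∀ (Def-∀ (Def-→ (plusᵈ (inj₁ (inj₁ new)) (inj₁ new) new)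
               (Def-→ (P-def [ idᶜ ↑ ↑ ↑ ,, inj₁ (inj₁ new) ]) (Def-→ (P-def [ idᶜ ↑ ↑ ↑ ,, inj₁ new ])
                      (P-def [ idᶜ ↑ ↑ ↑ ,, new ])))))))
             (Def-∀ (Def-∀ (Def-∀ (Def-→ (plusᵈ (inj₁ (inj₁ new)) (inj₁ new) new) (Def-→ (plusᵈ new new new)
               (Def-→ (P-def [ idᶜ ↑ ↑ ↑ ,, inj₁ (inj₁ new) ]) (P-def [ idᶜ ↑ ↑ ↑ ,, inj₁ new ])))))))))

  subgroups⇒uniform : CollectionUniformFiniteness L M (definableConvexSubgroups L M G) → UniformFiniteness (M ᵉᑫ)
  subgroups⇒uniform finite = uniformFiniteness (allBounded ConvexSubgroup
    (λ q (c , s) → (λ {x} {y} {z} → convex-resp q c {x} {y} {z}) , subgroup-resp q s)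
    (λ d → Def-× (convex-def d) (subgroup-def d)) finite)

  module _ (F : ExpandsOrderedField L M G) where
    open Multiplicative em L M G sat wom F
    private
      ring : CommutativeRing ℓ ℓ
      ring = record { isCommutativeRing = F.isCommutativeRing }
      module R = CommutativeRing ring
    open F using (_*_; 1#)

    valuation-resp : ∀ {O O′} → O ≐ O′ → IsValuationSubring L M G F O → IsValuationSubring L M G F O′
    valuation-resp (i , j) v = let open IsValuationSubring v in record
      { isSubgroup = subgroup-resp (i , j) isSubgroup
      ; 1#-mem     = i 1#-mem
      ; *-closed   = λ p q → i (*-closed (j p) (j q))
      ; valuation  = λ x y q → Sum.map i i (valuation x y q) }

    -- There need not be a symbol for 1, which is therefore described as the element `x` with
    -- `x * y ≈ y` for all `y`.
    valuation-def : ∀ {C P} → Def (C ▹ pt) P → Def C (λ a → IsValuationSubring L M G F (λ x → P (a , x)))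
    valuation-def {C} {P} P-def = Def-⇔
      (λ a → mk⇔
        (λ (s , o , m , v) → record
          { isSubgroup = s ; 1#-mem = o 1# R.*-identityˡ
          ; *-closed = λ {x} {y} p q → m x y (x * y) R.refl p q
          ; valuation = λ x y q → v x y 1# q R.*-identityˡ })
        (λ s → let open IsValuationSubring s in
          isSubgroup ,
          (λ x h → resp a (unit h) 1#-mem) ,
          (λ x y z q p p′ → resp a q (*-closed p p′)) ,
          (λ x y z q h → valuation x y (R.trans q (R.sym (unit h))))))
      (Def-× (subgroup-def P-def)
      (Def-× (Def-∀ (Def-→ (Def-∀ (timesᵈ (inj₁ new) new new)) (P-def [ idᶜ ↑ ,, new ])))
      (Def-× (Def-∀ (Def-∀ (Def-∀ (Def-→ (timesᵈ (inj₁ (inj₁ new)) (inj₁ new) new)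
               (Def-→ (P-def [ idᶜ ↑ ↑ ↑ ,, inj₁ (inj₁ new) ]) (Def-→ (P-def [ idᶜ ↑ ↑ ↑ ,, inj₁ new ])
                      (P-def [ idᶜ ↑ ↑ ↑ ,, new ])))))))
             (Def-∀ (Def-∀ (Def-∀ (Def-→ (timesᵈ (inj₁ (inj₁ new)) (inj₁ new) new)
               (Def-→ (Def-∀ (timesᵈ (inj₁ new) new new))
                      (Def-⊎ (P-def [ idᶜ ↑ ↑ ↑ ,, inj₁ (inj₁ new) ]) (P-def [ idᶜ ↑ ↑ ↑ ,, inj₁ new ]))))))))))
      where
      resp : ∀ a {x y} → x ≈ y → P (a , x) → P (a , y)
      resp = Def-resp P-def
      unit : ∀ {x} → (∀ y → x * y ≈ y) → 1# ≈ x
      unit {x} h = R.trans (R.sym (h 1#)) (R.*-identityʳ x)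

    valuationSubrings⇒uniform :
      CollectionUniformFiniteness L M (definableConvexValuationSubrings L M G F) → UniformFiniteness (M ᵉᑫ)
    valuationSubrings⇒uniform finite = uniformFiniteness (convexSubgroupsBounded (allBounded ConvexValuationSubring
      (λ q (c , v) → (λ {x} {y} {z} → convex-resp q c {x} {y} {z}) , valuation-resp q v)
      (λ d → Def-× (convex-def d) (valuation-def d)) finite))

theorem1 : ∀ {ℓ : Level} → ExcludedMiddle (Level.suc ℓ) →
    (L : Language ℓ) (M : Structure (oneSorted L)) (G : ExpandsOrderedGroup L M) →
    ℵ₀-Saturated M →
    WeaklyOMinimal L M G →
    (UniformFiniteness (M ᵉᑫ) ⇔
    CollectionUniformFiniteness L M (definableConvexSubgroups L M G))
    ×
    ((F : ExpandsOrderedField L M G) →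
    UniformFiniteness (M ᵉᑫ) ⇔
    CollectionUniformFiniteness L M (definableConvexValuationSubrings L M G F))
theorem1 {ℓ} em₊ L M G sat wom =
  mk⇔ (everywhere (definableConvexSubgroups L M G)) subgroups⇒uniform ,
  λ F → mk⇔ (everywhere (definableConvexValuationSubrings L M G F)) (valuationSubrings⇒uniform F)
  where
  em : ExcludedMiddle ℓ
  em = Dec.map′ lower lift em₊
  open Finiteness em L M G sat wom
  everywhere : ∀ 𝓓 → UniformFiniteness (M ᵉᑫ) → CollectionUniformFiniteness L M 𝓓
  everywhere 𝓓 uf X X-def _ = uf X X-def
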